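{- In the language of second-order arithmetic, let $\exists X\,\forall Y\,\Psi(X,Y)$ be a $\Sigma^1_2$ sentence such that $\Psi(X,Y)$ is a $\Pi^0_3$ formula. If $\mathrm{RCA}_0 + \exists X\,\forall Y\,\Psi(X,Y)$ is consistent, then $\mathrm{RCA}_0 + \exists X\,\forall Y\,\Psi(X,Y)$ does not prove $\mathrm{B}\Sigma^0_2$.
   Context: $\mathrm{RCA}_0$ is the standard base system of reverse mathematics (basic arithmetic axioms, $\Delta^0_1$ comprehension, and $\Sigma^0_1$ induction). For a $\Sigma^0_k$ formula $\Phi$ (possibly with free number and set variables), $\mathrm{B}\Sigma^0_k$ ($\Sigma^0_k$ bounding) is the scheme consisting of the universal closures of $(\forall i\,\exists j\,\Phi(i,j))\Rightarrow\forall m\,\exists n\,(\forall i<m)\,(\exists j<n)\,\Phi(i,j)$. -}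

module Defs where

open import Data.Nat using (ℕ; zero; suc)
open import Data.Fin using (Fin; zero; suc)
open import Data.Sum using (_⊎_)
open import Relation.Binary.PropositionalEquality using (_≡_)
open import Relation.Nullary using (¬_)

-- Syntax.  Tm n : number terms with n number variables (de Bruijn).
-- Fm n m : formulas with n free number variables and m free set variables.

data Tm (n : ℕ) : Set where
  var     : Fin n → Tm n
  `0 `1   : Tm n
  _⊕_ _⊗_ : Tm n → Tm n → Tm n

infix  7 _≐_ _≺_ _∈̇_
infixr 6 _∧̇_
infixr 5 _∨̇_
infixr 4 _⇒_ _⇔_

data Fm : ℕ → ℕ → Set where
  _≐_ _≺_       : ∀ {n m} → Tm n → Tm n → Fm n m
  _∈̇_           : ∀ {n m} → Tm n → Fin m → Fm n m
  ⊥̇             : ∀ {n m} → Fm n m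
  _⇒_ _∧̇_ _∨̇_   : ∀ {n m} → Fm n m → Fm n m → Fm n m
  ∀ₙ ∃ₙ         : ∀ {n m} → Fm (suc n) m → Fm n m
  ∀ₛ ∃ₛ         : ∀ {n m} → Fm n (suc m) → Fm n m

¬̇_ : ∀ {n m} → Fm n m → Fm n m
¬̇ φ = φ ⇒ ⊥̇

_⇔_ : ∀ {n m} → Fm n m → Fm n m → Fm n m
φ ⇔ ψ = (φ ⇒ ψ) ∧̇ (ψ ⇒ φ)

Sentence : Set
Sentence = Fm 0 0

renT : ∀ {n k} → (Fin n → Fin k) → Tm n → Tm k
renT ρ (var i) = var (ρ i)
renT ρ `0 = `0
renT ρ `1 = `1
renT ρ (s ⊕ t) = renT ρ s ⊕ renT ρ t
renT ρ (s ⊗ t) = renT ρ s ⊗ renT ρ t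

wkT : ∀ {n} → Tm n → Tm (suc n)
wkT = renT suc

liftσ : ∀ {n k} → (Fin n → Tm k) → Fin (suc n) → Tm (suc k)
liftσ σ zero = var zero
liftσ σ (suc i) = wkT (σ i)

substT : ∀ {n k} → (Fin n → Tm k) → Tm n → Tm k
substT σ (var i) = σ i
substT σ `0 = `0
substT σ `1 = `1
substT σ (s ⊕ t) = substT σ s ⊕ substT σ t
substT σ (s ⊗ t) = substT σ s ⊗ substT σ t

substF : ∀ {n k m} → (Fin n → Tm k) → Fm n m → Fm k m
substF σ (s ≐ t) = substT σ s ≐ substT σ t
substF σ (s ≺ t) = substT σ s ≺ substT σ t
substF σ (t ∈̇ X) = substT σ t ∈̇ X
substF σ ⊥̇ = ⊥̇
substF σ (φ ⇒ ψ) = substF σ φ ⇒ substF σ ψ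
substF σ (φ ∧̇ ψ) = substF σ φ ∧̇ substF σ ψ
substF σ (φ ∨̇ ψ) = substF σ φ ∨̇ substF σ ψ
substF σ (∀ₙ φ) = ∀ₙ (substF (liftσ σ) φ)
substF σ (∃ₙ φ) = ∃ₙ (substF (liftσ σ) φ)
substF σ (∀ₛ φ) = ∀ₛ (substF σ φ)
substF σ (∃ₛ φ) = ∃ₛ (substF σ φ)

liftρ : ∀ {m k} → (Fin m → Fin k) → Fin (suc m) → Fin (suc k)
liftρ ρ zero = zero
liftρ ρ (suc i) = suc (ρ i)

renS : ∀ {n m k} → (Fin m → Fin k) → Fm n m → Fm n k
renS ρ (s ≐ t) = s ≐ t
renS ρ (s ≺ t) = s ≺ t
renS ρ (t ∈̇ X) = t ∈̇ ρ X
renS ρ ⊥̇ = ⊥̇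
renS ρ (φ ⇒ ψ) = renS ρ φ ⇒ renS ρ ψ
renS ρ (φ ∧̇ ψ) = renS ρ φ ∧̇ renS ρ ψ
renS ρ (φ ∨̇ ψ) = renS ρ φ ∨̇ renS ρ ψ
renS ρ (∀ₙ φ) = ∀ₙ (renS ρ φ)
renS ρ (∃ₙ φ) = ∃ₙ (renS ρ φ)
renS ρ (∀ₛ φ) = ∀ₛ (renS (liftρ ρ) φ)
renS ρ (∃ₛ φ) = ∃ₛ (renS (liftρ ρ) φ)

_[_]ₙ : ∀ {n m} → Fm (suc n) m → Tm n → Fm n m
φ [ t ]ₙ = substF σ φ
  where
  σ : Fin (suc _) → Tm _
  σ zero = t
  σ (suc i) = var i

_[_]ₛ : ∀ {n m} → Fm n (suc m) → Fin m → Fm n m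
φ [ Y ]ₛ = renS ρ φ
  where
  ρ : Fin (suc _) → Fin _
  ρ zero = Y
  ρ (suc i) = i

wkN : ∀ {n m} → Fm n m → Fm (suc n) m
wkN = substF (λ i → var (suc i))

wkS : ∀ {n m} → Fm n m → Fm n (suc m)
wkS = renS suc

wkSentence : ∀ {n m} → Sentence → Fm n m
wkSentence σ = renS (λ ()) (substF (λ ()) σ)

closeN : ∀ {n m} → Fm n m → Fm 0 m
closeN {zero} φ = φ
closeN {suc n} φ = closeN (∀ₙ φ)

closeS : ∀ {m} → Fm 0 m → Fm 0 0
closeS {zero} φ = φ
closeS {suc m} φ = closeS (∀ₛ φ)

close : ∀ {n m} → Fm n m → Sentence
close φ = closeS (closeN φ)

data Δ₀ : ∀ {n m} → Fm n m → Set where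
  d-≐ : ∀ {n m} {s t : Tm n} → Δ₀ {n} {m} (s ≐ t)
  d-≺ : ∀ {n m} {s t : Tm n} → Δ₀ {n} {m} (s ≺ t)
  d-∈ : ∀ {n m} {t : Tm n} {X : Fin m} → Δ₀ (t ∈̇ X)
  d-⊥ : ∀ {n m} → Δ₀ {n} {m} ⊥̇
  d-⇒ : ∀ {n m} {φ ψ : Fm n m} → Δ₀ φ → Δ₀ ψ → Δ₀ (φ ⇒ ψ)
  d-∧ : ∀ {n m} {φ ψ : Fm n m} → Δ₀ φ → Δ₀ ψ → Δ₀ (φ ∧̇ ψ)
  d-∨ : ∀ {n m} {φ ψ : Fm n m} → Δ₀ φ → Δ₀ ψ → Δ₀ (φ ∨̇ ψ)
  d-b∀ : ∀ {n m} (t : Tm n) {φ : Fm (suc n) m} → Δ₀ φ →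
         Δ₀ (∀ₙ ((var zero ≺ wkT t) ⇒ φ))
  d-b∃ : ∀ {n m} (t : Tm n) {φ : Fm (suc n) m} → Δ₀ φ →
         Δ₀ (∃ₙ ((var zero ≺ wkT t) ∧̇ φ))

data Σ⁰ : ℕ → ∀ {n m} → Fm n m → Set
data Π⁰ : ℕ → ∀ {n m} → Fm n m → Set

data Σ⁰ where
  Σ-Δ₀ : ∀ {n m} {φ : Fm n m} → Δ₀ φ → Σ⁰ zero φ
  Σ-Π  : ∀ {k n m} {φ : Fm n m} → Π⁰ k φ → Σ⁰ (suc k) φ
  Σ-∃  : ∀ {k n m} {φ : Fm (suc n) m} → Σ⁰ (suc k) φ → Σ⁰ (suc k) (∃ₙ φ)

data Π⁰ where
  Π-Δ₀ : ∀ {n m} {φ : Fm n m} → Δ₀ φ → Π⁰ zero φ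
  Π-Σ  : ∀ {k n m} {φ : Fm n m} → Σ⁰ k φ → Π⁰ (suc k) φ
  Π-∀  : ∀ {k n m} {φ : Fm (suc n) m} → Π⁰ (suc k) φ → Π⁰ (suc k) (∀ₙ φ)

Theory : Set₁
Theory = Sentence → Set

data Pf (T : Theory) : ∀ {n m} → Fm n m → Set where
  ax   : ∀ {n m} {σ : Sentence} → T σ → Pf T {n} {m} (wkSentence σ)
  mp   : ∀ {n m} {φ ψ : Fm n m} → Pf T (φ ⇒ ψ) → Pf T φ → Pf T ψ
  genN : ∀ {n m} {φ : Fm (suc n) m} → Pf T φ → Pf T (∀ₙ φ)
  genS : ∀ {n m} {φ : Fm n (suc m)} → Pf T φ → Pf T (∀ₛ φ)
  pK   : ∀ {n m} (φ ψ : Fm n m) → Pf T (φ ⇒ ψ ⇒ φ)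
  pS   : ∀ {n m} (φ ψ χ : Fm n m) → Pf T ((φ ⇒ ψ ⇒ χ) ⇒ (φ ⇒ ψ) ⇒ φ ⇒ χ)
  pDNE : ∀ {n m} (φ : Fm n m) → Pf T (¬̇ ¬̇ φ ⇒ φ)
  p∧I  : ∀ {n m} (φ ψ : Fm n m) → Pf T (φ ⇒ ψ ⇒ φ ∧̇ ψ)
  p∧E₁ : ∀ {n m} (φ ψ : Fm n m) → Pf T (φ ∧̇ ψ ⇒ φ)
  p∧E₂ : ∀ {n m} (φ ψ : Fm n m) → Pf T (φ ∧̇ ψ ⇒ ψ)
  p∨I₁ : ∀ {n m} (φ ψ : Fm n m) → Pf T (φ ⇒ φ ∨̇ ψ)
  p∨I₂ : ∀ {n m} (φ ψ : Fm n m) → Pf T (ψ ⇒ φ ∨̇ ψ)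
  p∨E  : ∀ {n m} (φ ψ χ : Fm n m) → Pf T ((φ ⇒ χ) ⇒ (ψ ⇒ χ) ⇒ φ ∨̇ ψ ⇒ χ)
  q∀E  : ∀ {n m} (φ : Fm (suc n) m) (t : Tm n) → Pf T (∀ₙ φ ⇒ φ [ t ]ₙ)
  q∃I  : ∀ {n m} (φ : Fm (suc n) m) (t : Tm n) → Pf T (φ [ t ]ₙ ⇒ ∃ₙ φ)
  q∀D  : ∀ {n m} (ψ : Fm n m) (φ : Fm (suc n) m) → Pf T (∀ₙ (wkN ψ ⇒ φ) ⇒ ψ ⇒ ∀ₙ φ)
  q∃D  : ∀ {n m} (φ : Fm (suc n) m) (ψ : Fm n m) → Pf T (∀ₙ (φ ⇒ wkN ψ) ⇒ ∃ₙ φ ⇒ ψ)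
  q∀V  : ∀ {n m} (ψ : Fm n m) → Pf T (∀ₙ (wkN ψ) ⇒ ψ)
  s∀E  : ∀ {n m} (φ : Fm n (suc m)) (Y : Fin m) → Pf T (∀ₛ φ ⇒ φ [ Y ]ₛ)
  s∃I  : ∀ {n m} (φ : Fm n (suc m)) (Y : Fin m) → Pf T (φ [ Y ]ₛ ⇒ ∃ₛ φ)
  s∀D  : ∀ {n m} (ψ : Fm n m) (φ : Fm n (suc m)) → Pf T (∀ₛ (wkS ψ ⇒ φ) ⇒ ψ ⇒ ∀ₛ φ)
  s∃D  : ∀ {n m} (φ : Fm n (suc m)) (ψ : Fm n m) → Pf T (∀ₛ (φ ⇒ wkS ψ) ⇒ ∃ₛ φ ⇒ ψ)
  s∀V  : ∀ {n m} (ψ : Fm n m) → Pf T (∀ₛ (wkS ψ) ⇒ ψ)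
  eRefl : ∀ {n m} (t : Tm n) → Pf T {n} {m} (t ≐ t)
  eSubst : ∀ {n m} (φ : Fm (suc n) m) (s t : Tm n) → Pf T (s ≐ t ⇒ φ [ s ]ₙ ⇒ φ [ t ]ₙ)

_⊢_ : Theory → Sentence → Set
T ⊢ σ = Pf T {0} {0} σ

Consistent : Theory → Set
Consistent T = ¬ (T ⊢ ⊥̇)

-- RCA₀  (Simpson, SOSOA Def. I.7.1 / II.1)

private
  x₀ x₁ : ∀ {n} → Tm (suc (suc n))
  x₀ = var zero
  x₁ = var (suc zero)

sucσ : ∀ {n} → Fin (suc n) → Tm (suc n)
sucσ zero = var zero ⊕ `1
sucσ (suc i) = var (suc i)

data RCA₀ : Theory where
  b1 : RCA₀ (∀ₙ (¬̇ ((var zero ⊕ `1) ≐ `0)))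
  b2 : RCA₀ (∀ₙ (∀ₙ (((x₁ ⊕ `1) ≐ (x₀ ⊕ `1)) ⇒ (x₁ ≐ x₀))))
  b3 : RCA₀ (∀ₙ (¬̇ (var zero ≺ `0)))
  b4 : RCA₀ (∀ₙ (∀ₙ ((x₁ ≺ (x₀ ⊕ `1)) ⇔ ((x₁ ≺ x₀) ∨̇ (x₁ ≐ x₀)))))
  b5 : RCA₀ (∀ₙ ((var zero ⊕ `0) ≐ var zero))
  b6 : RCA₀ (∀ₙ (∀ₙ ((x₁ ⊕ (x₀ ⊕ `1)) ≐ ((x₁ ⊕ x₀) ⊕ `1))))
  b7 : RCA₀ (∀ₙ ((var zero ⊗ `0) ≐ `0))
  b8 : RCA₀ (∀ₙ (∀ₙ ((x₁ ⊗ (x₀ ⊕ `1)) ≐ ((x₁ ⊗ x₀) ⊕ x₁))))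
  ind : ∀ {n m} (φ : Fm (suc n) m) → Σ⁰ 1 φ →
        RCA₀ (close ((φ [ `0 ]ₙ ∧̇ ∀ₙ (φ ⇒ substF (λ i → sucσ i) φ)) ⇒ ∀ₙ φ))
  comp : ∀ {n m} (φ ψ : Fm (suc n) m) → Σ⁰ 1 φ → Π⁰ 1 ψ →
         RCA₀ (close (∀ₙ (φ ⇔ ψ) ⇒ ∃ₛ (∀ₙ ((var zero ∈̇ zero) ⇔ wkS φ))))

_+ₜ_ : Theory → Sentence → Theory
(T +ₜ σ) τ = T τ ⊎ (τ ≡ σ)

-- BΣ⁰_k instances:
--   (∀i ∃j Φ(i,j)) ⇒ ∀m ∃n (∀i<m)(∃j<n) Φ(i,j)     (universal closure)
-- Φ : Fm (2+n) m' with var 0 = j, var 1 = i, remaining variables parameters.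

shift₂ : ∀ {n} → Fin (suc (suc n)) → Tm (suc (suc (suc (suc n))))
shift₂ zero = var zero
shift₂ (suc zero) = var (suc zero)
shift₂ (suc (suc p)) = var (suc (suc (suc (suc p))))

BoundingInstance : ∀ {n m} → Fm (suc (suc n)) m → Sentence
BoundingInstance Φ =
  close (∀ₙ (∃ₙ Φ) ⇒
         ∀ₙ (∃ₙ (∀ₙ ((var zero ≺ var (suc (suc zero))) ⇒
                     ∃ₙ ((var zero ≺ var (suc (suc zero))) ∧̇ substF shift₂ Φ)))))

ProvesBΣ : ℕ → Theory → Set
ProvesBΣ k T = ∀ {n m} (Φ : Fm (suc (suc n)) m) → Σ⁰ k Φ → T ⊢ BoundingInstance Φ

{-# OPTIONS --safe #-}

-- By completeness, take a model M of the theory with a number a above all standard numbers, a witness X and a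
-- set U such that, for every standard e, the e-th section of U is the set defined by the e-th Δ₀ formula with
-- parameter a; by compactness such a model exists, because finitely many sections can be obtained by Δ₁
-- comprehension.  Let 𝒦 be the Σ₂ Skolem hull of a in M: the elements that are first components of Π₁(X,U)
-- singletons, with the sets Δ₁ definable from X and U.  Then 𝒦 is a Σ₂ elementary substructure, so it satisfies
-- RCA₀ and the Π₃ formula Ψ(X,Y) for all its sets Y.  If 𝒦 satisfied Σ₂ bounding then, for every nonstandard k,
-- the map sending a standard index to the element it defines would restrict to a Δ₀ definable surjection
-- from a part of {0,…,k-1} onto {0,…,k}.  The k admitting such a surjection would form a Σ₁ definable set
-- consisting of exactly the nonstandard numbers (pigeonhole), contradicting Σ₁ induction.
--
-- All semantics is negative (∃ and ∨ are interpreted as ¬¬Σ and ¬¬⊎), so that classical logic is available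
-- inside every model.
module Submission where

open import Defs
open import Algebra.Bundles using (CommutativeSemiring)
import Algebra.Solver.Ring.NaturalCoefficients.Default as NatSolver
open import Algebra.Structures.Biased using (isCommutativeSemiringˡ)
open import Data.Empty using (⊥; ⊥-elim)
open import Data.Fin using (Fin; zero; suc; toℕ; fromℕ; fromℕ<; inject₁; _↑ˡ_; _↑ʳ_)
open import Data.Fin.Patterns using (1F; 2F; 3F)
open import Data.Fin.Properties using (pigeonhole; toℕ-fromℕ; toℕ-fromℕ<; toℕ-inject₁)
open import Data.Nat using (ℕ; zero; suc; z≤n; s≤s; _⊔_; _≟_; _≤′_; ≤′-reflexive; ≤′-step) renaming (_+_ to _+ℕ_; _≤_ to _≤ℕ_; _<_ to _<ℕ_)
import Data.Nat.Properties as ℕₚ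
open import Data.Product using (Σ; _×_; _,_; proj₁; proj₂)
open import Data.Sum using (_⊎_; inj₁; inj₂)
open import Level using (0ℓ)
open import Relation.Binary.PropositionalEquality using (_≡_; _≢_; refl; sym; trans; cong; cong₂; subst; subst₂)
open import Relation.Binary.Structures using (IsEquivalence)
open import Relation.Nullary using (¬_; yes; no)

-- Substitution

-- Enumerating definitions inside the model would call for arithmetized syntax and a partial truth
-- predicate. `U` replaces both: its sections need to be right only at standard indices, where
-- correctness is an external scheme of axioms, and at nonstandard indices they may be anything. For
-- this reason an index is read as naming the least solution of its Π₁ condition. That is a partial
-- function at every index, good or bad, and it remains one when all quantifiers are cut off at a
-- common number, which is what the pigeonhole argument needs. The hull has to be built with Σ₁
-- induction alone. A least solution of a Π₁ formula exists, but its minimality is not Π₁; it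
-- becomes so once a bound for the refutations of all smaller candidates is added as a second
-- coordinate, and taking this bound least makes the pair a Π₁ singleton. Hence elements of 𝒦 are
-- components of such singletons. The complexity of Ψ is dictated by the transfer: Σ₂ elementarity
-- hands Π₃ formulas down from M to 𝒦, and the quantifier over Y survives because every set of 𝒦 is
-- a set of M.

substT-cong : ∀ {n k} {σ τ : Fin n → Tm k} → (∀ i → σ i ≡ τ i) → ∀ t → substT σ t ≡ substT τ t
substT-cong h (var i) = h i
substT-cong h `0 = refl
substT-cong h `1 = refl
substT-cong h (s ⊕ t) = cong₂ _⊕_ (substT-cong h s) (substT-cong h t)
substT-cong h (s ⊗ t) = cong₂ _⊗_ (substT-cong h s) (substT-cong h t)

substT-∘ : ∀ {n k l} (τ : Fin k → Tm l) (σ : Fin n → Tm k) {υ : Fin n → Tm l} →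
           (∀ i → substT τ (σ i) ≡ υ i) → ∀ t → substT τ (substT σ t) ≡ substT υ t
substT-∘ τ σ h (var i) = h i
substT-∘ τ σ h `0 = refl
substT-∘ τ σ h `1 = refl
substT-∘ τ σ h (s ⊕ t) = cong₂ _⊕_ (substT-∘ τ σ h s) (substT-∘ τ σ h t)
substT-∘ τ σ h (s ⊗ t) = cong₂ _⊗_ (substT-∘ τ σ h s) (substT-∘ τ σ h t)

renT≡substT : ∀ {n k} (ρ : Fin n → Fin k) t → renT ρ t ≡ substT (λ i → var (ρ i)) t
renT≡substT ρ (var i) = refl
renT≡substT ρ `0 = refl
renT≡substT ρ `1 = refl
renT≡substT ρ (s ⊕ t) = cong₂ _⊕_ (renT≡substT ρ s) (renT≡substT ρ t)
renT≡substT ρ (s ⊗ t) = cong₂ _⊗_ (renT≡substT ρ s) (renT≡substT ρ t)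

substT-renT : ∀ {n k l} (τ : Fin k → Tm l) (ρ : Fin n → Fin k) t →
              substT τ (renT ρ t) ≡ substT (λ i → τ (ρ i)) t
substT-renT τ ρ (var i) = refl
substT-renT τ ρ `0 = refl
substT-renT τ ρ `1 = refl
substT-renT τ ρ (s ⊕ t) = cong₂ _⊕_ (substT-renT τ ρ s) (substT-renT τ ρ t)
substT-renT τ ρ (s ⊗ t) = cong₂ _⊗_ (substT-renT τ ρ s) (substT-renT τ ρ t)

substT-var : ∀ {n} {σ : Fin n → Tm n} → (∀ i → σ i ≡ var i) → ∀ t → substT σ t ≡ t
substT-var h (var i) = h i
substT-var h `0 = refl
substT-var h `1 = refl
substT-var h (s ⊕ t) = cong₂ _⊕_ (substT-var h s) (substT-var h t)
substT-var h (s ⊗ t) = cong₂ _⊗_ (substT-var h s) (substT-var h t)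

substT-wkT : ∀ {n k} (σ : Fin n → Tm k) t → substT (liftσ σ) (wkT t) ≡ wkT (substT σ t)
substT-wkT σ t =
  trans (substT-renT (liftσ σ) suc t)
    (trans (sym (substT-∘ (λ i → var (suc i)) σ (λ i → sym (renT≡substT suc (σ i))) t))
           (sym (renT≡substT suc (substT σ t))))

liftσ-cong : ∀ {n k} {σ τ : Fin n → Tm k} → (∀ i → σ i ≡ τ i) → ∀ i → liftσ σ i ≡ liftσ τ i
liftσ-cong h zero = refl
liftσ-cong h (suc i) = cong wkT (h i)

liftρ-cong : ∀ {n k} {σ τ : Fin n → Fin k} → (∀ i → σ i ≡ τ i) → ∀ i → liftρ σ i ≡ liftρ τ i
liftρ-cong h zero = refl
liftρ-cong h (suc i) = cong suc (h i)

liftσ-∘ : ∀ {n k l} (τ : Fin k → Tm l) (σ : Fin n → Tm k) {υ : Fin n → Tm l} →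
          (∀ i → substT τ (σ i) ≡ υ i) → ∀ i → substT (liftσ τ) (liftσ σ i) ≡ liftσ υ i
liftσ-∘ τ σ h zero = refl
liftσ-∘ τ σ h (suc i) = trans (substT-wkT τ (σ i)) (cong wkT (h i))

substF-cong : ∀ {n k m} {σ τ : Fin n → Tm k} → (∀ i → σ i ≡ τ i) →
              (φ : Fm n m) → substF σ φ ≡ substF τ φ
substF-cong h (s ≐ t) = cong₂ _≐_ (substT-cong h s) (substT-cong h t)
substF-cong h (s ≺ t) = cong₂ _≺_ (substT-cong h s) (substT-cong h t)
substF-cong h (t ∈̇ X) = cong (_∈̇ X) (substT-cong h t)
substF-cong h ⊥̇ = refl
substF-cong h (φ ⇒ ψ) = cong₂ _⇒_ (substF-cong h φ) (substF-cong h ψ)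
substF-cong h (φ ∧̇ ψ) = cong₂ _∧̇_ (substF-cong h φ) (substF-cong h ψ)
substF-cong h (φ ∨̇ ψ) = cong₂ _∨̇_ (substF-cong h φ) (substF-cong h ψ)
substF-cong h (∀ₙ φ) = cong ∀ₙ (substF-cong (liftσ-cong h) φ)
substF-cong h (∃ₙ φ) = cong ∃ₙ (substF-cong (liftσ-cong h) φ)
substF-cong h (∀ₛ φ) = cong ∀ₛ (substF-cong h φ)
substF-cong h (∃ₛ φ) = cong ∃ₛ (substF-cong h φ)

substF-∘ : ∀ {n k l m} (τ : Fin k → Tm l) (σ : Fin n → Tm k) {υ : Fin n → Tm l} →
           (∀ i → substT τ (σ i) ≡ υ i) → (φ : Fm n m) → substF τ (substF σ φ) ≡ substF υ φ
substF-∘ τ σ h (s ≐ t) = cong₂ _≐_ (substT-∘ τ σ h s) (substT-∘ τ σ h t)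
substF-∘ τ σ h (s ≺ t) = cong₂ _≺_ (substT-∘ τ σ h s) (substT-∘ τ σ h t)
substF-∘ τ σ h (t ∈̇ X) = cong (_∈̇ X) (substT-∘ τ σ h t)
substF-∘ τ σ h ⊥̇ = refl
substF-∘ τ σ h (φ ⇒ ψ) = cong₂ _⇒_ (substF-∘ τ σ h φ) (substF-∘ τ σ h ψ)
substF-∘ τ σ h (φ ∧̇ ψ) = cong₂ _∧̇_ (substF-∘ τ σ h φ) (substF-∘ τ σ h ψ)
substF-∘ τ σ h (φ ∨̇ ψ) = cong₂ _∨̇_ (substF-∘ τ σ h φ) (substF-∘ τ σ h ψ)
substF-∘ τ σ h (∀ₙ φ) = cong ∀ₙ (substF-∘ (liftσ τ) (liftσ σ) (liftσ-∘ τ σ h) φ)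
substF-∘ τ σ h (∃ₙ φ) = cong ∃ₙ (substF-∘ (liftσ τ) (liftσ σ) (liftσ-∘ τ σ h) φ)
substF-∘ τ σ h (∀ₛ φ) = cong ∀ₛ (substF-∘ τ σ h φ)
substF-∘ τ σ h (∃ₛ φ) = cong ∃ₛ (substF-∘ τ σ h φ)

substF-renS : ∀ {n k m l} (σ : Fin n → Tm k) (ρ : Fin m → Fin l) (φ : Fm n m) →
              substF σ (renS ρ φ) ≡ renS ρ (substF σ φ)
substF-renS σ ρ (s ≐ t) = refl
substF-renS σ ρ (s ≺ t) = refl
substF-renS σ ρ (t ∈̇ X) = refl
substF-renS σ ρ ⊥̇ = refl
substF-renS σ ρ (φ ⇒ ψ) = cong₂ _⇒_ (substF-renS σ ρ φ) (substF-renS σ ρ ψ)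
substF-renS σ ρ (φ ∧̇ ψ) = cong₂ _∧̇_ (substF-renS σ ρ φ) (substF-renS σ ρ ψ)
substF-renS σ ρ (φ ∨̇ ψ) = cong₂ _∨̇_ (substF-renS σ ρ φ) (substF-renS σ ρ ψ)
substF-renS σ ρ (∀ₙ φ) = cong ∀ₙ (substF-renS (liftσ σ) ρ φ)
substF-renS σ ρ (∃ₙ φ) = cong ∃ₙ (substF-renS (liftσ σ) ρ φ)
substF-renS σ ρ (∀ₛ φ) = cong ∀ₛ (substF-renS σ (liftρ ρ) φ)
substF-renS σ ρ (∃ₛ φ) = cong ∃ₛ (substF-renS σ (liftρ ρ) φ)

liftρ-∘ : ∀ {m k l} {τ : Fin k → Fin l} {σ : Fin m → Fin k} {υ : Fin m → Fin l} →
          (∀ i → τ (σ i) ≡ υ i) → ∀ i → liftρ τ (liftρ σ i) ≡ liftρ υ i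
liftρ-∘ h zero = refl
liftρ-∘ h (suc i) = cong suc (h i)

renS-∘ : ∀ {n m k l} (τ : Fin k → Fin l) (σ : Fin m → Fin k) {υ : Fin m → Fin l} →
         (∀ i → τ (σ i) ≡ υ i) → (φ : Fm n m) → renS τ (renS σ φ) ≡ renS υ φ
renS-∘ τ σ h (s ≐ t) = refl
renS-∘ τ σ h (s ≺ t) = refl
renS-∘ τ σ h (t ∈̇ X) = cong (t ∈̇_) (h X)
renS-∘ τ σ h ⊥̇ = refl
renS-∘ τ σ h (φ ⇒ ψ) = cong₂ _⇒_ (renS-∘ τ σ h φ) (renS-∘ τ σ h ψ)
renS-∘ τ σ h (φ ∧̇ ψ) = cong₂ _∧̇_ (renS-∘ τ σ h φ) (renS-∘ τ σ h ψ)
renS-∘ τ σ h (φ ∨̇ ψ) = cong₂ _∨̇_ (renS-∘ τ σ h φ) (renS-∘ τ σ h ψ)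
renS-∘ τ σ h (∀ₙ φ) = cong ∀ₙ (renS-∘ τ σ h φ)
renS-∘ τ σ h (∃ₙ φ) = cong ∃ₙ (renS-∘ τ σ h φ)
renS-∘ τ σ h (∀ₛ φ) = cong ∀ₛ (renS-∘ (liftρ τ) (liftρ σ) (liftρ-∘ h) φ)
renS-∘ τ σ h (∃ₛ φ) = cong ∃ₛ (renS-∘ (liftρ τ) (liftρ σ) (liftρ-∘ h) φ)

renS-cong : ∀ {n m k} {σ τ : Fin m → Fin k} → (∀ i → σ i ≡ τ i) →
            (φ : Fm n m) → renS σ φ ≡ renS τ φ
renS-cong h (s ≐ t) = refl
renS-cong h (s ≺ t) = refl
renS-cong h (t ∈̇ X) = cong (t ∈̇_) (h X)
renS-cong h ⊥̇ = refl
renS-cong h (φ ⇒ ψ) = cong₂ _⇒_ (renS-cong h φ) (renS-cong h ψ)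
renS-cong h (φ ∧̇ ψ) = cong₂ _∧̇_ (renS-cong h φ) (renS-cong h ψ)
renS-cong h (φ ∨̇ ψ) = cong₂ _∨̇_ (renS-cong h φ) (renS-cong h ψ)
renS-cong h (∀ₙ φ) = cong ∀ₙ (renS-cong h φ)
renS-cong h (∃ₙ φ) = cong ∃ₙ (renS-cong h φ)
renS-cong h (∀ₛ φ) = cong ∀ₛ (renS-cong (liftρ-cong h) φ)
renS-cong h (∃ₛ φ) = cong ∃ₛ (renS-cong (liftρ-cong h) φ)

single : ∀ {n} → Tm n → Fin (suc n) → Tm n
single t zero = t
single t (suc i) = var i

[]ₙ≡ : ∀ {n m} (φ : Fm (suc n) m) t → φ [ t ]ₙ ≡ substF (single t) φ
[]ₙ≡ φ t = substF-cong (λ { zero → refl ; (suc i) → refl }) φ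

singleₛ : ∀ {m} → Fin m → Fin (suc m) → Fin m
singleₛ Y zero = Y
singleₛ Y (suc i) = i

[]ₛ≡ : ∀ {n m} (φ : Fm n (suc m)) Y → φ [ Y ]ₛ ≡ renS (singleₛ Y) φ
[]ₛ≡ φ Y = renS-cong (λ { zero → refl ; (suc i) → refl }) φ

substF-[] : ∀ {n k m} (σ : Fin n → Tm k) (φ : Fm (suc n) m) (t : Tm n) →
            substF σ (φ [ t ]ₙ) ≡ substF (liftσ σ) φ [ substT σ t ]ₙ
substF-[] {n} {k} σ φ t =
  trans (cong (substF σ) ([]ₙ≡ φ t))
    (trans (substF-∘ σ (single t) {υ} (λ { zero → refl ; (suc i) → refl }) φ)
      (trans (sym (substF-∘ (single (substT σ t)) (liftσ σ) h φ))
             (sym ([]ₙ≡ (substF (liftσ σ) φ) (substT σ t)))))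
  where
  υ : Fin (suc n) → Tm k
  υ zero = substT σ t
  υ (suc i) = σ i
  h : ∀ i → substT (single (substT σ t)) (liftσ σ i) ≡ υ i
  h zero = refl
  h (suc i) = trans (substT-renT (single (substT σ t)) suc (σ i)) (substT-var (λ _ → refl) (σ i))

substF-wkN : ∀ {n k m} (σ : Fin n → Tm k) (ψ : Fm n m) →
             substF (liftσ σ) (wkN ψ) ≡ wkN (substF σ ψ)
substF-wkN σ ψ =
  trans (substF-∘ (liftσ σ) (λ i → var (suc i)) {λ i → wkT (σ i)} (λ _ → refl) ψ)
        (sym (substF-∘ (λ i → var (suc i)) σ (λ i → sym (renT≡substT suc (σ i))) ψ))

renS-[] : ∀ {n m k} (ρ : Fin m → Fin k) (φ : Fm n (suc m)) (Y : Fin m) →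
          renS ρ (φ [ Y ]ₛ) ≡ renS (liftρ ρ) φ [ ρ Y ]ₛ
renS-[] {n} {m} {k} ρ φ Y =
  trans (cong (renS ρ) ([]ₛ≡ φ Y))
    (trans (renS-∘ ρ (singleₛ Y) {υ} (λ { zero → refl ; (suc i) → refl }) φ)
      (trans (sym (renS-∘ (singleₛ (ρ Y)) (liftρ ρ) (λ { zero → refl ; (suc i) → refl }) φ))
             (sym ([]ₛ≡ (renS (liftρ ρ) φ) (ρ Y)))))
  where
  υ : Fin (suc m) → Fin k
  υ zero = ρ Y
  υ (suc i) = ρ i

renS-wkS : ∀ {n m k} (ρ : Fin m → Fin k) (ψ : Fm n m) → renS (liftρ ρ) (wkS ψ) ≡ wkS (renS ρ ψ)
renS-wkS ρ ψ =
  trans (renS-∘ (liftρ ρ) suc {λ i → suc (ρ i)} (λ _ → refl) ψ)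
        (sym (renS-∘ suc ρ (λ _ → refl) ψ))

-- Derivations under substitution of terms and renaming of set variables

Pf-substF : ∀ {T n k m} (σ : Fin n → Tm k) {φ : Fm n m} → Pf T φ → Pf T (substF σ φ)
Pf-substF {T} {n} {k} {m} σ (ax {σ = χ} x) =
  subst (Pf T) (sym (trans (substF-renS σ (λ ()) (substF (λ ()) χ))
                      (cong (renS (λ ())) (substF-∘ σ (λ ()) (λ ()) χ)))) (ax x)
Pf-substF σ (mp p q) = mp (Pf-substF σ p) (Pf-substF σ q)
Pf-substF σ (genN p) = genN (Pf-substF (liftσ σ) p)
Pf-substF σ (genS p) = genS (Pf-substF σ p)
Pf-substF σ (pK φ ψ) = pK _ _
Pf-substF σ (pS φ ψ χ) = pS _ _ _
Pf-substF σ (pDNE φ) = pDNE _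
Pf-substF σ (p∧I φ ψ) = p∧I _ _
Pf-substF σ (p∧E₁ φ ψ) = p∧E₁ _ _
Pf-substF σ (p∧E₂ φ ψ) = p∧E₂ _ _
Pf-substF σ (p∨I₁ φ ψ) = p∨I₁ _ _
Pf-substF σ (p∨I₂ φ ψ) = p∨I₂ _ _
Pf-substF σ (p∨E φ ψ χ) = p∨E _ _ _
Pf-substF {T} σ (q∀E φ t) =
  subst (λ x → Pf T (∀ₙ (substF (liftσ σ) φ) ⇒ x)) (sym (substF-[] σ φ t)) (q∀E _ _)
Pf-substF {T} σ (q∃I φ t) =
  subst (λ x → Pf T (x ⇒ ∃ₙ (substF (liftσ σ) φ))) (sym (substF-[] σ φ t)) (q∃I _ _)
Pf-substF {T} σ (q∀D ψ φ) =
  subst (λ x → Pf T (∀ₙ (x ⇒ substF (liftσ σ) φ) ⇒ substF σ ψ ⇒ ∀ₙ (substF (liftσ σ) φ)))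
        (sym (substF-wkN σ ψ)) (q∀D _ _)
Pf-substF {T} σ (q∃D φ ψ) =
  subst (λ x → Pf T (∀ₙ (substF (liftσ σ) φ ⇒ x) ⇒ ∃ₙ (substF (liftσ σ) φ) ⇒ substF σ ψ))
        (sym (substF-wkN σ ψ)) (q∃D _ _)
Pf-substF {T} σ (q∀V ψ) =
  subst (λ x → Pf T (∀ₙ x ⇒ substF σ ψ)) (sym (substF-wkN σ ψ)) (q∀V _)
Pf-substF {T} σ (s∀E φ Y) =
  subst (λ x → Pf T (∀ₛ (substF σ φ) ⇒ x)) (sym (substF-renS σ _ φ)) (s∀E _ _)
Pf-substF {T} σ (s∃I φ Y) =
  subst (λ x → Pf T (x ⇒ ∃ₛ (substF σ φ))) (sym (substF-renS σ _ φ)) (s∃I _ _)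
Pf-substF {T} σ (s∀D ψ φ) =
  subst (λ x → Pf T (∀ₛ (x ⇒ substF σ φ) ⇒ substF σ ψ ⇒ ∀ₛ (substF σ φ)))
        (sym (substF-renS σ suc ψ)) (s∀D _ _)
Pf-substF {T} σ (s∃D φ ψ) =
  subst (λ x → Pf T (∀ₛ (substF σ φ ⇒ x) ⇒ ∃ₛ (substF σ φ) ⇒ substF σ ψ))
        (sym (substF-renS σ suc ψ)) (s∃D _ _)
Pf-substF {T} σ (s∀V ψ) =
  subst (λ x → Pf T (∀ₛ x ⇒ substF σ ψ)) (sym (substF-renS σ suc ψ)) (s∀V _)
Pf-substF σ (eRefl t) = eRefl _
Pf-substF {T} σ (eSubst φ s t) =
  subst₂ (λ x y → Pf T (substT σ s ≐ substT σ t ⇒ x ⇒ y))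
         (sym (substF-[] σ φ s)) (sym (substF-[] σ φ t)) (eSubst _ _ _)

Pf-renS : ∀ {T n m k} (ρ : Fin m → Fin k) {φ : Fm n m} → Pf T φ → Pf T (renS ρ φ)
Pf-renS {T} ρ (ax {σ = χ} x) =
  subst (Pf T) (sym (renS-∘ ρ (λ ()) (λ ()) (substF (λ ()) χ))) (ax x)
Pf-renS ρ (mp p q) = mp (Pf-renS ρ p) (Pf-renS ρ q)
Pf-renS ρ (genN p) = genN (Pf-renS ρ p)
Pf-renS ρ (genS p) = genS (Pf-renS (liftρ ρ) p)
Pf-renS ρ (pK φ ψ) = pK _ _
Pf-renS ρ (pS φ ψ χ) = pS _ _ _
Pf-renS ρ (pDNE φ) = pDNE _
Pf-renS ρ (p∧I φ ψ) = p∧I _ _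
Pf-renS ρ (p∧E₁ φ ψ) = p∧E₁ _ _
Pf-renS ρ (p∧E₂ φ ψ) = p∧E₂ _ _
Pf-renS ρ (p∨I₁ φ ψ) = p∨I₁ _ _
Pf-renS ρ (p∨I₂ φ ψ) = p∨I₂ _ _
Pf-renS ρ (p∨E φ ψ χ) = p∨E _ _ _
Pf-renS {T} ρ (q∀E φ t) =
  subst (λ x → Pf T (∀ₙ (renS ρ φ) ⇒ x)) (substF-renS _ ρ φ) (q∀E _ _)
Pf-renS {T} ρ (q∃I φ t) =
  subst (λ x → Pf T (x ⇒ ∃ₙ (renS ρ φ))) (substF-renS _ ρ φ) (q∃I _ _)
Pf-renS {T} ρ (q∀D ψ φ) =
  subst (λ x → Pf T (∀ₙ (x ⇒ renS ρ φ) ⇒ renS ρ ψ ⇒ ∀ₙ (renS ρ φ)))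
        (substF-renS _ ρ ψ) (q∀D _ _)
Pf-renS {T} ρ (q∃D φ ψ) =
  subst (λ x → Pf T (∀ₙ (renS ρ φ ⇒ x) ⇒ ∃ₙ (renS ρ φ) ⇒ renS ρ ψ))
        (substF-renS _ ρ ψ) (q∃D _ _)
Pf-renS {T} ρ (q∀V ψ) =
  subst (λ x → Pf T (∀ₙ x ⇒ renS ρ ψ)) (substF-renS _ ρ ψ) (q∀V _)
Pf-renS {T} ρ (s∀E φ Y) =
  subst (λ x → Pf T (∀ₛ (renS (liftρ ρ) φ) ⇒ x)) (sym (renS-[] ρ φ Y)) (s∀E _ _)
Pf-renS {T} ρ (s∃I φ Y) =
  subst (λ x → Pf T (x ⇒ ∃ₛ (renS (liftρ ρ) φ))) (sym (renS-[] ρ φ Y)) (s∃I _ _)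
Pf-renS {T} ρ (s∀D ψ φ) =
  subst (λ x → Pf T (∀ₛ (x ⇒ renS (liftρ ρ) φ) ⇒ renS ρ ψ ⇒ ∀ₛ (renS (liftρ ρ) φ)))
        (sym (renS-wkS ρ ψ)) (s∀D _ _)
Pf-renS {T} ρ (s∃D φ ψ) =
  subst (λ x → Pf T (∀ₛ (renS (liftρ ρ) φ ⇒ x) ⇒ ∃ₛ (renS (liftρ ρ) φ) ⇒ renS ρ ψ))
        (sym (renS-wkS ρ ψ)) (s∃D _ _)
Pf-renS {T} ρ (s∀V ψ) =
  subst (λ x → Pf T (∀ₛ x ⇒ renS ρ ψ)) (sym (renS-wkS ρ ψ)) (s∀V _)
Pf-renS ρ (eRefl t) = eRefl _
Pf-renS {T} ρ (eSubst φ s t) =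
  subst₂ (λ x y → Pf T (s ≐ t ⇒ x ⇒ y))
         (substF-renS _ ρ φ) (substF-renS _ ρ φ) (eSubst _ _ _)

-- Tarski semantics

Stable : Set → Set
Stable A = ¬ ¬ A → A

infix 1 _⟷_
_⟷_ : Set → Set → Set
A ⟷ B = (A → B) × (B → A)

⟷-refl : ∀ {A} → A ⟷ A
⟷-refl = (λ x → x) , (λ x → x)

⟷-sym : ∀ {A B} → A ⟷ B → B ⟷ A
⟷-sym (f , g) = g , f

⟷-trans : ∀ {A B C} → A ⟷ B → B ⟷ C → A ⟷ C
⟷-trans (f , g) (h , k) = (λ x → h (f x)) , (λ x → g (k x))

→-⟷ : ∀ {A B C D} → A ⟷ B → C ⟷ D → (A → C) ⟷ (B → D)
→-⟷ (f , g) (h , k) = (λ u x → h (u (g x))) , (λ u x → k (u (f x)))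

×-⟷ : ∀ {A B C D} → A ⟷ B → C ⟷ D → (A × C) ⟷ (B × D)
×-⟷ (f , g) (h , k) = (λ (x , y) → f x , h y) , (λ (x , y) → g x , k y)

¬¬-map : ∀ {A B : Set} → (A → B) → ¬ ¬ A → ¬ ¬ B
¬¬-map f p k = p (λ x → k (f x))

¬¬⊎-⟷ : ∀ {A B C D : Set} → A ⟷ B → C ⟷ D → (¬ ¬ (A ⊎ C)) ⟷ (¬ ¬ (B ⊎ D))
¬¬⊎-⟷ (f , g) (h , k) =
  ¬¬-map (λ { (inj₁ x) → inj₁ (f x) ; (inj₂ y) → inj₂ (h y) }) ,
  ¬¬-map (λ { (inj₁ x) → inj₁ (g x) ; (inj₂ y) → inj₂ (k y) })

Π-⟷ : ∀ {A : Set} {P Q : A → Set} → (∀ x → P x ⟷ Q x) → (∀ x → P x) ⟷ (∀ x → Q x)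
Π-⟷ h = (λ f x → proj₁ (h x) (f x)) , (λ f x → proj₂ (h x) (f x))

¬¬Σ-⟷ : ∀ {A : Set} {P Q : A → Set} → (∀ x → P x ⟷ Q x) → (¬ ¬ Σ A P) ⟷ (¬ ¬ Σ A Q)
¬¬Σ-⟷ h = ¬¬-map (λ (x , p) → x , proj₁ (h x) p) , ¬¬-map (λ (x , p) → x , proj₂ (h x) p)

em : ∀ {A} (P : Set) → Stable A → (P → A) → (¬ P → A) → A
em P st f g = st (λ k → k (g (λ p → k (f p))))

infixr 5 _▹_
_▹_ : ∀ {A : Set} {n} → A → (Fin n → A) → Fin (suc n) → A
(d ▹ ρ) zero = d
(d ▹ ρ) (suc i) = ρ i

ε : ∀ {A : Set} → Fin 0 → A
ε ()

-- Equality is only a congruence, so that the term model below needs no quotient. Stability of the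
-- atomic relations gives stability of every formula, hence double negation elimination. `set₀`
-- makes the second sort inhabited, as the axiom `s∀V` on vacuous set quantifiers demands.
record Structure : Set₁ where
  infix 4 _≈_ _<_ _∈_
  infixl 6 _+_
  infixl 7 _*_
  field
    Dom Sets : Set
    0# 1# : Dom
    _+_ _*_ : Dom → Dom → Dom
    _≈_ _<_ : Dom → Dom → Set
    _∈_ : Dom → Sets → Set
    set₀ : Sets
    ≈-refl : ∀ {x} → x ≈ x
    ≈-sym : ∀ {x y} → x ≈ y → y ≈ x
    ≈-trans : ∀ {x y z} → x ≈ y → y ≈ z → x ≈ z
    +-cong : ∀ {x y u v} → x ≈ y → u ≈ v → (x + u) ≈ (y + v)
    *-cong : ∀ {x y u v} → x ≈ y → u ≈ v → (x * u) ≈ (y * v)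
    <-cong : ∀ {x y u v} → x ≈ y → u ≈ v → x < u → y < v
    ∈-cong : ∀ {x y Y} → x ≈ y → x ∈ Y → y ∈ Y
    ≈-stable : ∀ {x y} → Stable (x ≈ y)
    <-stable : ∀ {x y} → Stable (x < y)
    ∈-stable : ∀ {x Y} → Stable (x ∈ Y)

module Sem (M : Structure) where
  open Structure M

  eval : ∀ {n} → Tm n → (Fin n → Dom) → Dom
  eval (var i) ρ = ρ i
  eval `0 ρ = 0#
  eval `1 ρ = 1#
  eval (s ⊕ t) ρ = eval s ρ + eval t ρ
  eval (s ⊗ t) ρ = eval s ρ * eval t ρ

  Sat : ∀ {n m} → Fm n m → (Fin n → Dom) → (Fin m → Sets) → Set
  Sat (s ≐ t) ρ τ = eval s ρ ≈ eval t ρ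
  Sat (s ≺ t) ρ τ = eval s ρ < eval t ρ
  Sat (t ∈̇ X) ρ τ = eval t ρ ∈ τ X
  Sat ⊥̇ ρ τ = ⊥
  Sat (φ ⇒ ψ) ρ τ = Sat φ ρ τ → Sat ψ ρ τ
  Sat (φ ∧̇ ψ) ρ τ = Sat φ ρ τ × Sat ψ ρ τ
  Sat (φ ∨̇ ψ) ρ τ = ¬ ¬ (Sat φ ρ τ ⊎ Sat ψ ρ τ)
  Sat (∀ₙ φ) ρ τ = ∀ d → Sat φ (d ▹ ρ) τ
  Sat (∃ₙ φ) ρ τ = ¬ ¬ (Σ Dom λ d → Sat φ (d ▹ ρ) τ)
  Sat (∀ₛ φ) ρ τ = ∀ Y → Sat φ ρ (Y ▹ τ)
  Sat (∃ₛ φ) ρ τ = ¬ ¬ (Σ Sets λ Y → Sat φ ρ (Y ▹ τ))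

  Models : Theory → Set
  Models T = ∀ σ → T σ → Sat σ ε ε

  Sat-stable : ∀ {n m} (φ : Fm n m) {ρ τ} → Stable (Sat φ ρ τ)
  Sat-stable (s ≐ t) = ≈-stable
  Sat-stable (s ≺ t) = <-stable
  Sat-stable (t ∈̇ X) = ∈-stable
  Sat-stable ⊥̇ k = k (λ x → x)
  Sat-stable (φ ⇒ ψ) k x = Sat-stable ψ (λ h → k (λ f → h (f x)))
  Sat-stable (φ ∧̇ ψ) k =
    Sat-stable φ (λ h → k (λ p → h (proj₁ p))) , Sat-stable ψ (λ h → k (λ p → h (proj₂ p)))
  Sat-stable (φ ∨̇ ψ) k h = k (λ f → f h)
  Sat-stable (∀ₙ φ) k d = Sat-stable φ (λ h → k (λ f → h (f d)))
  Sat-stable (∃ₙ φ) k h = k (λ f → f h)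
  Sat-stable (∀ₛ φ) k d = Sat-stable φ (λ h → k (λ f → h (f d)))
  Sat-stable (∃ₛ φ) k h = k (λ f → f h)

  ≡⇒≈ : ∀ {x y} → x ≡ y → x ≈ y
  ≡⇒≈ refl = ≈-refl

  ▹-≈ : ∀ {n d e} {ρ ρ' : Fin n → Dom} → d ≈ e → (∀ i → ρ i ≈ ρ' i) → ∀ i → (d ▹ ρ) i ≈ (e ▹ ρ') i
  ▹-≈ p h zero = p
  ▹-≈ p h (suc i) = h i

  ▹-≡ : ∀ {A : Set} {n} {d : A} {τ τ' : Fin n → A} → (∀ i → τ i ≡ τ' i) → ∀ i → (d ▹ τ) i ≡ (d ▹ τ') i
  ▹-≡ h zero = refl
  ▹-≡ h (suc i) = h i

  eval-cong : ∀ {n} (t : Tm n) {ρ ρ'} → (∀ i → ρ i ≈ ρ' i) → eval t ρ ≈ eval t ρ'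
  eval-cong (var i) h = h i
  eval-cong `0 h = ≈-refl
  eval-cong `1 h = ≈-refl
  eval-cong (s ⊕ t) h = +-cong (eval-cong s h) (eval-cong t h)
  eval-cong (s ⊗ t) h = *-cong (eval-cong s h) (eval-cong t h)

  eval-subst : ∀ {n k} (σ : Fin n → Tm k) (t : Tm n) {ρ ρ'} →
               (∀ i → eval (σ i) ρ ≈ ρ' i) → eval (substT σ t) ρ ≈ eval t ρ'
  eval-subst σ (var i) h = h i
  eval-subst σ `0 h = ≈-refl
  eval-subst σ `1 h = ≈-refl
  eval-subst σ (s ⊕ t) h = +-cong (eval-subst σ s h) (eval-subst σ t h)
  eval-subst σ (s ⊗ t) h = *-cong (eval-subst σ s h) (eval-subst σ t h)

  eval-renT : ∀ {n k} (f : Fin n → Fin k) (t : Tm n) {ρ} → eval (renT f t) ρ ≡ eval t (λ i → ρ (f i))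
  eval-renT f (var i) = refl
  eval-renT f `0 = refl
  eval-renT f `1 = refl
  eval-renT f (s ⊕ t) {ρ} rewrite eval-renT f s {ρ} | eval-renT f t {ρ} = refl
  eval-renT f (s ⊗ t) {ρ} rewrite eval-renT f s {ρ} | eval-renT f t {ρ} = refl

  eval-wkT : ∀ {n} (t : Tm n) {ρ d} → eval (wkT t) (d ▹ ρ) ≈ eval t ρ
  eval-wkT t = ≡⇒≈ (eval-renT suc t)

  Sat-subst : ∀ {n k m} (σ : Fin n → Tm k) (φ : Fm n m) {ρ ρ' τ} →
              (∀ i → eval (σ i) ρ ≈ ρ' i) → Sat (substF σ φ) ρ τ ⟷ Sat φ ρ' τ
  lift-eval : ∀ {n k} (σ : Fin n → Tm k) {ρ ρ' d} → (∀ i → eval (σ i) ρ ≈ ρ' i) →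
              ∀ i → eval (liftσ σ i) (d ▹ ρ) ≈ (d ▹ ρ') i
  lift-eval σ h zero = ≈-refl
  lift-eval σ h (suc i) = ≈-trans (eval-wkT (σ i)) (h i)

  Sat-subst σ (s ≐ t) h =
    (λ p → ≈-trans (≈-sym (eval-subst σ s h)) (≈-trans p (eval-subst σ t h))) ,
    (λ p → ≈-trans (eval-subst σ s h) (≈-trans p (≈-sym (eval-subst σ t h))))
  Sat-subst σ (s ≺ t) h =
    <-cong (eval-subst σ s h) (eval-subst σ t h) ,
    <-cong (≈-sym (eval-subst σ s h)) (≈-sym (eval-subst σ t h))
  Sat-subst σ (t ∈̇ X) h = ∈-cong (eval-subst σ t h) , ∈-cong (≈-sym (eval-subst σ t h))
  Sat-subst σ ⊥̇ h = ⟷-refl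
  Sat-subst σ (φ ⇒ ψ) h = →-⟷ (Sat-subst σ φ h) (Sat-subst σ ψ h)
  Sat-subst σ (φ ∧̇ ψ) h = ×-⟷ (Sat-subst σ φ h) (Sat-subst σ ψ h)
  Sat-subst σ (φ ∨̇ ψ) h = ¬¬⊎-⟷ (Sat-subst σ φ h) (Sat-subst σ ψ h)
  Sat-subst σ (∀ₙ φ) h = Π-⟷ (λ d → Sat-subst (liftσ σ) φ (lift-eval σ h))
  Sat-subst σ (∃ₙ φ) h = ¬¬Σ-⟷ (λ d → Sat-subst (liftσ σ) φ (lift-eval σ h))
  Sat-subst σ (∀ₛ φ) h = Π-⟷ (λ d → Sat-subst σ φ h)
  Sat-subst σ (∃ₛ φ) h = ¬¬Σ-⟷ (λ d → Sat-subst σ φ h)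

  Sat-ren : ∀ {n m k} (κ : Fin m → Fin k) (φ : Fm n m) {ρ τ τ'} →
            (∀ i → τ (κ i) ≡ τ' i) → Sat (renS κ φ) ρ τ ⟷ Sat φ ρ τ'
  lift-τ : ∀ {m k} (κ : Fin m → Fin k) {τ τ' Y} → (∀ i → τ (κ i) ≡ τ' i) →
           ∀ i → (Y ▹ τ) (liftρ κ i) ≡ (Y ▹ τ') i
  lift-τ κ h zero = refl
  lift-τ κ h (suc i) = h i

  Sat-ren κ (s ≐ t) h = ⟷-refl
  Sat-ren κ (s ≺ t) h = ⟷-refl
  Sat-ren κ (t ∈̇ X) {ρ} h = subst (eval t ρ ∈_) (h X) , subst (eval t ρ ∈_) (sym (h X))
  Sat-ren κ ⊥̇ h = ⟷-refl
  Sat-ren κ (φ ⇒ ψ) h = →-⟷ (Sat-ren κ φ h) (Sat-ren κ ψ h)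
  Sat-ren κ (φ ∧̇ ψ) h = ×-⟷ (Sat-ren κ φ h) (Sat-ren κ ψ h)
  Sat-ren κ (φ ∨̇ ψ) h = ¬¬⊎-⟷ (Sat-ren κ φ h) (Sat-ren κ ψ h)
  Sat-ren κ (∀ₙ φ) h = Π-⟷ (λ d → Sat-ren κ φ h)
  Sat-ren κ (∃ₙ φ) h = ¬¬Σ-⟷ (λ d → Sat-ren κ φ h)
  Sat-ren κ (∀ₛ φ) h = Π-⟷ (λ d → Sat-ren (liftρ κ) φ (lift-τ κ h))
  Sat-ren κ (∃ₛ φ) h = ¬¬Σ-⟷ (λ d → Sat-ren (liftρ κ) φ (lift-τ κ h))

  Sat-cong : ∀ {n m} (φ : Fm n m) {ρ ρ' τ τ'} → (∀ i → ρ i ≈ ρ' i) → (∀ i → τ i ≡ τ' i) →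
             Sat φ ρ τ ⟷ Sat φ ρ' τ'
  Sat-cong (s ≐ t) h g =
    (λ p → ≈-trans (≈-sym (eval-cong s h)) (≈-trans p (eval-cong t h))) ,
    (λ p → ≈-trans (eval-cong s h) (≈-trans p (≈-sym (eval-cong t h))))
  Sat-cong (s ≺ t) h g =
    <-cong (eval-cong s h) (eval-cong t h) , <-cong (≈-sym (eval-cong s h)) (≈-sym (eval-cong t h))
  Sat-cong (t ∈̇ X) {ρ} {ρ'} h g =
    (λ p → subst (eval t ρ' ∈_) (g X) (∈-cong (eval-cong t h) p)) ,
    (λ p → subst (eval t ρ ∈_) (sym (g X)) (∈-cong (≈-sym (eval-cong t h)) p))
  Sat-cong ⊥̇ h g = ⟷-refl
  Sat-cong (φ ⇒ ψ) h g = →-⟷ (Sat-cong φ h g) (Sat-cong ψ h g)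
  Sat-cong (φ ∧̇ ψ) h g = ×-⟷ (Sat-cong φ h g) (Sat-cong ψ h g)
  Sat-cong (φ ∨̇ ψ) h g = ¬¬⊎-⟷ (Sat-cong φ h g) (Sat-cong ψ h g)
  Sat-cong (∀ₙ φ) h g = Π-⟷ (λ d → Sat-cong φ (▹-≈ ≈-refl h) g)
  Sat-cong (∃ₙ φ) h g = ¬¬Σ-⟷ (λ d → Sat-cong φ (▹-≈ ≈-refl h) g)
  Sat-cong (∀ₛ φ) h g = Π-⟷ (λ d → Sat-cong φ h (▹-≡ g))
  Sat-cong (∃ₛ φ) h g = ¬¬Σ-⟷ (λ d → Sat-cong φ h (▹-≡ g))

  Sat-congᵥ : ∀ {n m} (φ : Fm n m) {ρ ρ' τ} → (∀ i → ρ i ≈ ρ' i) → Sat φ ρ τ → Sat φ ρ' τ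
  Sat-congᵥ φ h = proj₁ (Sat-cong φ h (λ _ → refl))

  Sat-[] : ∀ {n m} (φ : Fm (suc n) m) (t : Tm n) {ρ τ} → Sat (φ [ t ]ₙ) ρ τ ⟷ Sat φ (eval t ρ ▹ ρ) τ
  Sat-[] φ t = Sat-subst _ φ (λ { zero → ≈-refl ; (suc i) → ≈-refl })

  Sat-[]ₛ : ∀ {n m} (φ : Fm n (suc m)) (Y : Fin m) {ρ τ} → Sat (φ [ Y ]ₛ) ρ τ ⟷ Sat φ ρ (τ Y ▹ τ)
  Sat-[]ₛ φ Y = Sat-ren _ φ (λ { zero → refl ; (suc i) → refl })

  Sat-wkN : ∀ {n m} (φ : Fm n m) {d ρ τ} → Sat (wkN φ) (d ▹ ρ) τ ⟷ Sat φ ρ τ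
  Sat-wkN φ = Sat-subst _ φ (λ _ → ≈-refl)

  Sat-wkS : ∀ {n m} (φ : Fm n m) {Y ρ τ} → Sat (wkS φ) ρ (Y ▹ τ) ⟷ Sat φ ρ τ
  Sat-wkS φ = Sat-ren _ φ (λ _ → refl)

  Sat-wkSentence : ∀ {n m} (φ : Sentence) {ρ : Fin n → Dom} {τ : Fin m → Sets} →
                   Sat (wkSentence φ) ρ τ ⟷ Sat φ ε ε
  Sat-wkSentence φ = ⟷-trans (Sat-ren _ (substF (λ ()) φ) {τ' = ε} (λ ())) (Sat-subst _ φ (λ ()))

  soundness : ∀ {T} → Models T → ∀ {n m} {φ : Fm n m} → Pf T φ → ∀ ρ τ → Sat φ ρ τ
  soundness mod (ax {σ = σ} t) ρ τ = proj₂ (Sat-wkSentence σ) (mod σ t)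
  soundness mod (mp p q) ρ τ = soundness mod p ρ τ (soundness mod q ρ τ)
  soundness mod (genN p) ρ τ d = soundness mod p (d ▹ ρ) τ
  soundness mod (genS p) ρ τ Y = soundness mod p ρ (Y ▹ τ)
  soundness mod (pK φ ψ) ρ τ x y = x
  soundness mod (pS φ ψ χ) ρ τ f g x = f x (g x)
  soundness mod (pDNE φ) ρ τ = Sat-stable φ
  soundness mod (p∧I φ ψ) ρ τ x y = x , y
  soundness mod (p∧E₁ φ ψ) ρ τ = proj₁
  soundness mod (p∧E₂ φ ψ) ρ τ = proj₂
  soundness mod (p∨I₁ φ ψ) ρ τ x k = k (inj₁ x)
  soundness mod (p∨I₂ φ ψ) ρ τ x k = k (inj₂ x)
  soundness mod (p∨E φ ψ χ) ρ τ f g h =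
    Sat-stable χ (λ k → h (λ { (inj₁ x) → k (f x) ; (inj₂ y) → k (g y) }))
  soundness mod (q∀E φ t) ρ τ f = proj₂ (Sat-[] φ t) (f _)
  soundness mod (q∃I φ t) ρ τ p k = k (_ , proj₁ (Sat-[] φ t) p)
  soundness mod (q∀D ψ φ) ρ τ f x d = f d (proj₂ (Sat-wkN ψ) x)
  soundness mod (q∃D φ ψ) ρ τ f x =
    Sat-stable ψ (λ k → x (λ (d , p) → k (proj₁ (Sat-wkN ψ) (f d p))))
  soundness mod (q∀V ψ) ρ τ f = proj₁ (Sat-wkN ψ) (f 0#)
  soundness mod (s∀E φ Y) ρ τ f = proj₂ (Sat-[]ₛ φ Y) (f _)
  soundness mod (s∃I φ Y) ρ τ p k = k (_ , proj₁ (Sat-[]ₛ φ Y) p)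
  soundness mod (s∀D ψ φ) ρ τ f x d = f d (proj₂ (Sat-wkS ψ) x)
  soundness mod (s∃D φ ψ) ρ τ f x =
    Sat-stable ψ (λ k → x (λ (d , p) → k (proj₁ (Sat-wkS ψ) (f d p))))
  soundness mod (s∀V ψ) ρ τ f = proj₁ (Sat-wkS ψ) (f set₀)
  soundness mod (eRefl t) ρ τ = ≈-refl
  soundness mod (eSubst φ s t) ρ τ e p =
    proj₂ (Sat-[] φ t) (Sat-congᵥ φ (▹-≈ e (λ _ → ≈-refl)) (proj₁ (Sat-[] φ s) p))

  Sat-closeN : ∀ {n m} (φ : Fm n m) {τ} → Sat (closeN φ) ε τ ⟷ (∀ ρ → Sat φ ρ τ)
  Sat-closeN {zero} φ =
    (λ p ρ → Sat-congᵥ φ (λ ()) p) , (λ f → f ε)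
  Sat-closeN {suc n} φ =
    ⟷-trans (Sat-closeN {n} (∀ₙ φ))
      ((λ f ρ → Sat-congᵥ φ (λ { zero → ≈-refl ; (suc i) → ≈-refl }) (f (λ i → ρ (suc i)) (ρ zero))) ,
       (λ f ρ d → f (d ▹ ρ)))

  Sat-closeS : ∀ {m} (φ : Fm 0 m) → Sat (closeS φ) ε ε ⟷ (∀ τ → Sat φ ε τ)
  Sat-closeS {zero} φ = (λ p τ → proj₁ (Sat-cong φ (λ ()) (λ ())) p) , (λ f → f ε)
  Sat-closeS {suc m} φ =
    ⟷-trans (Sat-closeS {m} (∀ₛ φ))
      ((λ f τ → proj₁ (Sat-cong φ (λ ()) (λ { zero → refl ; (suc i) → refl }))
                   (f (λ i → τ (suc i)) (τ zero))) ,
       (λ f τ Y → f (Y ▹ τ)))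

  Sat-close : ∀ {n m} (φ : Fm n m) → Sat (close φ) ε ε ⟷ (∀ ρ τ → Sat φ ρ τ)
  Sat-close φ =
    (λ p ρ τ → proj₁ (Sat-closeN φ) (proj₁ (Sat-closeS (closeN φ)) p τ) ρ) ,
    (λ f → proj₂ (Sat-closeS (closeN φ)) (λ τ → proj₂ (Sat-closeN φ) (λ ρ → f ρ τ)))

-- Enumerating formulas

-- One step of the walk through ℕ × ℕ along the antidiagonals.
next : ℕ × ℕ → ℕ × ℕ
next (zero , y) = suc y , zero
next (suc x , y) = x , suc y

unpair : ℕ → ℕ × ℕ
unpair zero = zero , zero
unpair (suc n) = next (unpair n)

unpair-onto : ∀ x y → Σ ℕ λ n → unpair n ≡ (x , y)
unpair-onto x y = go (x +ℕ y) y x refl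
  where
  go : ∀ s y x → x +ℕ y ≡ s → Σ ℕ λ n → unpair n ≡ (x , y)
  go zero zero zero p = zero , refl
  go (suc s) zero (suc x) p with go s x zero (trans (sym (ℕₚ.+-identityʳ x)) (ℕₚ.suc-injective p))
  ... | n , q = suc n , cong next q
  go s (suc y) x p with go s y (suc x) (trans (sym (ℕₚ.+-suc x y)) p)
  ... | n , q = suc n , cong next q

-- Ensures that a formula of stage `K` is treated at a stage `N` not before `K`, where its variables
-- already exist.
unpair₁-≤ : ∀ n → proj₁ (unpair n) ≤ℕ n
unpair₁-≤ n = ℕₚ.≤-trans (ℕₚ.m≤m+n _ _) (sum≤ n)
  where
  step : ∀ p k → proj₁ p +ℕ proj₂ p ≤ℕ k → proj₁ (next p) +ℕ proj₂ (next p) ≤ℕ suc k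
  step (zero , y) k h rewrite ℕₚ.+-identityʳ y = s≤s h
  step (suc x , y) k h rewrite ℕₚ.+-suc x y = ℕₚ.m≤n⇒m≤1+n h
  sum≤ : ∀ n → proj₁ (unpair n) +ℕ proj₂ (unpair n) ≤ℕ n
  sum≤ zero = z≤n
  sum≤ (suc n) = step (unpair n) n (sum≤ n)

tag arg₁ arg₂ : ℕ → ℕ
tag c = proj₁ (unpair c)
arg₁ c = proj₁ (unpair (proj₂ (unpair c)))
arg₂ c = proj₂ (unpair (proj₂ (unpair c)))

triple : ∀ t x y → Σ ℕ λ c → tag c ≡ t × arg₁ c ≡ x × arg₂ c ≡ y
triple t x y with unpair-onto x y
... | r , p with unpair-onto t r
... | c , q = c , cong proj₁ q , trans (cong (λ z → proj₁ (unpair (proj₂ z))) q) (cong proj₁ p)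
                , trans (cong (λ z → proj₂ (unpair (proj₂ z))) q) (cong proj₂ p)

nthVar : ∀ {n} → ℕ → Tm n
nthVar {zero} c = `0
nthVar {suc n} zero = var zero
nthVar {suc n} (suc c) = wkT (nthVar c)

nthVar-toℕ : ∀ {n} (i : Fin n) → nthVar (toℕ i) ≡ var i
nthVar-toℕ zero = refl
nthVar-toℕ (suc i) = cong wkT (nthVar-toℕ i)

memNth : ∀ {n m} → Tm n → ℕ → Fm n m
memNth {m = zero} t c = ⊥̇
memNth {m = suc m} t zero = t ∈̇ zero
memNth {m = suc m} t (suc c) = wkS (memNth t c)

memNth-toℕ : ∀ {n m} (t : Tm n) (X : Fin m) → memNth t (toℕ X) ≡ t ∈̇ X
memNth-toℕ t zero = refl
memNth-toℕ t (suc X) = cong wkS (memNth-toℕ t X)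

nodeT : (∀ {n} → ℕ → Tm n) → ∀ {n} → ℕ → ℕ → ℕ → Tm n
nodeT rec 0 x y = nthVar x
nodeT rec 1 x y = `0
nodeT rec 2 x y = `1
nodeT rec 3 x y = rec x ⊕ rec y
nodeT rec _ x y = rec x ⊗ rec y

decT : ℕ → ∀ {n} → ℕ → Tm n
decT zero c = `0
decT (suc d) c = nodeT (decT d) (tag c) (arg₁ c) (arg₂ c)

nodeF : ℕ → (∀ {n m} → ℕ → Fm n m) → ∀ {n m} → ℕ → ℕ → ℕ → Fm n m
nodeF d rec 0 x y = decT d x ≐ decT d y
nodeF d rec 1 x y = decT d x ≺ decT d y
nodeF d rec 2 x y = memNth (decT d x) y
nodeF d rec 3 x y = ⊥̇
nodeF d rec 4 x y = rec x ⇒ rec y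
nodeF d rec 5 x y = rec x ∧̇ rec y
nodeF d rec 6 x y = rec x ∨̇ rec y
nodeF d rec 7 x y = ∀ₙ (rec x)
nodeF d rec 8 x y = ∃ₙ (rec x)
nodeF d rec 9 x y = ∀ₛ (rec x)
nodeF d rec _ x y = ∃ₛ (rec x)

decF : ℕ → ∀ {n m} → ℕ → Fm n m
decF zero c = ⊥̇
decF (suc d) c = nodeF d (decF d) (tag c) (arg₁ c) (arg₂ c)

-- Formulas are enumerated together with their `Δ₀` derivations, so that every index yields a
-- formula to which comprehension applies.
nodeΔ : ℕ → (∀ {n} → ℕ → Σ (Fm n 0) Δ₀) → ∀ {n} → ℕ → ℕ → ℕ → Σ (Fm n 0) Δ₀
nodeΔ d rec 0 x y = decT d x ≐ decT d y , d-≐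
nodeΔ d rec 1 x y = decT d x ≺ decT d y , d-≺
nodeΔ d rec 2 x y = ⊥̇ , d-⊥
nodeΔ d rec 3 x y = (proj₁ (rec x) ⇒ proj₁ (rec y)) , d-⇒ (proj₂ (rec x)) (proj₂ (rec y))
nodeΔ d rec 4 x y = proj₁ (rec x) ∧̇ proj₁ (rec y) , d-∧ (proj₂ (rec x)) (proj₂ (rec y))
nodeΔ d rec 5 x y = proj₁ (rec x) ∨̇ proj₁ (rec y) , d-∨ (proj₂ (rec x)) (proj₂ (rec y))
nodeΔ d rec 6 x y = ∀ₙ ((var zero ≺ wkT (decT d x)) ⇒ proj₁ (rec y)) , d-b∀ (decT d x) (proj₂ (rec y))
nodeΔ d rec _ x y = ∃ₙ ((var zero ≺ wkT (decT d x)) ∧̇ proj₁ (rec y)) , d-b∃ (decT d x) (proj₂ (rec y))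

decΔ : ℕ → ∀ {n} → ℕ → Σ (Fm n 0) Δ₀
decΔ zero c = ⊥̇ , d-⊥
decΔ (suc d) c = nodeΔ d (decΔ d) (tag c) (arg₁ c) (arg₂ c)

-- Surjectivity of the decoders is proved for all sufficiently large fuel, so that subcodes can share it.
Coded : {A : Set} → (ℕ → ℕ → A) → A → Set
Coded dec x = Σ ℕ λ D → ∀ d → D ≤ℕ d → Σ ℕ λ c → dec d c ≡ x

at-code : {A : Set} (g : ℕ → ℕ → ℕ → A) (t x y : ℕ) →
          Σ ℕ λ c → g (tag c) (arg₁ c) (arg₂ c) ≡ g t x y
at-code g t x y with triple t x y
... | c , p , q , r = c , trans (cong (λ z → g z (arg₁ c) (arg₂ c)) p) (cong₂ (g t) q r)

coded-0 : {A : Set} (dec : ℕ → ℕ → A) (g : ℕ → ℕ → ℕ → ℕ → A) →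
          (∀ d c → dec (suc d) c ≡ g d (tag c) (arg₁ c) (arg₂ c)) →
          (t x : ℕ) {a : A} → (∀ d → g d t x 0 ≡ a) → Coded dec a
coded-0 dec g h t x e = 1 , λ { (suc d) _ → let (c , p) = at-code (g d) t x 0 in
  c , trans (h d c) (trans p (e d)) }

coded-2 : {A B C : Set} (dec : ℕ → ℕ → A) (g : ℕ → ℕ → ℕ → ℕ → A) →
          (∀ d c → dec (suc d) c ≡ g d (tag c) (arg₁ c) (arg₂ c)) →
          {decB : ℕ → ℕ → B} {decC : ℕ → ℕ → C} {b : B} {c : C} (f : B → C → A) (t : ℕ) →
          (∀ d x y → g d t x y ≡ f (decB d x) (decC d y)) → Coded decB b → Coded decC c → Coded dec (f b c)
coded-2 dec g h f t e (D₁ , k₁) (D₂ , k₂) = suc (D₁ ⊔ D₂) , λ { (suc d) (s≤s p) →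
  let (x , px) = k₁ d (ℕₚ.≤-trans (ℕₚ.m≤m⊔n D₁ D₂) p)
      (y , py) = k₂ d (ℕₚ.≤-trans (ℕₚ.m≤n⊔m D₁ D₂) p)
      (c , q) = at-code (g d) t x y
  in c , trans (h d c) (trans q (trans (e d x y) (cong₂ f px py))) }

coded-1 : {A B : Set} (dec : ℕ → ℕ → A) (g : ℕ → ℕ → ℕ → ℕ → A) →
          (∀ d c → dec (suc d) c ≡ g d (tag c) (arg₁ c) (arg₂ c)) →
          {decB : ℕ → ℕ → B} {b : B} (f : B → A) (t : ℕ) →
          (∀ d x y → g d t x y ≡ f (decB d x)) → Coded decB b → Coded dec (f b)
coded-1 dec g h {decB} f t e k = coded-2 dec g h {decB} {decB} (λ x _ → f x) t e k k

stepT : ∀ {n} → ℕ → ℕ → ℕ → ℕ → Tm n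
stepT d = nodeT (decT d)

stepF : ∀ {n m} → ℕ → ℕ → ℕ → ℕ → Fm n m
stepF d = nodeF d (decF d)

stepΔ : ∀ {n} → ℕ → ℕ → ℕ → ℕ → Σ (Fm n 0) Δ₀
stepΔ d = nodeΔ d (decΔ d)

codeT : ∀ {n} (t : Tm n) → Coded (λ d → decT d) t
codeT (var i) = coded-0 _ stepT (λ _ _ → refl) 0 (toℕ i) (λ _ → nthVar-toℕ i)
codeT `0 = coded-0 _ stepT (λ _ _ → refl) 1 0 (λ _ → refl)
codeT `1 = coded-0 _ stepT (λ _ _ → refl) 2 0 (λ _ → refl)
codeT (s ⊕ t) = coded-2 _ stepT (λ _ _ → refl) _⊕_ 3 (λ _ _ _ → refl) (codeT s) (codeT t)
codeT (s ⊗ t) = coded-2 _ stepT (λ _ _ → refl) _⊗_ 4 (λ _ _ _ → refl) (codeT s) (codeT t)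

codeF : ∀ {n m} (φ : Fm n m) → Coded (λ d → decF d) φ
codeF (s ≐ t) = coded-2 _ stepF (λ _ _ → refl) _≐_ 0 (λ _ _ _ → refl) (codeT s) (codeT t)
codeF (s ≺ t) = coded-2 _ stepF (λ _ _ → refl) _≺_ 1 (λ _ _ _ → refl) (codeT s) (codeT t)
codeF (t ∈̇ X) = subst (Coded (λ d → decF d)) (memNth-toℕ t X)
  (coded-2 _ stepF (λ _ _ → refl) {decC = λ _ y → y} memNth 2 (λ _ _ _ → refl)
    (codeT t) (0 , λ _ _ → toℕ X , refl))
codeF ⊥̇ = coded-0 _ stepF (λ _ _ → refl) 3 0 (λ _ → refl)
codeF (φ ⇒ ψ) = coded-2 _ stepF (λ _ _ → refl) _⇒_ 4 (λ _ _ _ → refl) (codeF φ) (codeF ψ)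
codeF (φ ∧̇ ψ) = coded-2 _ stepF (λ _ _ → refl) _∧̇_ 5 (λ _ _ _ → refl) (codeF φ) (codeF ψ)
codeF (φ ∨̇ ψ) = coded-2 _ stepF (λ _ _ → refl) _∨̇_ 6 (λ _ _ _ → refl) (codeF φ) (codeF ψ)
codeF (∀ₙ φ) = coded-1 _ stepF (λ _ _ → refl) ∀ₙ 7 (λ _ _ _ → refl) (codeF φ)
codeF (∃ₙ φ) = coded-1 _ stepF (λ _ _ → refl) ∃ₙ 8 (λ _ _ _ → refl) (codeF φ)
codeF (∀ₛ φ) = coded-1 _ stepF (λ _ _ → refl) ∀ₛ 9 (λ _ _ _ → refl) (codeF φ)
codeF (∃ₛ φ) = coded-1 _ stepF (λ _ _ → refl) ∃ₛ 10 (λ _ _ _ → refl) (codeF φ)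

codeΔ : ∀ {n} {φ : Fm n 0} (p : Δ₀ φ) → Coded (λ d → decΔ d) (φ , p)
codeΔ (d-≐ {s = s} {t}) =
  coded-2 _ stepΔ (λ _ _ → refl) (λ s t → s ≐ t , d-≐) 0 (λ _ _ _ → refl) (codeT s) (codeT t)
codeΔ (d-≺ {s = s} {t}) =
  coded-2 _ stepΔ (λ _ _ → refl) (λ s t → s ≺ t , d-≺) 1 (λ _ _ _ → refl) (codeT s) (codeT t)
codeΔ d-⊥ = coded-0 _ stepΔ (λ _ _ → refl) 2 0 (λ _ → refl)
codeΔ (d-⇒ p q) = coded-2 _ stepΔ (λ _ _ → refl)
  (λ (φ , p) (ψ , q) → (φ ⇒ ψ) , d-⇒ p q) 3 (λ _ _ _ → refl) (codeΔ p) (codeΔ q)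
codeΔ (d-∧ p q) = coded-2 _ stepΔ (λ _ _ → refl)
  (λ (φ , p) (ψ , q) → φ ∧̇ ψ , d-∧ p q) 4 (λ _ _ _ → refl) (codeΔ p) (codeΔ q)
codeΔ (d-∨ p q) = coded-2 _ stepΔ (λ _ _ → refl)
  (λ (φ , p) (ψ , q) → φ ∨̇ ψ , d-∨ p q) 5 (λ _ _ _ → refl) (codeΔ p) (codeΔ q)
codeΔ (d-b∀ t p) = coded-2 _ stepΔ (λ _ _ → refl)
  (λ t (φ , p) → ∀ₙ ((var zero ≺ wkT t) ⇒ φ) , d-b∀ t p) 6 (λ _ _ _ → refl) (codeT t) (codeΔ p)
codeΔ (d-b∃ t p) = coded-2 _ stepΔ (λ _ _ → refl)
  (λ t (φ , p) → ∃ₙ ((var zero ≺ wkT t) ∧̇ φ) , d-b∃ t p) 7 (λ _ _ _ → refl) (codeT t) (codeΔ p)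

fuelled : {A : Set} → (ℕ → ℕ → A) → ℕ → A
fuelled dec c = dec (proj₁ (unpair c)) (proj₂ (unpair c))

fuelled-onto : {A : Set} {dec : ℕ → ℕ → A} {x : A} → Coded dec x → Σ ℕ λ c → fuelled dec c ≡ x
fuelled-onto {dec = dec} (D , k) with k D ℕₚ.≤-refl
... | c , p with unpair-onto D c
... | e , q = e , trans (cong (λ z → dec (proj₁ z) (proj₂ z)) q) p

enumF : ∀ {n m} → ℕ → Fm n m
enumF = fuelled (λ d → decF d)

enumF-onto : ∀ {n m} (φ : Fm n m) → Σ ℕ λ c → enumF c ≡ φ
enumF-onto φ = fuelled-onto (codeF φ)

abstract
  enumΔ : ∀ {n} → ℕ → Σ (Fm n 0) Δ₀
  enumΔ = fuelled (λ d → decΔ d)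

  enumΔ-onto : ∀ {n} {φ : Fm n 0} (p : Δ₀ φ) → Σ ℕ λ c → enumΔ c ≡ (φ , p)
  enumΔ-onto p = fuelled-onto (codeΔ p)

-- Direct limits along weakening

module Grow (F : ℕ → Set) (wk : ∀ {N} → F N → F (suc N)) (junk : F 0) where

  -- An element of the direct limit of the contexts is represented by a sequence that follows `wk`
  -- from some stage on. The stages before `K` are filled with `junk`, and nothing is claimed about
  -- them.
  grow : ∀ K → F K → ∀ N → F N
  grow K x zero with K ≟ zero
  ... | yes refl = x
  ... | no _ = junk
  grow K x (suc N) with K ≟ suc N
  ... | yes refl = x
  ... | no _ = wk (grow K x N)

  grow-hit : ∀ K x → grow K x K ≡ x
  grow-hit zero x = refl
  grow-hit (suc K) x with suc K ≟ suc K
  ... | yes refl = refl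
  ... | no ¬p = ⊥-elim (¬p refl)

  grow-coh : ∀ K x N → K ≤ℕ N → grow K x (suc N) ≡ wk (grow K x N)
  grow-coh K x N h with K ≟ suc N
  ... | yes refl = ⊥-elim (ℕₚ.1+n≰n h)
  ... | no _ = refl

  Coherent : (∀ N → F N) → ℕ → Set
  Coherent g K = ∀ N → K ≤ℕ N → g (suc N) ≡ wk (g N)

  grow-unique : (g : ∀ N → F N) (K : ℕ) → Coherent g K → ∀ N → K ≤ℕ N → grow K (g K) N ≡ g N
  grow-unique g zero h zero z≤n = refl
  grow-unique g K h (suc N) p with K ≟ suc N
  ... | yes refl = refl
  ... | no ¬q = trans (cong wk (grow-unique g K h N (pred p ¬q))) (sym (h N (pred p ¬q)))
    where
    pred : K ≤ℕ suc N → K ≢ suc N → K ≤ℕ N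
    pred p q = ℕₚ.≤-pred (ℕₚ.≤∧≢⇒< p q)

-- Completeness

module Hilbert (T : Theory) where

  infix 2 _⊩_
  _⊩_ : ∀ {n m} → Fm n m → Fm n m → Set
  A ⊩ B = Pf T (A ⇒ B)

  module _ {n m : ℕ} where

    constᵖ : {A B : Fm n m} → Pf T B → A ⊩ B
    constᵖ p = mp (pK _ _) p

    appᵖ : {A B C : Fm n m} → A ⊩ (B ⇒ C) → A ⊩ B → A ⊩ C
    appᵖ p q = mp (mp (pS _ _ _) p) q

    idᵖ : {A : Fm n m} → A ⊩ A
    idᵖ {A} = appᵖ (pK A (A ⇒ A)) (pK A A)

    infixr 3 _⨾_
    _⨾_ : {A B C : Fm n m} → A ⊩ B → B ⊩ C → A ⊩ C
    p ⨾ q = appᵖ (constᵖ q) p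

    pairᵖ : {A B C : Fm n m} → A ⊩ B → A ⊩ C → A ⊩ (B ∧̇ C)
    pairᵖ p q = appᵖ (p ⨾ p∧I _ _) q

    fstᵖ : {A B : Fm n m} → A ∧̇ B ⊩ A
    fstᵖ = p∧E₁ _ _

    sndᵖ : {A B : Fm n m} → A ∧̇ B ⊩ B
    sndᵖ = p∧E₂ _ _

    curryᵖ : {A B C : Fm n m} → A ∧̇ B ⊩ C → A ⊩ (B ⇒ C)
    curryᵖ p = appᵖ (constᵖ (mp (pS _ _ _) (constᵖ p)) ) (p∧I _ _)

    compᵖ : {A B C : Fm n m} → (A ⇒ B) ⊩ ((C ⇒ A) ⇒ (C ⇒ B))
    compᵖ = pK _ _ ⨾ pS _ _ _

    efqᵖ : {A : Fm n m} → ⊥̇ ⊩ A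
    efqᵖ = pK _ _ ⨾ pDNE _

    dneᵖ : {A : Fm n m} → (¬̇ ¬̇ A) ⊩ A
    dneᵖ = pDNE _

    ≡⇒⊩ : {A B : Fm n m} → A ≡ B → A ⊩ B
    ≡⇒⊩ refl = idᵖ

  leib : ∀ {n m} (φ : Fm (suc n) m) {s t : Tm n} {A B : Fm n m} →
         φ [ s ]ₙ ≡ A → φ [ t ]ₙ ≡ B → (s ≐ t) ⊩ (A ⇒ B)
  leib φ refl refl = eSubst φ _ _

  module _ {n m : ℕ} where

    wk-id : ∀ {σ : Fin (suc n) → Tm n} → (∀ i → σ (suc i) ≡ var i) → (s : Tm n) → substT σ (wkT s) ≡ s
    wk-id {σ} h s = trans (substT-renT σ suc s) (substT-var h s)

    eqSym : {s t : Tm n} → (s ≐ t) ⊩ _≐_ {m = m} t s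
    eqSym {s} = appᵖ (leib (var zero ≐ wkT s) (cong (_ ≐_) (wk-id (λ _ → refl) s))
      (cong (_ ≐_) (wk-id (λ _ → refl) s)))
                     (constᵖ (eRefl s))

    eqTrans : {s t u : Tm n} → (s ≐ t) ⊩ (t ≐ u ⇒ _≐_ {m = m} s u)
    eqTrans {s} = curryᵖ (appᵖ (sndᵖ ⨾ leib (wkT s ≐ var zero) (cong (_≐ _) (wk-id (λ _ → refl) s))
                                             (cong (_≐ _) (wk-id (λ _ → refl) s))) fstᵖ)

    eq⊕ : {x y u v : Tm n} → (x ≐ y) ⊩ (u ≐ v ⇒ _≐_ {m = m} (x ⊕ u) (y ⊕ v))
    eq⊕ {x} {y} {u} = curryᵖ (appᵖ (sndᵖ ⨾ leib (wkT (x ⊕ u) ≐ wkT y ⊕ var zero)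
        (cong₂ _≐_ (wk-id (λ _ → refl) (x ⊕ u)) (cong (_⊕ _) (wk-id (λ _ → refl) y)))
        (cong₂ _≐_ (wk-id (λ _ → refl) (x ⊕ u)) (cong (_⊕ _) (wk-id (λ _ → refl) y))))
      (appᵖ (fstᵖ ⨾ leib (wkT (x ⊕ u) ≐ var zero ⊕ wkT u)
        (cong₂ _≐_ (wk-id (λ _ → refl) (x ⊕ u)) (cong (_ ⊕_) (wk-id (λ _ → refl) u)))
        (cong₂ _≐_ (wk-id (λ _ → refl) (x ⊕ u)) (cong (_ ⊕_) (wk-id (λ _ → refl) u))))
        (constᵖ (eRefl _))))

    eq⊗ : {x y u v : Tm n} → (x ≐ y) ⊩ (u ≐ v ⇒ _≐_ {m = m} (x ⊗ u) (y ⊗ v))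
    eq⊗ {x} {y} {u} = curryᵖ (appᵖ (sndᵖ ⨾ leib (wkT (x ⊗ u) ≐ wkT y ⊗ var zero)
        (cong₂ _≐_ (wk-id (λ _ → refl) (x ⊗ u)) (cong (_⊗ _) (wk-id (λ _ → refl) y)))
        (cong₂ _≐_ (wk-id (λ _ → refl) (x ⊗ u)) (cong (_⊗ _) (wk-id (λ _ → refl) y))))
      (appᵖ (fstᵖ ⨾ leib (wkT (x ⊗ u) ≐ var zero ⊗ wkT u)
        (cong₂ _≐_ (wk-id (λ _ → refl) (x ⊗ u)) (cong (_ ⊗_) (wk-id (λ _ → refl) u)))
        (cong₂ _≐_ (wk-id (λ _ → refl) (x ⊗ u)) (cong (_ ⊗_) (wk-id (λ _ → refl) u))))
        (constᵖ (eRefl _))))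

    eq≺ : {x y u v : Tm n} → (x ≐ y) ⊩ (u ≐ v ⇒ x ≺ u ⇒ _≺_ {m = m} y v)
    eq≺ {x} {y} {u} = curryᵖ (curryᵖ (appᵖ (fstᵖ ⨾ sndᵖ ⨾ leib (wkT y ≺ var zero)
        (cong (_≺ _) (wk-id (λ _ → refl) y)) (cong (_≺ _) (wk-id (λ _ → refl) y)))
      (appᵖ (fstᵖ ⨾ fstᵖ ⨾ leib (var zero ≺ wkT u)
        (cong (_ ≺_) (wk-id (λ _ → refl) u)) (cong (_ ≺_) (wk-id (λ _ → refl) u))) sndᵖ)))

    eq∈ : {x y : Tm n} {Y : Fin m} → (x ≐ y) ⊩ (x ∈̇ Y ⇒ y ∈̇ Y)
    eq∈ {Y = Y} = leib (var zero ∈̇ Y) refl refl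

  -- Adding the Henkin axiom for a fresh variable is conservative: refuting `C ⇒ wkN (∀ₙ C)` from
  -- `B` means deriving both `C` and the negation of `∀ₙ C`. The fresh variable does not occur in
  -- `B`, so generalizing the former contradicts the latter.
  removeN : ∀ {n m} {B : Fm n m} {C : Fm (suc n) m} →
            wkN B ∧̇ (C ⇒ wkN (∀ₙ C)) ⊩ ⊥̇ → B ⊩ ⊥̇
  removeN {B = B} {C} p = appᵖ (mp (q∀D _ _) (genN (curryᵖ p₂)) ⨾ q∀V (¬̇ (∀ₙ C))) (mp (q∀D _ _) (genN p₁))
    where
    q : wkN B ⊩ (¬̇ (C ⇒ wkN (∀ₙ C)))
    q = curryᵖ p
    p₁ : wkN B ⊩ C
    p₁ = curryᵖ (appᵖ (fstᵖ ⨾ q) (curryᵖ (appᵖ (fstᵖ ⨾ sndᵖ) sndᵖ ⨾ efqᵖ))) ⨾ dneᵖ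
    p₂ : wkN B ∧̇ wkN (∀ₙ C) ⊩ ⊥̇
    p₂ = appᵖ (fstᵖ ⨾ q) (sndᵖ ⨾ pK _ _)

  removeS : ∀ {n m} {B : Fm n m} {C : Fm n (suc m)} →
            wkS B ∧̇ (C ⇒ wkS (∀ₛ C)) ⊩ ⊥̇ → B ⊩ ⊥̇
  removeS {B = B} {C} p = appᵖ (mp (s∀D _ _) (genS (curryᵖ p₂)) ⨾ s∀V (¬̇ (∀ₛ C))) (mp (s∀D _ _) (genS p₁))
    where
    q : wkS B ⊩ (¬̇ (C ⇒ wkS (∀ₛ C)))
    q = curryᵖ p
    p₁ : wkS B ⊩ C
    p₁ = curryᵖ (appᵖ (fstᵖ ⨾ q) (curryᵖ (appᵖ (fstᵖ ⨾ sndᵖ) sndᵖ ⨾ efqᵖ))) ⨾ dneᵖ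
    p₂ : wkS B ∧̇ wkS (∀ₛ C) ⊩ ⊥̇
    p₂ = appᵖ (fstᵖ ⨾ q) (sndᵖ ⨾ pK _ _)

-- The Henkin theory and its term model

⊤̇ : ∀ {n m} → Fm n m
⊤̇ = ⊥̇ ⇒ ⊥̇

conj : ∀ {n m} → (ℕ → Fm n m) → ℕ → Fm n m
conj b zero = ⊤̇
conj b (suc N) = conj b N ∧̇ b N

wk : ∀ {n m} → Fm n m → Fm (suc n) (suc m)
wk φ = wkS (wkN φ)

inst-wk : ∀ {n m n' m'} (σ : Fin n → Tm n') (τ : Fin m → Fin m') (φ : Fm n m) {σ' τ'} →
          (∀ i → σ' i ≡ wkT (σ i)) → (∀ i → τ' i ≡ suc (τ i)) →
          renS τ' (substF σ' φ) ≡ wk (renS τ (substF σ φ))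
inst-wk σ τ φ hσ hτ = sym
  (trans (cong wkS (substF-renS _ τ (substF σ φ)))
    (trans (renS-∘ suc τ (λ i → sym (hτ i)) (wkN (substF σ φ)))
      (cong (renS _) (substF-∘ (λ i → var (suc i)) σ (λ i → trans (sym (renT≡substT suc (σ i))) (sym (hσ i))) φ))))

instB-wk : ∀ {n m n' m'} (σ : Fin n → Tm n') (τ : Fin m → Fin m') (φ : Fm (suc n) m) {σ' τ'} →
           (∀ i → σ' i ≡ wkT (σ i)) → (∀ i → τ' i ≡ suc (τ i)) →
           renS τ' (substF (liftσ σ') φ) ≡ renS suc (substF (liftσ (λ i → var (suc i))) (renS τ (substF (liftσ σ) φ)))
instB-wk σ τ φ hσ hτ = sym
  (trans (cong wkS (substF-renS _ τ (substF (liftσ σ) φ)))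
    (trans (renS-∘ suc τ (λ i → sym (hτ i)) (substF _ (substF (liftσ σ) φ)))
      (cong (renS _) (substF-∘ _ (liftσ σ)
        (liftσ-∘ _ σ (λ i → trans (sym (renT≡substT suc (σ i))) (sym (hσ i)))) φ))))

instC-wk : ∀ {n m n' m'} (σ : Fin n → Tm n') (τ : Fin m → Fin m') (φ : Fm n (suc m)) {σ' τ'} →
           (∀ i → σ' i ≡ wkT (σ i)) → (∀ i → τ' i ≡ suc (τ i)) →
           renS (liftρ τ') (substF σ' φ) ≡ renS (liftρ suc) (wkN (renS (liftρ τ) (substF σ φ)))
instC-wk σ τ φ hσ hτ = sym
  (trans (cong (renS _) (substF-renS _ (liftρ τ) (substF σ φ)))
    (trans (renS-∘ (liftρ suc) (liftρ τ) (liftρ-∘ (λ i → sym (hτ i))) (wkN (substF σ φ)))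
      (cong (renS _) (substF-∘ (λ i → var (suc i)) σ (λ i → trans (sym (renT≡substT suc (σ i))) (sym (hσ i))) φ))))

liftσ-id : ∀ {n} {σ : Fin n → Tm n} → (∀ i → σ i ≡ var i) → ∀ i → liftσ σ i ≡ var i
liftσ-id h zero = refl
liftσ-id h (suc i) = cong wkT (h i)

liftρ-id : ∀ {n} {ρ : Fin n → Fin n} → (∀ i → ρ i ≡ i) → ∀ i → liftρ ρ i ≡ i
liftρ-id h zero = refl
liftρ-id h (suc i) = cong suc (h i)

substF-id : ∀ {n m} {σ : Fin n → Tm n} → (∀ i → σ i ≡ var i) → (φ : Fm n m) → substF σ φ ≡ φ
substF-id h (s ≐ t) = cong₂ _≐_ (substT-var h s) (substT-var h t)
substF-id h (s ≺ t) = cong₂ _≺_ (substT-var h s) (substT-var h t)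
substF-id h (t ∈̇ X) = cong (_∈̇ X) (substT-var h t)
substF-id h ⊥̇ = refl
substF-id h (φ ⇒ ψ) = cong₂ _⇒_ (substF-id h φ) (substF-id h ψ)
substF-id h (φ ∧̇ ψ) = cong₂ _∧̇_ (substF-id h φ) (substF-id h ψ)
substF-id h (φ ∨̇ ψ) = cong₂ _∨̇_ (substF-id h φ) (substF-id h ψ)
substF-id h (∀ₙ φ) = cong ∀ₙ (substF-id (liftσ-id h) φ)
substF-id h (∃ₙ φ) = cong ∃ₙ (substF-id (liftσ-id h) φ)
substF-id h (∀ₛ φ) = cong ∀ₛ (substF-id h φ)
substF-id h (∃ₛ φ) = cong ∃ₛ (substF-id h φ)

renS-id : ∀ {n m} {ρ : Fin m → Fin m} → (∀ i → ρ i ≡ i) → (φ : Fm n m) → renS ρ φ ≡ φ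
renS-id h (s ≐ t) = refl
renS-id h (s ≺ t) = refl
renS-id h (t ∈̇ X) = cong (t ∈̇_) (h X)
renS-id h ⊥̇ = refl
renS-id h (φ ⇒ ψ) = cong₂ _⇒_ (renS-id h φ) (renS-id h ψ)
renS-id h (φ ∧̇ ψ) = cong₂ _∧̇_ (renS-id h φ) (renS-id h ψ)
renS-id h (φ ∨̇ ψ) = cong₂ _∨̇_ (renS-id h φ) (renS-id h ψ)
renS-id h (∀ₙ φ) = cong ∀ₙ (renS-id h φ)
renS-id h (∃ₙ φ) = cong ∃ₙ (renS-id h φ)
renS-id h (∀ₛ φ) = cong ∀ₛ (renS-id (liftρ-id h) φ)
renS-id h (∃ₛ φ) = cong ∃ₛ (renS-id (liftρ-id h) φ)

maxF : ∀ {n} → (Fin n → ℕ) → ℕ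
maxF {zero} f = 0
maxF {suc n} f = f zero ⊔ maxF (λ i → f (suc i))

≤-maxF : ∀ {n} (f : Fin n → ℕ) i → f i ≤ℕ maxF f
≤-maxF f zero = ℕₚ.m≤m⊔n _ _
≤-maxF f (suc i) = ℕₚ.≤-trans (≤-maxF (λ i → f (suc i)) i) (ℕₚ.m≤n⊔m (f zero) _)

-- Stage 0 has one number variable and two set variables, which will become a, X and U; each further
-- stage adds one Henkin constant of either sort.
CF CT CS : ℕ → Set
CF N = Fm (suc N) (suc (suc N))
CT N = Tm (suc N)
CS N = Fin (suc (suc N))

module GF = Grow CF wk ⊥̇
module GT = Grow CT wkT (var zero)
module GS = Grow CS suc zero
module GB = Grow (λ N → Fm (suc (suc N)) (suc (suc N))) (λ χ → renS suc (substF (liftσ (λ i → var (suc i))) χ)) ⊥̇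
module GC = Grow (λ N → Fm (suc N) (suc (suc (suc N)))) (λ χ → renS (liftρ suc) (wkN χ)) ⊥̇

module Henkin (T : Theory) (b : ℕ → Fm 1 2) (con : ∀ N → ¬ Pf T (conj b N ⇒ ⊥̇)) where

  open Hilbert T

  -- `N` is read as a stage together with a formula number, so every formula of every stage gets its
  -- turn at a stage that is at least its own.
  hb : ∀ N → Fm (suc (suc N)) (suc (suc N))
  hb N = GB.grow (proj₁ (unpair N)) (enumF (proj₂ (unpair N))) N

  hc : ∀ N → Fm (suc N) (suc (suc (suc N)))
  hc N = GC.grow (proj₁ (unpair N)) (enumF (proj₂ (unpair N))) N

  -- The axioms have the form "if the fresh constant satisfies C, then everything does", that is,
  -- the constant is a counterexample if there is one. Existential witnesses come from the axioms
  -- for negations.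
  hen : ∀ N → CF N
  hen zero = ⊤̇
  hen (suc N) = wkS (wkN (hen N) ∧̇ (hb N ⇒ wkN (∀ₙ (hb N)))) ∧̇ (wkN (hc N) ⇒ wkS (∀ₛ (wkN (hc N))))

  up : ∀ N → Fm 1 2 → CF N
  up zero φ = φ
  up (suc N) φ = wk (up N φ)

  -- Only finitely many of the formulas `b` enter each stage. The theory of a stage is thus a single
  -- formula, and the consistency of finite conjunctions suffices.
  th : ∀ N → CF N
  th N = up N (conj b N) ∧̇ hen N

  wk-⊩ : ∀ {n m} {A B : Fm n m} → A ⊩ B → wk A ⊩ wk B
  wk-⊩ p = Pf-renS suc (Pf-substF (λ i → var (suc i)) p)

  up-⊩ : ∀ N {A B : Fm 1 2} → A ⊩ B → up N A ⊩ up N B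
  up-⊩ zero p = p
  up-⊩ (suc N) p = wk-⊩ (up-⊩ N p)

  th-wk : ∀ N → th (suc N) ⊩ wk (th N)
  th-wk N = pairᵖ (fstᵖ ⨾ wk-⊩ (up-⊩ N fstᵖ)) (sndᵖ ⨾ fstᵖ ⨾ fstᵖ)

  -- Henkin axioms are taken off in the reverse order of their introduction: within a stage the set
  -- constant lives in the larger context and goes before the number constant.
  remove : ∀ N (β : Fm 1 2) → up N β ∧̇ hen N ⊩ ⊥̇ → β ⊩ ⊥̇
  remove zero β p = appᵖ (curryᵖ p) (constᵖ idᵖ)
  remove (suc N) β p =
    remove N β (pairᵖ fstᵖ sndᵖ ⨾ removeN (pairᵖ (fstᵖ ⨾ fstᵖ) (pairᵖ (fstᵖ ⨾ sndᵖ) sndᵖ) ⨾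
      removeS (pairᵖ (fstᵖ ⨾ fstᵖ) (pairᵖ (fstᵖ ⨾ sndᵖ) sndᵖ) ⨾ p)))

  consistent : ∀ N → ¬ (th N ⊩ ⊥̇)
  consistent N p = con N (remove N (conj b N) p)

  Der : (∀ N → CF N) → Set
  Der g = Σ ℕ λ K → ∀ N → K ≤ℕ N → th N ⊩ g N

  Der-coh : ∀ {g K} → GF.Coherent g K → ∀ N → K ≤ℕ N → th N ⊩ g N → Der g
  Der-coh {g} {K} coh N h p = N , λ N' le → go N' (ℕₚ.≤⇒≤′ le)
    where
    go : ∀ N' → N ≤′ N' → th N' ⊩ g N'
    go N' (≤′-reflexive refl) = p
    go (suc N') (≤′-step le) =
      th-wk N' ⨾ wk-⊩ (go N' le) ⨾ ≡⇒⊩ (sym (coh N' (ℕₚ.≤-trans h (ℕₚ.≤′⇒≤ le))))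

  Der-thm : ∀ {g} → (∀ N → Pf T (g N)) → Der g
  Der-thm p = 0 , λ N _ → constᵖ (p N)

  Seq : Set
  Seq = ∀ N → CF N

  infixr 4 _⇒ˢ_
  _⇒ˢ_ : Seq → Seq → Seq
  (f ⇒ˢ g) N = f N ⇒ g N

  ⊥ˢ : Seq
  ⊥ˢ N = ⊥̇

  F : ℕ → Seq
  F j = GF.grow (proj₁ (unpair j)) (enumF (proj₂ (unpair j)))

  -- E j is the theory generated by the axioms together with those of F 0, …, F (j - 1) that were consistent
  -- at their turn; stating it this way avoids deciding consistency.
  E : ℕ → Seq → Set
  E zero g = Der g
  E (suc j) g = E j g ⊎ (¬ E j (F j ⇒ˢ ⊥ˢ) × E j (F j ⇒ˢ g))

  Der⇒E : ∀ j {g} → Der g → E j g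
  Der⇒E zero d = d
  Der⇒E (suc j) d = inj₁ (Der⇒E j d)

  E-app : ∀ j {f g} → E j (f ⇒ˢ g) → E j f → E j g
  E-app zero (K , p) (L , q) = K ⊔ L , λ N h →
    appᵖ (p N (ℕₚ.≤-trans (ℕₚ.m≤m⊔n K L) h)) (q N (ℕₚ.≤-trans (ℕₚ.m≤n⊔m K L) h))
  E-app (suc j) (inj₁ p) (inj₁ q) = inj₁ (E-app j p q)
  E-app (suc j) {f} {g} (inj₁ p) (inj₂ (c , q)) =
    inj₂ (c , E-app j (E-app j (Der⇒E j (Der-thm (λ N → pS (F j N) (f N) (g N))))
                        (E-app j (Der⇒E j (Der-thm (λ N → pK _ _))) p)) q)
  E-app (suc j) {f} {g} (inj₂ (c , p)) (inj₁ q) =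
    inj₂ (c , E-app j (E-app j (Der⇒E j (Der-thm (λ N → pS (F j N) (f N) (g N)))) p)
                (E-app j (Der⇒E j (Der-thm (λ N → pK _ _))) q))
  E-app (suc j) {f} {g} (inj₂ (c , p)) (inj₂ (_ , q)) =
    inj₂ (c , E-app j (E-app j (Der⇒E j (Der-thm (λ N → pS (F j N) (f N) (g N)))) p) q)

  E-lift : ∀ k {j g} → E j g → E (k +ℕ j) g
  E-lift zero e = e
  E-lift (suc k) e = inj₁ (E-lift k e)

  E-consistent : ∀ j → ¬ E j ⊥ˢ
  E-consistent zero (K , p) = consistent K (p K ℕₚ.≤-refl)
  E-consistent (suc j) (inj₁ e) = E-consistent j e
  E-consistent (suc j) (inj₂ (c , e)) = c e

  H : Seq → Set
  H g = ¬ ¬ (Σ ℕ λ j → E j g)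

  H-app : ∀ {f g} → H (f ⇒ˢ g) → H f → H g
  H-app {f} {g} p q k = p (λ (i , e) → q (λ (j , e') →
    k (i +ℕ j , E-app (i +ℕ j) (subst (λ z → E z (f ⇒ˢ g)) (ℕₚ.+-comm j i) (E-lift j e)) (E-lift i e'))))

  H-Der : ∀ {g} → Der g → H g
  H-Der d k = k (0 , d)

  H-⊩ : ∀ {f g} → (∀ N → f N ⊩ g N) → H f → H g
  H-⊩ p h = H-app (H-Der (Der-thm p)) h

  H-≡ : ∀ {f g} → (∀ N → f N ≡ g N) → H f → H g
  H-≡ p = H-⊩ (λ N → ≡⇒⊩ (p N))

  H-consistent : ¬ H ⊥ˢ
  H-consistent h = h (λ (j , e) → E-consistent j e)

  H-stable : ∀ {g} → Stable (H g)
  H-stable h k = h (λ f → f k)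

  H-complete : ∀ {g K} → GF.Coherent g K → ¬ H g → H (g ⇒ˢ ⊥ˢ)
  H-complete {g} {K} coh ng k with enumF-onto (g K)
  ... | c , p with unpair-onto K c
  ... | j , q = ng (λ k' → k' (suc j , inj₂ ((λ e → k (j , refute e)) , Der⇒E j F⇒g)))
    where
    eq : ∀ N → K ≤ℕ N → F j N ≡ g N
    eq N h = trans (cong (λ z → GF.grow (proj₁ z) (enumF (proj₂ z)) N) q)
               (trans (cong (λ z → GF.grow K z N) p) (GF.grow-unique g K coh N h))
    F⇒g : Der (F j ⇒ˢ g)
    F⇒g = K , λ N h → constᵖ (≡⇒⊩ (eq N h))
    refute : E j (F j ⇒ˢ ⊥ˢ) → E j (g ⇒ˢ ⊥ˢ)
    refute e = E-app j (E-app j (Der⇒E j (Der-thm (λ N → compᵖ))) e)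
                 (Der⇒E j (K , λ N h → constᵖ (≡⇒⊩ (sym (eq N h)))))

  H-⇒ : ∀ {f g K} → GF.Coherent f K → (H f → H g) ⟷ H (f ⇒ˢ g)
  H-⇒ {f} {g} coh = (λ u → H-stable (λ k →
      k (H-⊩ (λ N → curryᵖ (appᵖ fstᵖ sndᵖ ⨾ efqᵖ))
          (H-complete coh (λ hf → k (H-⊩ (λ N → pK _ _) (u hf))))))) ,
    H-app

  record Elt : Set where
    field
      at : ∀ N → CT N
      from : ℕ
      coh : GT.Coherent at from
  open Elt public

  record SElt : Set where
    field
      atₛ : ∀ N → CS N
      fromₛ : ℕ
      cohₛ : GS.Coherent atₛ fromₛ
  open SElt public

  elt : ∀ K → CT K → Elt
  elt K x = record { at = GT.grow K x ; from = K ; coh = GT.grow-coh K x }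

  selt : ∀ K → CS K → SElt
  selt K x = record { atₛ = GS.grow K x ; fromₛ = K ; cohₛ = GS.grow-coh K x }


  Hen : Structure
  Hen = record
    { Dom = Elt
    ; Sets = SElt
    ; 0# = record { at = λ _ → `0 ; from = 0 ; coh = λ _ _ → refl }
    ; 1# = record { at = λ _ → `1 ; from = 0 ; coh = λ _ _ → refl }
    ; _+_ = λ x y → record
        { at = λ N → at x N ⊕ at y N ; from = from x ⊔ from y
        ; coh = λ N h → cong₂ _⊕_ (coh x N (ℕₚ.≤-trans (ℕₚ.m≤m⊔n _ _) h)) (coh y N (ℕₚ.≤-trans (ℕₚ.m≤n⊔m (from x) _)
          h)) }
    ; _*_ = λ x y → record
        { at = λ N → at x N ⊗ at y N ; from = from x ⊔ from y
        ; coh = λ N h → cong₂ _⊗_ (coh x N (ℕₚ.≤-trans (ℕₚ.m≤m⊔n _ _) h)) (coh y N (ℕₚ.≤-trans (ℕₚ.m≤n⊔m (from x) _)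
          h)) }
    ; _≈_ = λ x y → H (λ N → at x N ≐ at y N)
    ; _<_ = λ x y → H (λ N → at x N ≺ at y N)
    ; _∈_ = λ x Y → H (λ N → at x N ∈̇ atₛ Y N)
    ; set₀ = selt 0 zero
    ; ≈-refl = H-Der (Der-thm (λ N → eRefl _))
    ; ≈-sym = H-⊩ (λ N → eqSym)
    ; ≈-trans = λ p q → H-app (H-⊩ (λ N → eqTrans) p) q
    ; +-cong = λ p q → H-app (H-⊩ (λ N → eq⊕) p) q
    ; *-cong = λ p q → H-app (H-⊩ (λ N → eq⊗) p) q
    ; <-cong = λ p q r → H-app (H-app (H-⊩ (λ N → eq≺) p) q) r
    ; ∈-cong = λ p r → H-app (H-⊩ (λ N → eq∈) p) r
    ; ≈-stable = H-stable
    ; <-stable = H-stable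
    ; ∈-stable = H-stable
    }

  open Sem Hen

  inst : ∀ {n m} → Fm n m → (Fin n → Elt) → (Fin m → SElt) → Seq
  inst φ ρ τ N = renS (λ i → atₛ (τ i) N) (substF (λ i → at (ρ i) N) φ)

  fromᵥ : ∀ {n m} → (Fin n → Elt) → (Fin m → SElt) → ℕ
  fromᵥ ρ τ = maxF (λ i → from (ρ i)) ⊔ maxF (λ i → fromₛ (τ i))

  module _ {n m : ℕ} (ρ : Fin n → Elt) (τ : Fin m → SElt) where

    cohᵥ : ∀ N → fromᵥ ρ τ ≤ℕ N → ∀ i → at (ρ i) (suc N) ≡ wkT (at (ρ i) N)
    cohᵥ N h i = coh (ρ i) N (ℕₚ.≤-trans (ℕₚ.≤-trans (≤-maxF _ i) (ℕₚ.m≤m⊔n _ _)) h)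

    cohᵥₛ : ∀ N → fromᵥ ρ τ ≤ℕ N → ∀ i → atₛ (τ i) (suc N) ≡ suc (atₛ (τ i) N)
    cohᵥₛ N h i = cohₛ (τ i) N (ℕₚ.≤-trans (ℕₚ.≤-trans (≤-maxF _ i) (ℕₚ.m≤n⊔m (maxF (λ i → from (ρ i))) _)) h)

    inst-coh : (φ : Fm n m) → GF.Coherent (inst φ ρ τ) (fromᵥ ρ τ)
    inst-coh φ N h = inst-wk _ _ φ (cohᵥ N h) (cohᵥₛ N h)

  at-eval : ∀ {n} (t : Tm n) (ρ : Fin n → Elt) N → at (eval t ρ) N ≡ substT (λ i → at (ρ i) N) t
  at-eval (var i) ρ N = refl
  at-eval `0 ρ N = refl
  at-eval `1 ρ N = refl
  at-eval (s ⊕ t) ρ N = cong₂ _⊕_ (at-eval s ρ N) (at-eval t ρ N)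
  at-eval (s ⊗ t) ρ N = cong₂ _⊗_ (at-eval s ρ N) (at-eval t ρ N)

  fresh : ∀ N → Elt
  fresh N = elt (suc N) (var zero)

  freshₛ : ∀ N → SElt
  freshₛ N = selt (suc N) zero

  hits : ∀ (K c : ℕ) → Σ ℕ λ N → unpair N ≡ (K , c) × K ≤ℕ N
  hits K c with unpair-onto K c
  ... | N , p = N , p , subst (_≤ℕ N) (cong proj₁ p) (unpair₁-≤ N)

  -- The element is the constant introduced at the stage `N*` where the body of `φ`, with `ρ` and
  -- `τ` inserted, is scheduled. The work lies in identifying the scheduled formula with the
  -- instance of `φ` at that constant.
  henkinN : ∀ {n m} (φ : Fm (suc n) m) ρ τ →
            Σ Elt λ d → H (inst φ (d ▹ ρ) τ ⇒ˢ inst (∀ₙ φ) ρ τ)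
  henkinN {n} {m} φ ρ τ = fresh N* , H-Der (Der-coh coh' (suc N*) ℕₚ.≤-refl base)
    where
    K = fromᵥ ρ τ
    body : ∀ N → Fm (suc (suc N)) (suc (suc N))
    body N = renS (λ i → atₛ (τ i) N) (substF (liftσ (λ i → at (ρ i) N)) φ)
    bcoh : GB.Coherent body K
    bcoh N h = instB-wk _ _ φ (cohᵥ ρ τ N h) (cohᵥₛ ρ τ N h)
    code = enumF-onto (body K)
    hit = hits K (proj₁ code)
    N* = proj₁ hit
    K≤N* : K ≤ℕ N*
    K≤N* = proj₂ (proj₂ hit)
    hb≡ : hb N* ≡ body N*
    hb≡ = trans (cong (λ z → GB.grow (proj₁ z) (enumF (proj₂ z)) N*) (proj₁ (proj₂ hit)))
            (trans (cong (λ z → GB.grow K z N*) (proj₂ code)) (GB.grow-unique body K bcoh N* K≤N*))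
    σ≡ : ∀ i → at ((fresh N* ▹ ρ) i) (suc N*) ≡ liftσ (λ i → at (ρ i) N*) i
    σ≡ zero = GT.grow-hit (suc N*) (var zero)
    σ≡ (suc i) = cohᵥ ρ τ N* K≤N* i
    lhs≡ : wkS (body N*) ≡ inst φ (fresh N* ▹ ρ) τ (suc N*)
    lhs≡ = trans (renS-∘ suc _ (λ i → sym (cohᵥₛ ρ τ N* K≤N* i)) _) (cong (renS _) (substF-cong (λ i → sym (σ≡ i)) φ))
    coh' : GF.Coherent (inst φ (fresh N* ▹ ρ) τ ⇒ˢ inst (∀ₙ φ) ρ τ) (suc N*)
    coh' N h = cong₂ _⇒_ (inst-wk _ _ φ (λ { zero → coh (fresh N*) N h ; (suc i) → cohᵥ ρ τ N h' i })
      (cohᵥₛ ρ τ N h'))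
                         (inst-coh ρ τ (∀ₙ φ) N h')
      where h' = ℕₚ.≤-trans (ℕₚ.m≤n⇒m≤1+n K≤N*) h
    base : th (suc N*) ⊩ (inst φ (fresh N* ▹ ρ) τ (suc N*) ⇒ inst (∀ₙ φ) ρ τ (suc N*))
    base = subst₂ (λ x y → th (suc N*) ⊩ (x ⇒ y)) (trans (cong wkS hb≡) lhs≡)
             (trans (cong (λ z → wk (∀ₙ z)) hb≡) (sym (inst-coh ρ τ (∀ₙ φ) N* K≤N*)))
             (sndᵖ ⨾ fstᵖ ⨾ sndᵖ)

  henkinS : ∀ {n m} (φ : Fm n (suc m)) ρ τ →
            Σ SElt λ d → H (inst φ ρ (d ▹ τ) ⇒ˢ inst (∀ₛ φ) ρ τ)
  henkinS {n} {m} φ ρ τ = freshₛ N* , H-Der (Der-coh coh' (suc N*) ℕₚ.≤-refl base)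
    where
    K = fromᵥ ρ τ
    body : ∀ N → Fm (suc N) (suc (suc (suc N)))
    body N = renS (liftρ (λ i → atₛ (τ i) N)) (substF (λ i → at (ρ i) N) φ)
    bcoh : GC.Coherent body K
    bcoh N h = instC-wk _ _ φ (cohᵥ ρ τ N h) (cohᵥₛ ρ τ N h)
    code = enumF-onto (body K)
    hit = hits K (proj₁ code)
    N* = proj₁ hit
    K≤N* : K ≤ℕ N*
    K≤N* = proj₂ (proj₂ hit)
    hc≡ : hc N* ≡ body N*
    hc≡ = trans (cong (λ z → GC.grow (proj₁ z) (enumF (proj₂ z)) N*) (proj₁ (proj₂ hit)))
            (trans (cong (λ z → GC.grow K z N*) (proj₂ code)) (GC.grow-unique body K bcoh N* K≤N*))
    τ≡ : ∀ i → liftρ (λ i → atₛ (τ i) N*) i ≡ atₛ ((freshₛ N* ▹ τ) i) (suc N*)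
    τ≡ zero = sym (GS.grow-hit (suc N*) zero)
    τ≡ (suc i) = sym (cohᵥₛ ρ τ N* K≤N* i)
    lhs≡ : wkN (body N*) ≡ inst φ ρ (freshₛ N* ▹ τ) (suc N*)
    lhs≡ = trans (substF-renS _ (liftρ (λ i → atₛ (τ i) N*)) _)
             (trans (renS-cong τ≡ _)
               (cong (renS _) (substF-∘ _ _ (λ i → trans (sym (renT≡substT suc _)) (sym (cohᵥ ρ τ N* K≤N* i))) φ)))
    coh' : GF.Coherent (inst φ ρ (freshₛ N* ▹ τ) ⇒ˢ inst (∀ₛ φ) ρ τ) (suc N*)
    coh' N h = cong₂ _⇒_ (inst-wk _ _ φ (cohᵥ ρ τ N h') (λ { zero → cohₛ (freshₛ N*) N h ; (suc i) →
      cohᵥₛ ρ τ N h' i }))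
                         (inst-coh ρ τ (∀ₛ φ) N h')
      where h' = ℕₚ.≤-trans (ℕₚ.m≤n⇒m≤1+n K≤N*) h
    base : th (suc N*) ⊩ (inst φ ρ (freshₛ N* ▹ τ) (suc N*) ⇒ inst (∀ₛ φ) ρ τ (suc N*))
    base = subst₂ (λ x y → th (suc N*) ⊩ (x ⇒ y)) (trans (cong wkN hc≡) lhs≡)
             (trans (cong (λ z → wk (∀ₛ z)) hc≡) (sym (inst-coh ρ τ (∀ₛ φ) N* K≤N*)))
             (sndᵖ ⨾ sndᵖ)

  instN-at : ∀ {n m} (φ : Fm (suc n) m) ρ τ d N →
             renS (λ i → atₛ (τ i) N) (substF (liftσ (λ i → at (ρ i) N)) φ) [ at d N ]ₙ ≡ inst φ (d ▹ ρ) τ N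
  instN-at φ ρ τ d N = trans (substF-renS _ _ _) (cong (renS _)
    (substF-∘ _ _ (λ { zero → refl
                     ; (suc i) → trans (substT-renT _ suc (at (ρ i) N)) (substT-var (λ _ → refl) (at (ρ i) N)) }) φ))

  instS-at : ∀ {n m} (φ : Fm n (suc m)) ρ τ d N →
             renS (liftρ (λ i → atₛ (τ i) N)) (substF (λ i → at (ρ i) N) φ) [ atₛ d N ]ₛ ≡ inst φ ρ (d ▹ τ) N
  instS-at φ ρ τ d N = renS-∘ _ _ (λ { zero → refl ; (suc i) → refl }) _

  truth : ∀ {n m} (φ : Fm n m) ρ τ → Sat φ ρ τ ⟷ H (inst φ ρ τ)
  truth (s ≐ t) ρ τ = H-≡ eq , H-≡ (λ N → sym (eq N))
    where eq = λ N → cong₂ _≐_ (at-eval s ρ N) (at-eval t ρ N)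
  truth (s ≺ t) ρ τ = H-≡ eq , H-≡ (λ N → sym (eq N))
    where eq = λ N → cong₂ _≺_ (at-eval s ρ N) (at-eval t ρ N)
  truth (t ∈̇ X) ρ τ = H-≡ eq , H-≡ (λ N → sym (eq N))
    where eq = λ N → cong (_∈̇ atₛ (τ X) N) (at-eval t ρ N)
  truth ⊥̇ ρ τ = ⊥-elim , H-consistent
  truth (φ ⇒ ψ) ρ τ = ⟷-trans (→-⟷ (truth φ ρ τ) (truth ψ ρ τ)) (H-⇒ (inst-coh ρ τ φ))
  truth (φ ∧̇ ψ) ρ τ = ⟷-trans (×-⟷ (truth φ ρ τ) (truth ψ ρ τ))
    ((λ (p , q) → H-app (H-⊩ (λ N → p∧I _ _) p) q) , (λ h → H-⊩ (λ N → fstᵖ) h , H-⊩ (λ N → sndᵖ) h))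
  truth (φ ∨̇ ψ) ρ τ = ⟷-trans (¬¬⊎-⟷ (truth φ ρ τ) (truth ψ ρ τ))
    ((λ h → H-stable (λ k → h (λ { (inj₁ p) → k (H-⊩ (λ N → p∨I₁ _ _) p) ; (inj₂ p) → k (H-⊩ (λ N → p∨I₂ _ _) p) })))
      ,
     (λ h k → H-consistent (H-app (H-app (H-⊩ (λ N → p∨E _ _ _)
        (H-complete (inst-coh ρ τ φ) (λ p → k (inj₁ p))))
        (H-complete (inst-coh ρ τ ψ) (λ p → k (inj₂ p)))) h)))
  truth (∀ₙ φ) ρ τ =
    (λ f → let (d , h) = henkinN φ ρ τ in H-app h (proj₁ (truth φ (d ▹ ρ) τ) (f d))) ,
    (λ h d → proj₂ (truth φ (d ▹ ρ) τ) (H-⊩ (λ N → q∀E _ (at d N) ⨾ ≡⇒⊩ (instN-at φ ρ τ d N)) h))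
  truth (∃ₙ φ) ρ τ =
    (λ h → H-stable (λ k → h (λ (d , p) → k
      (H-⊩ (λ N → ≡⇒⊩ (sym (instN-at φ ρ τ d N)) ⨾ q∃I _ (at d N)) (proj₁ (truth φ (d ▹ ρ) τ) p))))) ,
    -- The constant belonging to `¬̇ φ` satisfies `φ` if anything does; if it does not, `∀ₙ (¬̇ φ)`
    -- belongs to `H` and contradicts `h`.
    (λ h k → let (d , e) = henkinN (¬̇ φ) ρ τ in
      H-consistent (H-app (H-⊩ (λ N → q∃D _ ⊥̇) (H-app e (proj₁ (H-⇒ (inst-coh (d ▹ ρ) τ φ))
        (λ p → ⊥-elim (k (d , proj₂ (truth φ (d ▹ ρ) τ) p)))))) h))
  truth (∀ₛ φ) ρ τ =
    (λ f → let (d , h) = henkinS φ ρ τ in H-app h (proj₁ (truth φ ρ (d ▹ τ)) (f d))) ,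
    (λ h d → proj₂ (truth φ ρ (d ▹ τ)) (H-⊩ (λ N → s∀E _ (atₛ d N) ⨾ ≡⇒⊩ (instS-at φ ρ τ d N)) h))
  truth (∃ₛ φ) ρ τ =
    (λ h → H-stable (λ k → h (λ (d , p) → k
      (H-⊩ (λ N → ≡⇒⊩ (sym (instS-at φ ρ τ d N)) ⨾ s∃I _ (atₛ d N)) (proj₁ (truth φ ρ (d ▹ τ)) p))))) ,
    (λ h k → let (d , e) = henkinS (¬̇ φ) ρ τ in
      H-consistent (H-app (H-⊩ (λ N → s∃D _ ⊥̇) (H-app e (proj₁ (H-⇒ (inst-coh ρ (d ▹ τ) φ))
        (λ p → ⊥-elim (k (d , proj₂ (truth φ ρ (d ▹ τ)) p)))))) h))

  models : Models T
  models σ t = proj₂ (truth σ ε ε) (H-Der (Der-thm (λ N →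
    subst (Pf T) (trans (renS-cong (λ ()) _) (cong (renS _) (substF-cong (λ ()) σ))) (ax t))))

  ρ₀ : Fin 1 → Elt
  ρ₀ = elt 0 (var zero) ▹ ε

  τ₀ : Fin 2 → SElt
  τ₀ = selt 0 zero ▹ selt 0 (suc zero) ▹ ε

  axioms : ∀ k → Sat (b k) ρ₀ τ₀
  axioms k = proj₂ (truth (b k) ρ₀ τ₀) (H-Der (suc k , λ N h → fstᵖ ⨾ up-⊩ N (conj-elim h) ⨾ ≡⇒⊩ (up≡ N)))
    where
    conj-elim : ∀ {N} → suc k ≤ℕ N → conj b N ⊩ b k
    conj-elim h = go (ℕₚ.≤⇒≤′ h)
      where
      go : ∀ {N} → suc k ≤′ N → conj b N ⊩ b k
      go (≤′-reflexive refl) = sndᵖ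
      go (≤′-step h) = fstᵖ ⨾ go h
    up≡ : ∀ N → up N (b k) ≡ inst (b k) ρ₀ τ₀ N
    up≡ zero = sym (trans (renS-id (λ { zero → refl ; 1F → refl }) _) (substF-id (λ { zero → refl }) (b k)))
    up≡ (suc N) = trans (cong wk (up≡ N)) (sym (inst-coh ρ₀ τ₀ (b k) N z≤n))

record ModelOf (T : Theory) (b : ℕ → Fm 1 2) : Set₁ where
  field
    M : Structure
  open Sem M
  field
    T-holds : Models T
    nums : Fin 1 → Structure.Dom M
    sets : Fin 2 → Structure.Sets M
    b-holds : ∀ k → Sat (b k) nums sets

completeness : (T : Theory) (b : ℕ → Fm 1 2) → (∀ N → ¬ Pf T (conj b N ⇒ ⊥̇)) → ModelOf T b
completeness T b con = record { M = Hen ; T-holds = models ; nums = ρ₀ ; sets = τ₀ ; b-holds = axioms }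
  where open Henkin T b con

-- Arithmetic in models of RCA₀

pattern v0 = var zero
pattern v1 = var (suc zero)
pattern v2 = var (suc (suc zero))
pattern v3 = var (suc (suc (suc zero)))
pattern v4 = var (suc (suc (suc (suc zero))))
pattern v5 = var (suc (suc (suc (suc (suc zero)))))
pattern v6 = var (suc (suc (suc (suc (suc (suc zero))))))
pattern v7 = var (suc (suc (suc (suc (suc (suc (suc zero)))))))
pattern v8 = var (suc (suc (suc (suc (suc (suc (suc (suc zero))))))))

Δ₀⇒Σ₁ : ∀ {n m} {φ : Fm n m} → Δ₀ φ → Σ⁰ 1 φ
Δ₀⇒Σ₁ d = Σ-Π (Π-Δ₀ d)

Δ₀⇒Π₁ : ∀ {n m} {φ : Fm n m} → Δ₀ φ → Π⁰ 1 φ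
Δ₀⇒Π₁ d = Π-Σ (Σ-Δ₀ d)

module Arith (M : Structure) (rca : Sem.Models M RCA₀) where
  open Structure M public
  open Sem M public

  induction : ∀ {n m} {φ : Fm (suc n) m} → Σ⁰ 1 φ → (ρ : Fin n → Dom) (τ : Fin m → Sets) →
              Sat φ (0# ▹ ρ) τ → (∀ x → Sat φ (x ▹ ρ) τ → Sat φ ((x + 1#) ▹ ρ) τ) →
              ∀ x → Sat φ (x ▹ ρ) τ
  induction {φ = φ} s ρ τ base step =
    proj₁ (Sat-close ((φ [ `0 ]ₙ ∧̇ ∀ₙ (φ ⇒ substF (λ i → sucσ i) φ)) ⇒ ∀ₙ φ)) (rca _ (ind φ s)) ρ τ
      (proj₂ (Sat-[] φ `0) base ,
       λ x p → proj₂ (Sat-subst _ φ (λ { zero → ≈-refl ; (suc i) → ≈-refl })) (step x p))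

  suc≉0 : ∀ x → ¬ (x + 1# ≈ 0#)
  suc≉0 = rca _ b1

  suc-inj : ∀ {x y} → x + 1# ≈ y + 1# → x ≈ y
  suc-inj {x} {y} = rca _ b2 x y

  ≮0 : ∀ {x} → ¬ (x < 0#)
  ≮0 {x} = rca _ b3 x

  <-suc : ∀ {x y} → (x < y + 1#) ⟷ (¬ ¬ (x < y ⊎ x ≈ y))
  <-suc {x} {y} = rca _ b4 x y

  +-0 : ∀ x → x + 0# ≈ x
  +-0 = rca _ b5

  +-suc : ∀ x y → x + (y + 1#) ≈ (x + y) + 1#
  +-suc = rca _ b6

  *-0 : ∀ x → x * 0# ≈ 0#
  *-0 = rca _ b7

  *-suc : ∀ x y → x * (y + 1#) ≈ x * y + x
  *-suc = rca _ b8

  infixr 2 _∙_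
  _∙_ : ∀ {x y z} → x ≈ y → y ≈ z → x ≈ z
  _∙_ = ≈-trans

  +-cˡ : ∀ {x y} z → x ≈ y → z + x ≈ z + y
  +-cˡ z p = +-cong ≈-refl p

  +-cʳ : ∀ {x y} z → x ≈ y → x + z ≈ y + z
  +-cʳ z p = +-cong p ≈-refl

  private
    eqInd : (s t : Tm 3) (x y : Dom) → eval s (0# ▹ x ▹ y ▹ ε) ≈ eval t (0# ▹ x ▹ y ▹ ε) →
            (∀ z → eval s (z ▹ x ▹ y ▹ ε) ≈ eval t (z ▹ x ▹ y ▹ ε) →
                   eval s ((z + 1#) ▹ x ▹ y ▹ ε) ≈ eval t ((z + 1#) ▹ x ▹ y ▹ ε)) →
            ∀ z → eval s (z ▹ x ▹ y ▹ ε) ≈ eval t (z ▹ x ▹ y ▹ ε)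
    eqInd s t x y = induction {m = 0} {φ = s ≐ t} (Δ₀⇒Σ₁ d-≐) (x ▹ y ▹ ε) ε

  +-assoc : ∀ x y z → (x + y) + z ≈ x + (y + z)
  +-assoc x y = eqInd ((v1 ⊕ v2) ⊕ v0) (v1 ⊕ (v2 ⊕ v0)) x y
    (+-0 _ ∙ +-cˡ x (≈-sym (+-0 y)))
    (λ z h → +-suc _ z ∙ +-cʳ 1# h ∙ ≈-sym (+-suc _ _) ∙ +-cˡ x (≈-sym (+-suc y z)))

  0-+ : ∀ x → 0# + x ≈ x
  0-+ = eqInd (`0 ⊕ v0) v0 0# 0# (+-0 0#) (λ z h → +-suc _ z ∙ +-cʳ 1# h)

  suc-+ : ∀ x y → (x + 1#) + y ≈ (x + y) + 1#
  suc-+ x = eqInd ((v1 ⊕ `1) ⊕ v0) ((v1 ⊕ v0) ⊕ `1) x x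
    (+-0 _ ∙ +-cʳ 1# (≈-sym (+-0 x)))
    (λ z h → +-suc _ z ∙ +-cʳ 1# (h ∙ ≈-sym (+-suc x z)))

  +-comm : ∀ x y → x + y ≈ y + x
  +-comm x = eqInd (v1 ⊕ v0) (v0 ⊕ v1) x x (+-0 x ∙ ≈-sym (0-+ x))
    (λ z h → +-suc x z ∙ +-cʳ 1# h ∙ ≈-sym (suc-+ z x))

  0-* : ∀ x → 0# * x ≈ 0#
  0-* = eqInd (`0 ⊗ v0) `0 0# 0# (*-0 0#) (λ z h → *-suc _ z ∙ +-0 _ ∙ h)

  suc-* : ∀ x y → (x + 1#) * y ≈ x * y + y
  suc-* x = eqInd ((v1 ⊕ `1) ⊗ v0) ((v1 ⊗ v0) ⊕ v0) x x
    (*-0 _ ∙ ≈-sym (+-0 _ ∙ *-0 x))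
    (λ z h → *-suc _ z ∙ +-cʳ _ h ∙ +-assoc _ z _ ∙ +-cˡ _ (≈-sym (+-assoc z x 1#) ∙ +-cʳ 1# (+-comm z x) ∙
      +-assoc x z 1#)
       ∙ ≈-sym (+-assoc _ x _) ∙ +-cʳ _ (≈-sym (*-suc x z)))

  *-comm : ∀ x y → x * y ≈ y * x
  *-comm x = eqInd (v1 ⊗ v0) (v0 ⊗ v1) x x (*-0 x ∙ ≈-sym (0-* x))
    (λ z h → *-suc x z ∙ +-cʳ x h ∙ ≈-sym (suc-* z x))

  *-distribˡ : ∀ x y z → x * (y + z) ≈ x * y + x * z
  *-distribˡ x y = eqInd (v1 ⊗ (v2 ⊕ v0)) ((v1 ⊗ v2) ⊕ (v1 ⊗ v0)) x y
    (*-cong ≈-refl (+-0 y) ∙ ≈-sym (+-0 _) ∙ +-cˡ _ (≈-sym (*-0 x)))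
    (λ z h → *-cong ≈-refl (+-suc y z) ∙ *-suc x _ ∙ +-cʳ x h ∙ +-assoc _ _ x ∙ +-cˡ _ (≈-sym (*-suc x z)))

  *-distribʳ : ∀ x y z → (y + z) * x ≈ y * x + z * x
  *-distribʳ x y z = *-comm _ x ∙ *-distribˡ x y z ∙ +-cong (*-comm x y) (*-comm x z)

  *-assoc : ∀ x y z → (x * y) * z ≈ x * (y * z)
  *-assoc x y = eqInd ((v1 ⊗ v2) ⊗ v0) (v1 ⊗ (v2 ⊗ v0)) x y
    (*-0 _ ∙ ≈-sym (*-cong ≈-refl (*-0 y) ∙ *-0 x))
    (λ z h → *-suc _ z ∙ +-cʳ _ h ∙ ≈-sym (*-distribˡ x _ y) ∙ *-cong ≈-refl (≈-sym (*-suc y z)))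

  1-* : ∀ x → 1# * x ≈ x
  1-* x = *-cong (≈-sym (0-+ 1#)) ≈-refl ∙ suc-* 0# x ∙ +-cʳ x (0-* x) ∙ 0-+ x

  semiring : CommutativeSemiring 0ℓ 0ℓ
  semiring = record
    { Carrier = Dom ; _≈_ = _≈_ ; _+_ = _+_ ; _*_ = _*_ ; 0# = 0# ; 1# = 1#
    ; isCommutativeSemiring = isCommutativeSemiringˡ (record
      { +-isCommutativeMonoid = record
        { isMonoid = record
          { isSemigroup = record
            { isMagma = record { isEquivalence = equiv ; ∙-cong = +-cong } ; assoc = +-assoc }
          ; identity = 0-+ , +-0 }
        ; comm = +-comm }
      ; *-isCommutativeMonoid = record
        { isMonoid = record
          { isSemigroup = record
            { isMagma = record { isEquivalence = equiv ; ∙-cong = *-cong } ; assoc = *-assoc }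
          ; identity = 1-* , (λ x → *-comm x 1# ∙ 1-* x) }
        ; comm = *-comm }
      ; distribʳ = *-distribʳ
      ; zeroˡ = 0-* }) }
    where
    equiv : IsEquivalence _≈_
    equiv = record { refl = ≈-refl ; sym = ≈-sym ; trans = ≈-trans }

  open NatSolver semiring using (solve; _:=_; _:+_; _:*_; con) public

  use : ∀ {A B : Set} → Stable B → ¬ ¬ A → (A → B) → B
  use st p f = st (λ k → p (λ a → k (f a)))

  ∃-pure : ∀ {A : Set} → A → ¬ ¬ A
  ∃-pure a k = k a

  x<x+1 : ∀ {x} → x < x + 1#
  x<x+1 = proj₂ <-suc (λ k → k (inj₂ ≈-refl))

  <⇒<suc : ∀ {x y} → x < y → x < y + 1#
  <⇒<suc p = proj₂ <-suc (λ k → k (inj₁ p))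

  +⇒< : ∀ {x y} d → x + (d + 1#) ≈ y → x < y
  +⇒< {x} d e = <-cong ≈-refl e (go d)
    where
    go : ∀ d → x < x + (d + 1#)
    go = induction {m = 0} {φ = v1 ≺ (v1 ⊕ (v0 ⊕ `1))} (Δ₀⇒Σ₁ d-≺) (x ▹ ε) ε
      (<-cong ≈-refl (+-cˡ x (≈-sym (0-+ 1#))) x<x+1)
      (λ d h → <-cong ≈-refl (≈-sym (+-suc x (d + 1#))) (<⇒<suc h))

  <⇒+ : ∀ {x y} → x < y → ¬ ¬ (Σ Dom λ d → x + (d + 1#) ≈ y)
  <⇒+ {x} {y} p k = go y (λ (d , f) → k (d , f p))
    where
    go : ∀ y → ¬ ¬ (Σ Dom λ d → x < y → x + (d + 1#) ≈ y)
    -- The existential quantifier stands in front of the implication, which keeps the induction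
    -- formula Σ₁.
    go = induction {m = 0} {φ = ∃ₙ ((v2 ≺ v1) ⇒ (v2 ⊕ (v0 ⊕ `1)) ≐ v1)} (Σ-∃ (Δ₀⇒Σ₁ (d-⇒ d-≺ d-≐))) (x ▹ ε) ε
      (λ k → k (0# , λ q → ⊥-elim (≮0 q)))
      (λ y h k → h (λ (d , f) → em (x < y) (λ k → k (λ x → x))
        (λ q → k (d + 1# , λ _ → ≈-trans (+-suc x (d + 1#)) (+-cʳ 1# (f q))))
        (λ nq → k (0# , λ r → use ≈-stable (proj₁ <-suc r)
          (λ { (inj₁ q) → ⊥-elim (nq q) ; (inj₂ q) → +-cong q (0-+ 1#) })))))

  +-cancelʳ : ∀ {x y} z → x + z ≈ y + z → x ≈ y
  +-cancelʳ {x} {y} = induction {m = 0} {φ = (v1 ⊕ v0) ≐ (v2 ⊕ v0) ⇒ v1 ≐ v2} (Δ₀⇒Σ₁ (d-⇒ d-≐ d-≐)) (x ▹ y ▹ ε) ε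
    (λ p → ≈-sym (+-0 x) ∙ p ∙ +-0 y)
    (λ z h p → h (suc-inj (≈-sym (+-suc x z) ∙ p ∙ +-suc y z)))

  +-cancelˡ : ∀ {x y} z → z + x ≈ z + y → x ≈ y
  +-cancelˡ {x} {y} z p = +-cancelʳ z (+-comm x z ∙ p ∙ +-comm z y)

  <-irrefl : ∀ {x} → ¬ (x < x)
  <-irrefl {x} p = <⇒+ p (λ (d , e) → suc≉0 d (+-cancelˡ x (e ∙ ≈-sym (+-0 x))))

  infix 4 _≤_
  _≤_ : Dom → Dom → Set
  x ≤ y = x < y + 1#

  +⇒≤ : ∀ {x y} d → x + d ≈ y → x ≤ y
  +⇒≤ {x} {y} d e = +⇒< d (≈-sym (+-assoc x d 1#) ∙ +-cʳ 1# e)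

  ≤⇒+ : ∀ {x y} → x ≤ y → ¬ ¬ (Σ Dom λ d → x + d ≈ y)
  ≤⇒+ {x} p k = <⇒+ p (λ (d , e) → k (d , suc-inj (+-assoc x d 1# ∙ e)))

  ≤-refl : ∀ {x} → x ≤ x
  ≤-refl = x<x+1

  ≈⇒≤ : ∀ {x y} → x ≈ y → x ≤ y
  ≈⇒≤ e = <-cong ≈-refl (+-cʳ 1# e) x<x+1

  <-trans : ∀ {x y z} → x < y → y < z → x < z
  <-trans {x} p q = use <-stable (<⇒+ p) (λ (d , e) → use <-stable (<⇒+ q) (λ (d' , e') →
    +⇒< (d + 1# + d') (solve 3 (λ x d d' → x :+ (d :+ con 1 :+ d' :+ con 1) := (x :+ (d :+ con 1)) :+ (d' :+ con 1))
      ≈-refl x d d'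
       ∙ +-cʳ _ e ∙ e')))

  ≤-<-trans : ∀ {x y z} → x ≤ y → y < z → x < z
  ≤-<-trans p q = use <-stable (proj₁ <-suc p) (λ { (inj₁ r) → <-trans r q ; (inj₂ r) → <-cong (≈-sym r) ≈-refl q })

  <⇒suc≤ : ∀ {x y} → x < y → x + 1# ≤ y
  <⇒suc≤ {x} p = use <-stable (<⇒+ p) (λ (d , e) → +⇒≤ d
    (solve 2 (λ x d → (x :+ con 1) :+ d := x :+ (d :+ con 1)) ≈-refl x d ∙ e))

  <-≤-trans : ∀ {x y z} → x < y → y ≤ z → x < z
  <-≤-trans p q = use <-stable (proj₁ <-suc q) (λ { (inj₁ r) → <-trans p r ; (inj₂ r) → <-cong ≈-refl r p })

  ≤-trans : ∀ {x y z} → x ≤ y → y ≤ z → x ≤ z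
  ≤-trans p q = ≤-<-trans p q

  <⇒≤ : ∀ {x y} → x < y → x ≤ y
  <⇒≤ = <⇒<suc

  0≤ : ∀ {x} → 0# ≤ x
  0≤ {x} = +⇒≤ x (0-+ x)

  ≤-+ʳ : ∀ x y → x ≤ x + y
  ≤-+ʳ x y = +⇒≤ y ≈-refl

  ≤-+ˡ : ∀ x y → y ≤ x + y
  ≤-+ˡ x y = +⇒≤ x (+-comm y x)

  zero-or-suc : ∀ x → ¬ ¬ (x ≈ 0# ⊎ Σ Dom λ y → x ≈ y + 1#)
  zero-or-suc x k = go x (λ (y , h) → h (λ { (inj₁ p) → k (inj₁ p) ; (inj₂ p) → k (inj₂ (y , p)) }))
    where
    go : ∀ x → ¬ ¬ (Σ Dom λ y → ¬ ¬ (x ≈ 0# ⊎ x ≈ y + 1#))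
    go = induction {m = 0} {φ = ∃ₙ (v1 ≐ `0 ∨̇ v1 ≐ v0 ⊕ `1)} (Σ-∃ (Δ₀⇒Σ₁ (d-∨ d-≐ d-≐))) ε ε
      (λ k → k (0# , λ k → k (inj₁ ≈-refl)))
      (λ x _ k → k (x , λ k → k (inj₂ ≈-refl)))

  compare : ∀ x y → ¬ ¬ (x < y ⊎ x ≈ y ⊎ y < x)
  compare x y k = go y (λ { (inj₁ p) → k (inj₁ p) ; (inj₂ q) → q (λ r → k (inj₂ r)) })
    where
    go : ∀ y → ¬ ¬ (x < y ⊎ ¬ ¬ (x ≈ y ⊎ y < x))
    go = induction {m = 0} {φ = v1 ≺ v0 ∨̇ (v1 ≐ v0 ∨̇ v0 ≺ v1)} (Δ₀⇒Σ₁ (d-∨ d-≺ (d-∨ d-≐ d-≺))) (x ▹ ε) ε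
      (λ k → zero-or-suc x (λ { (inj₁ p) → k (inj₂ λ k → k (inj₁ p))
                              ; (inj₂ (x' , p)) → k (inj₂ λ k → k (inj₂ (<-cong ≈-refl (≈-sym p) 0≤))) }))
      (λ y h k → h (λ
        { (inj₁ p) → k (inj₁ (<⇒<suc p))
        ; (inj₂ q) → q (λ
          { (inj₁ p) → k (inj₁ (≈⇒≤ p))
          ; (inj₂ p) → proj₁ <-suc (<⇒suc≤ p) (λ
             { (inj₁ r) → k (inj₂ λ k → k (inj₂ r))
             ; (inj₂ r) → k (inj₂ λ k → k (inj₁ (≈-sym r))) }) }) }))

  ≮⇒≥ : ∀ {x y} → ¬ (x < y) → y ≤ x
  ≮⇒≥ {x} {y} n = use <-stable (compare x y) (λ
    { (inj₁ p) → ⊥-elim (n p) ; (inj₂ (inj₁ p)) → ≈⇒≤ (≈-sym p) ; (inj₂ (inj₂ p)) → <⇒≤ p })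

  +-mono-≤ : ∀ {x y u v} → x ≤ y → u ≤ v → x + u ≤ y + v
  +-mono-≤ {x} {y} {u} {v} p q = use <-stable (≤⇒+ p) (λ (d , e) → use <-stable (≤⇒+ q) (λ (d' , e') →
    +⇒≤ (d + d') (solve 4 (λ x u d d' → (x :+ u) :+ (d :+ d') := (x :+ d) :+ (u :+ d')) ≈-refl x u d d' ∙
      +-cong e e')))

  *-mono-≤ : ∀ {x y u v} → x ≤ y → u ≤ v → x * u ≤ y * v
  *-mono-≤ {x} {y} {u} {v} p q = use <-stable (≤⇒+ p) (λ (d , e) → use <-stable (≤⇒+ q) (λ (d' , e') →
    +⇒≤ (d * u + x * d' + d * d') (solve 4 (λ x u d d' → (x :* u) :+ (d :* u :+ x :* d' :+ d :* d') := (x :+ d) :*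
      (u :+ d')) ≈-refl x u d d' ∙ *-cong e e')))

  eval-mono : ∀ {n} (t : Tm n) {ρ ρ'} → (∀ i → ρ i ≤ ρ' i) → eval t ρ ≤ eval t ρ'
  eval-mono (var i) h = h i
  eval-mono `0 h = ≤-refl
  eval-mono `1 h = ≤-refl
  eval-mono (s ⊕ t) h = +-mono-≤ (eval-mono s h) (eval-mono t h)
  eval-mono (s ⊗ t) h = *-mono-≤ (eval-mono s h) (eval-mono t h)

  -- Injective because (x + y)² ≤ code < (x + y + 1)² determines x + y. Surjectivity is given up in
  -- exchange for a term without division; both components are bounded by the code, so unpairing is
  -- Δ₀.
  ⟪_,_⟫ : Dom → Dom → Dom
  ⟪ x , y ⟫ = (x + y) * (x + y) + x

  pair-cong : ∀ {x x' y y'} → x ≈ x' → y ≈ y' → ⟪ x , y ⟫ ≈ ⟪ x' , y' ⟫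
  pair-cong p q = +-cong (*-cong (+-cong p q) (+-cong p q)) p

  private
    pair-< : ∀ {x y x' y'} → x + y < x' + y' → ⟪ x , y ⟫ < ⟪ x' , y' ⟫
    pair-< {x} {y} {x'} {y'} p = use <-stable (<⇒+ p) (λ (d , e) →
      <-≤-trans (+⇒< ((x + y) * d + (x + y) * d + x + y + y + d * d + d + d)
         (solve 3 (λ x y d →  ((x :+ y) :* (x :+ y) :+ x) :+ (((x :+ y) :* d :+ (x :+ y) :* d :+ x :+ y :+ y :+ d :* d
           :+ d :+ d) :+ con 1)
            := (x :+ y :+ (d :+ con 1)) :* (x :+ y :+ (d :+ con 1))) ≈-refl x y d ∙ *-cong e e)) (≤-+ʳ _ x'))

    x≤x*x : ∀ x → x ≤ x * x
    x≤x*x x = use <-stable (zero-or-suc x) (λ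
      { (inj₁ p) → ≤-trans (≈⇒≤ p) 0≤
      ; (inj₂ (y , p)) → ≤-trans (≈⇒≤ p) (≤-trans (+⇒≤ (y * y + y)
          (solve 1 (λ y → (y :+ con 1) :+ (y :* y :+ y) := (y :+ con 1) :* (y :+ con 1)) ≈-refl y))
            (≈⇒≤ (*-cong (≈-sym p) (≈-sym p)))) })

  pair-inj : ∀ {x y x' y'} → ⟪ x , y ⟫ ≈ ⟪ x' , y' ⟫ → x ≈ x' × y ≈ y'
  pair-inj {x} {y} {x'} {y'} e = x≈ , +-cancelˡ x (sum≈ ∙ +-cʳ y' (≈-sym x≈))
    where
    sum≈ : x + y ≈ x' + y'
    sum≈ = use ≈-stable (compare (x + y) (x' + y')) (λ
      { (inj₁ p) → ⊥-elim (<-irrefl (<-cong e ≈-refl (pair-< p)))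
      ; (inj₂ (inj₁ p)) → p
      ; (inj₂ (inj₂ p)) → ⊥-elim (<-irrefl (<-cong ≈-refl e (pair-< p))) })
    x≈ : x ≈ x'
    x≈ = +-cancelˡ ((x + y) * (x + y)) (e ∙ +-cʳ x' (*-cong (≈-sym sum≈) (≈-sym sum≈)))

  ≤-pair₁ : ∀ x y → x ≤ ⟪ x , y ⟫
  ≤-pair₁ x y = ≤-+ˡ _ x

  ≤-pair₂ : ∀ x y → y ≤ ⟪ x , y ⟫
  ≤-pair₂ x y = ≤-trans (≤-+ˡ x y) (≤-trans (x≤x*x _) (≤-+ʳ _ x))

  num : ℕ → Dom
  num zero = 0#
  num (suc k) = num k + 1#

  num-inj : ∀ j k → num j ≈ num k → j ≡ k
  num-inj zero zero p = refl
  num-inj zero (suc k) p = ⊥-elim (suc≉0 _ (≈-sym p))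
  num-inj (suc j) zero p = ⊥-elim (suc≉0 _ p)
  num-inj (suc j) (suc k) p with num-inj j k (suc-inj p)
  ... | refl = refl

  <num : ∀ k {x} → x < num k → ¬ ¬ (Σ (Fin k) λ j → x ≈ num (toℕ j))
  <num zero p _ = ≮0 p
  <num (suc k) p h = proj₁ <-suc p (λ
    { (inj₁ q) → <num k q (λ (j , e) → h (inject₁ j , (e ∙ ≡⇒≈ (cong num (sym (toℕ-inject₁ j))))))
    ; (inj₂ q) → h (fromℕ k , (q ∙ ≡⇒≈ (cong num (sym (toℕ-fromℕ k))))) })

  num-< : ∀ {k} (j : Fin k) → num (toℕ j) < num k
  num-< {suc k} zero = 0≤
  num-< {suc k} (suc j) = use <-stable (<⇒+ (num-< j)) (λ (d , e) →
    +⇒< d (solve 2 (λ x d → (x :+ con 1) :+ (d :+ con 1) := (x :+ (d :+ con 1)) :+ con 1) ≈-refl (num (toℕ j)) d ∙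
      +-cʳ 1# e))

-- Coding finite sets

pairT : ∀ {n} → Tm n → Tm n → Tm n
pairT s t = ((s ⊕ t) ⊗ (s ⊕ t)) ⊕ s

numT : ∀ {n} → ℕ → Tm n
numT zero = `0
numT (suc k) = numT k ⊕ `1

Δ₀-subst : ∀ {n k m} (σ : Fin n → Tm k) {φ : Fm n m} → Δ₀ φ → Δ₀ (substF σ φ)
Δ₀-subst σ d-≐ = d-≐
Δ₀-subst σ d-≺ = d-≺
Δ₀-subst σ d-∈ = d-∈
Δ₀-subst σ d-⊥ = d-⊥
Δ₀-subst σ (d-⇒ p q) = d-⇒ (Δ₀-subst σ p) (Δ₀-subst σ q)
Δ₀-subst σ (d-∧ p q) = d-∧ (Δ₀-subst σ p) (Δ₀-subst σ q)
Δ₀-subst σ (d-∨ p q) = d-∨ (Δ₀-subst σ p) (Δ₀-subst σ q)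
Δ₀-subst σ (d-b∀ t {φ} p) =
  subst (λ u → Δ₀ (∀ₙ ((var zero ≺ u) ⇒ substF (liftσ σ) φ))) (sym (substT-wkT σ t)) (d-b∀ (substT σ t)
    (Δ₀-subst (liftσ σ) p))
Δ₀-subst σ (d-b∃ t {φ} p) =
  subst (λ u → Δ₀ (∃ₙ ((var zero ≺ u) ∧̇ substF (liftσ σ) φ))) (sym (substT-wkT σ t)) (d-b∃ (substT σ t)
    (Δ₀-subst (liftσ σ) p))

Δ₀-ren : ∀ {n m k} (κ : Fin m → Fin k) {φ : Fm n m} → Δ₀ φ → Δ₀ (renS κ φ)
Δ₀-ren κ d-≐ = d-≐
Δ₀-ren κ d-≺ = d-≺
Δ₀-ren κ d-∈ = d-∈
Δ₀-ren κ d-⊥ = d-⊥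
Δ₀-ren κ (d-⇒ p q) = d-⇒ (Δ₀-ren κ p) (Δ₀-ren κ q)
Δ₀-ren κ (d-∧ p q) = d-∧ (Δ₀-ren κ p) (Δ₀-ren κ q)
Δ₀-ren κ (d-∨ p q) = d-∨ (Δ₀-ren κ p) (Δ₀-ren κ q)
Δ₀-ren κ (d-b∀ t p) = d-b∀ t (Δ₀-ren κ p)
Δ₀-ren κ (d-b∃ t p) = d-b∃ t (Δ₀-ren κ p)

-- v0 = ⟪ u , v ⟫ codes the set of all v1 such that (v1 + 1) * v + 1 divides u.
memF : ∀ {m} → Fm 2 m
memF = ∃ₙ (v0 ≺ v1 ⊕ `1 ∧̇ ∃ₙ (v0 ≺ v2 ⊕ `1 ∧̇ ∃ₙ (v0 ≺ v2 ⊕ `1 ∧̇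
         (v3 ≐ pairT v2 v1 ∧̇ v2 ≐ v0 ⊗ (((v4 ⊕ `1) ⊗ v1) ⊕ `1)))))

memF-Δ₀ : ∀ {m} → Δ₀ (memF {m})
memF-Δ₀ = d-b∃ (v0 ⊕ `1) (d-b∃ (v1 ⊕ `1) (d-b∃ (v1 ⊕ `1) (d-∧ d-≐ d-≐)))

-- Set quantifiers get junk values: the function is only used on Δ₀ formulas.
elimF : ∀ {n m} → Tm n → Fm n (suc m) → Fm n m
elimF c (s ≐ t) = s ≐ t
elimF c (s ≺ t) = s ≺ t
elimF c (t ∈̇ zero) = substF (c ▹ t ▹ ε) memF
elimF c (t ∈̇ suc X) = t ∈̇ X
elimF c ⊥̇ = ⊥̇
elimF c (φ ⇒ ψ) = elimF c φ ⇒ elimF c ψ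
elimF c (φ ∧̇ ψ) = elimF c φ ∧̇ elimF c ψ
elimF c (φ ∨̇ ψ) = elimF c φ ∨̇ elimF c ψ
elimF c (∀ₙ φ) = ∀ₙ (elimF (wkT c) φ)
elimF c (∃ₙ φ) = ∃ₙ (elimF (wkT c) φ)
elimF c (∀ₛ φ) = ⊥̇
elimF c (∃ₛ φ) = ⊥̇

elimF-Δ₀ : ∀ {n m} {c : Tm n} {φ : Fm n (suc m)} → Δ₀ φ → Δ₀ (elimF c φ)
elimF-Δ₀ d-≐ = d-≐
elimF-Δ₀ d-≺ = d-≺
elimF-Δ₀ {c = c} (d-∈ {t = t} {X = zero}) = Δ₀-subst (c ▹ t ▹ ε) memF-Δ₀
elimF-Δ₀ (d-∈ {X = suc X}) = d-∈
elimF-Δ₀ d-⊥ = d-⊥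
elimF-Δ₀ (d-⇒ p q) = d-⇒ (elimF-Δ₀ p) (elimF-Δ₀ q)
elimF-Δ₀ (d-∧ p q) = d-∧ (elimF-Δ₀ p) (elimF-Δ₀ q)
elimF-Δ₀ (d-∨ p q) = d-∨ (elimF-Δ₀ p) (elimF-Δ₀ q)
elimF-Δ₀ (d-b∀ t p) = d-b∀ t (elimF-Δ₀ p)
elimF-Δ₀ (d-b∃ t p) = d-b∃ t (elimF-Δ₀ p)

-- A bound for the numbers whose membership in a set matters to the truth of a Δ₀ formula.
bnd : ∀ {n m} {φ : Fm n m} → Δ₀ φ → Tm n
bnd d-≐ = `0
bnd d-≺ = `0
bnd (d-∈ {t = t}) = t ⊕ `1
bnd d-⊥ = `0
bnd (d-⇒ p q) = bnd p ⊕ bnd q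
bnd (d-∧ p q) = bnd p ⊕ bnd q
bnd (d-∨ p q) = bnd p ⊕ bnd q
bnd (d-b∀ t p) = substT (single t) (bnd p)
bnd (d-b∃ t p) = substT (single t) (bnd p)

module Coding (M : Structure) (rca : Sem.Models M RCA₀) where
  open Arith M rca public

  Dvd : Dom → Dom → Set
  Dvd a b = ¬ ¬ (Σ Dom λ q → b ≈ q * a)

  Dvd-cong : ∀ {a b b'} → b ≈ b' → Dvd a b → Dvd a b'
  Dvd-cong e = ¬¬-map (λ (q , p) → q , (≈-sym e ∙ p))

  sum≈0 : ∀ {x y} → x + y ≈ 0# → y ≈ 0#
  sum≈0 {x} {y} e = use ≈-stable (zero-or-suc y) (λ
    { (inj₁ p) → p
    ; (inj₂ (z , p)) → ⊥-elim (suc≉0 (x + z) (≈-sym (+-suc x z) ∙ +-cˡ x (≈-sym p) ∙ e)) })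

  Dvd-+ : ∀ {a x y} → Dvd a (x + y) → Dvd a x → Dvd a y
  Dvd-+ {a} {x} {y} p p' k = p (λ (q , e) → p' (λ (q' , e') → compare q' q (λ
    { (inj₁ l) → <⇒+ l (λ (d , h) → k (d + 1# , +-cancelˡ x
        (e ∙ *-cong (≈-sym h) ≈-refl ∙ *-distribʳ a q' (d + 1#) ∙ +-cʳ _ (≈-sym e'))))
    ; (inj₂ (inj₁ h)) → k (0# , (+-cancelˡ x (e ∙ *-cong (≈-sym h) ≈-refl ∙ ≈-sym e' ∙ ≈-sym (+-0 x)) ∙
      ≈-sym (0-* a)))
    ; (inj₂ (inj₂ l)) → <⇒+ l (λ (d , h) → k (0# , (sum≈0 {(d + 1#) * a} (+-cancelˡ (q * a)
        (≈-sym (+-assoc (q * a) ((d + 1#) * a) y) ∙ +-cʳ y (≈-sym (*-distribʳ a q (d + 1#)) ∙ *-cong h ≈-refl ∙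
          ≈-sym e') ∙ e ∙ ≈-sym (+-0 _))) ∙ ≈-sym (0-* a)))) })))

  -- The moduli of Gödel's β function.
  A : Dom → Dom → Dom
  A v i = (i + 1#) * v + 1#

  -- Because `(i + 1#) * (y * v) + y ≈ y * A v i`, a divisor of `y * v` that equals `A v i` divides
  -- the remaining summand `y`.
  coprime-v : ∀ {v i y} → Dvd (A v i) (y * v) → Dvd (A v i) y
  coprime-v {v} {i} {y} p = Dvd-+ {x = (i + 1#) * (y * v)}
    (λ k → k (y , solve 3 (λ v i y → (i :+ con 1) :* (y :* v) :+ y := y :* ((i :+ con 1) :* v :+ con 1)) ≈-refl v i
      y))
    (¬¬-map (λ (q , e) → (i + 1#) * q , (*-cong ≈-refl e ∙ ≈-sym (*-assoc _ q _))) p)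

  -- A v i divides u * A v j - u * A v i = ± u * (i - j) * v and is prime to v, of which i - j is a divisor.
  coprime : ∀ {v m i j u} → (∀ d → d < m → Dvd (d + 1#) v) → i < m → j < m → ¬ (i ≈ j) →
            Dvd (A v i) (u * A v j) → Dvd (A v i) u
  coprime {v} {m} {i} {j} {u} dv i<m j<m i≉j p k = compare i j (λ
    { (inj₁ l) → <⇒+ l (λ (d , h) → finish d (≤-<-trans (≤-+ˡ i d)
      (<-trans (<-≤-trans x<x+1 (≈⇒≤ (+-assoc i d 1# ∙ h))) j<m))
        (Dvd-+ {x = u * A v i} (Dvd-cong (*-cong ≈-refl (+-cʳ 1# (*-cong (+-cʳ 1# (≈-sym h)) ≈-refl)) ∙
           solve 4 (λ u v i d → u :* ((i :+ (d :+ con 1) :+ con 1) :* v :+ con 1) := u :* ((i :+ con 1) :* v :+ con 1)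
             :+ (u :* (d :+ con 1)) :* v) ≈-refl u v i d) p)
          (∃-pure (u , ≈-refl))) k)
    ; (inj₂ (inj₁ h)) → i≉j h
    ; (inj₂ (inj₂ l)) → <⇒+ l (λ (d , h) → finish d (≤-<-trans (≤-+ˡ j d)
      (<-trans (<-≤-trans x<x+1 (≈⇒≤ (+-assoc j d 1# ∙ h))) i<m))
        (Dvd-+ {x = u * A v j} (λ k → k (u , (solve 4 (λ u v j d → u :* ((j :+ con 1) :* v :+ con 1) :+
          (u :* (d :+ con 1)) :* v := u :* ((j :+ (d :+ con 1) :+ con 1) :* v :+ con 1)) ≈-refl u v j d
             ∙ *-cong ≈-refl (+-cʳ 1# (*-cong (+-cʳ 1# h) ≈-refl))))) p) k) })
    where
    finish : ∀ d → d < m → Dvd (A v i) ((u * (d + 1#)) * v) → Dvd (A v i) u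
    finish d l p = coprime-v (λ k → coprime-v p (λ (q , e) → dv d l (λ (w , f) →
      k (w * q , (*-cong ≈-refl f ∙ solve 3 (λ u w d → u :* (w :* d) := w :* (u :* d)) ≈-refl u w (d + 1#) ∙
        *-cong ≈-refl e ∙ ≈-sym (*-assoc w q _))))))

  ≤-*suc : ∀ x y → x ≤ x * (y + 1#)
  ≤-*suc x y = ≤-trans (≤-+ˡ (x * y) x) (≈⇒≤ (≈-sym (*-suc x y)))

  -- The factorial of m is such a number; Σ₁ induction multiplies by `m + 1#` at each step without
  -- having to define it. Cofactors are bounded by `v` to keep the matrix Δ₀. That `v` is nonzero
  -- makes the moduli greater than 1.
  multiple : ∀ m → ¬ ¬ (Σ Dom λ v → ¬ (v ≈ 0#) × (∀ d → d < m → Dvd (d + 1#) v))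
  multiple m = ¬¬-map (λ (v , n , f) → v , n , λ d l → ¬¬-map (λ (q , _ , e) → q , e) (f d l)) (go m)
    where
    go : ∀ m → ¬ ¬ (Σ Dom λ v → ¬ (v ≈ 0#) × (∀ d → d < m → ¬ ¬ (Σ Dom λ q → q ≤ v × v ≈ q * (d + 1#))))
    go = induction {m = 0} {φ = ∃ₙ (¬̇ (v0 ≐ `0) ∧̇ ∀ₙ (v0 ≺ v2 ⇒ ∃ₙ (v0 ≺ v2 ⊕ `1 ∧̇ v2 ≐ v0 ⊗ (v1 ⊕ `1))))}
      (Σ-∃ (Δ₀⇒Σ₁ (d-∧ (d-⇒ d-≐ d-⊥) (d-b∀ v1 (d-b∃ (v1 ⊕ `1) d-≐))))) ε ε
      (λ k → k (1# , (λ e → suc≉0 0# (0-+ 1# ∙ e)) , λ d l → ⊥-elim (≮0 l)))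
      (λ m h k → h (λ (v , n , f) → k (v * (m + 1#) , (λ e → n (sum≈0 (≈-sym (*-suc v m) ∙ e))) , λ d l k →
        proj₁ <-suc l (λ
          { (inj₁ l') → f d l' (λ (q , _ , e) → k (q * (m + 1#) , fact q m d (*-cong e ≈-refl ∙ solve 3 (λ q m d →
            (q :* d) :* m := (q :* m) :* d) ≈-refl q (m + 1#) (d + 1#))))
          ; (inj₂ e) → k (v , fact' v m d (*-cong ≈-refl (+-cʳ 1# (≈-sym e)))) }))))
      where
      fact' : ∀ q m d → q * (m + 1#) ≈ q * (d + 1#) → q ≤ q * (m + 1#) × q * (m + 1#) ≈ q * (d + 1#)
      fact' q m d e = ≤-*suc q m , e
      fact : ∀ {v} q m d → v * (m + 1#) ≈ (q * (m + 1#)) * (d + 1#) → q * (m + 1#) ≤ v * (m + 1#) × v * (m + 1#) ≈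
        (q * (m + 1#)) * (d + 1#)
      fact q m d e = ≤-trans (≤-*suc _ d) (≈⇒≤ (≈-sym e)) , e

  CodeMem : Dom → Dom → Set
  CodeMem c i = ¬ ¬ (Σ Dom λ u → Σ Dom λ v → Σ Dom λ d → c ≈ ⟪ u , v ⟫ × u ≈ d * A v i)

  Sat-memF : ∀ {m} c i {τ : Fin m → Sets} → Sat memF (c ▹ i ▹ ε) τ ⟷ CodeMem c i
  Sat-memF c i = (λ h k → h (λ (u , _ , h) → h (λ (v , _ , h) → h (λ (d , _ , e , f) → k (u , v , d , e , f))))) ,
    (λ h k → h (λ (u , v , d , e , f) → k (u , ≤-trans (≤-pair₁ u v) (≈⇒≤ (≈-sym e)) , λ k →
      k (v , ≤-trans (≤-pair₂ u v) (≈⇒≤ (≈-sym e)) ,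
      λ k → k (d , ≤-trans (≤-*suc d ((i + 1#) * v)) (≈⇒≤ (≈-sym f)) , e , f)))))

  CodeMem-cong : ∀ {c c' i i'} → c ≈ c' → i ≈ i' → CodeMem c i → CodeMem c' i'
  CodeMem-cong p q = ¬¬-map (λ (u , v , d , e , f) → u , v , d , (≈-sym p ∙ e) ,
    (f ∙ *-cong ≈-refl (+-cʳ 1# (*-cong (+-cʳ 1# q) ≈-refl))))

  Codes : Dom → Sets → Dom → Set
  Codes c Y m = ∀ i → i < m → (i ∈ Y) ⟷ CodeMem c i

  -- The code consists of the product of the moduli `A v i` over the elements i of `Y` below `m`,
  -- paired with `v`. The inner induction builds the product factor by factor; coprimality shows
  -- that no modulus divides it unless it was put in.
  code-exists : ∀ Y m → ¬ ¬ (Σ Dom λ c → Codes c Y m)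
  code-exists Y m k = multiple m (λ (v , v≉0 , dv) → go v v≉0 dv m (λ (u , f) → k (⟪ u , v ⟫ , λ i l →
       (λ y → ¬¬-map (λ (d , _ , e) → u , v , d , ≈-refl , e) (proj₁ (f i l) (l , y))) ,
       (λ c → ∈-stable (λ k → c (λ (u' , v' , d , e , g) → let (p , q) = pair-inj e in
           k (proj₂ (proj₂ (f i l) (bounded i (p ∙ g ∙ *-cong ≈-refl (+-cʳ 1# (*-cong ≈-refl (≈-sym q)))))))))))))
    where
    bounded : ∀ {u v d} i → u ≈ d * A v i → ¬ ¬ (Σ Dom λ d → d ≤ u × u ≈ d * A v i)
    bounded {v = v} {d} i e k = k (d , ≤-trans (≤-*suc d ((i + 1#) * v)) (≈⇒≤ (≈-sym e)) , e)
    go : ∀ v → ¬ (v ≈ 0#) → (∀ d → d < m → Dvd (d + 1#) v) → ∀ j →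
         ¬ ¬ (Σ Dom λ u → ∀ i → i < m → (i < j × i ∈ Y) ⟷ (¬ ¬ (Σ Dom λ d → d ≤ u × u ≈ d * A v i)))
    go v v≉0 dv = induction
      {φ = ∃ₙ (∀ₙ (v0 ≺ v3 ⇒ ((v0 ≺ v2 ∧̇ v0 ∈̇ zero) ⇔ ∃ₙ (v0 ≺ v2 ⊕ `1 ∧̇ v2 ≐ v0 ⊗ (((v1 ⊕ `1) ⊗ v5) ⊕ `1)))))}
      (Σ-∃ (Δ₀⇒Σ₁ (d-b∀ v2 (let p = d-∧ d-≺ d-∈ ; q = d-b∃ (v1 ⊕ `1) d-≐ in d-∧ (d-⇒ p q) (d-⇒ q p)))))
      (m ▹ v ▹ ε) (Y ▹ ε)
      (λ k → k (1# , λ i l → (λ (l' , _) → ⊥-elim (≮0 l')) , λ h → ⊥-elim (h (λ (d , _ , e) → base d i e))))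
      (λ j h k → h (λ (u , f) →
        -- The product receives the factor `A v j` exactly in the first case.
        em (j < m × j ∈ Y) (λ k → k (λ x → x))
          (λ (j<m , jY) → k (u * A v j , λ i l →
            (λ (l' , y) k → proj₁ <-suc l' (λ
              { (inj₁ l'') → proj₁ (f i l) (l'' , y) (λ (d , _ , e) →
                  bounded i (*-cong e ≈-refl ∙ solve 3 (λ d x y → (d :* x) :* y := (d :* y) :* x) ≈-refl d (A v i)
                    (A v j)) k)
              ; (inj₂ e) → bounded i (*-cong ≈-refl (+-cʳ 1# (*-cong (+-cʳ 1# (≈-sym e)) ≈-refl))) k })) ,
            (λ h → em (i ≈ j) (Sat-stable {m = 1} ((v0 ≺ v1) ∧̇ (v0 ∈̇ zero)) {i ▹ (j + 1#) ▹ ε} {Y ▹ ε})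
               (λ e → ≈⇒≤ e , ∈-cong (≈-sym e) jY)
               (λ ne → let (r , s) = proj₂ (f i l) (λ k → coprime dv l j<m ne (¬¬-map (λ (d , _ , e) → d , e) h) (λ (d , e) → bounded i e k))
                       in <⇒<suc r , s))))
          (λ nj → k (u , λ i l →
            (λ (l' , y) k → proj₁ <-suc l' (λ
              { (inj₁ l'') → proj₁ (f i l) (l'' , y) k
              ; (inj₂ e) → nj (<-cong e ≈-refl l , ∈-cong e y) })) ,
            (λ h → let (r , s) = proj₂ (f i l) h in <⇒<suc r , s)))))
      where
      -- The empty product 1 has no modulus among its divisors, because `v` is nonzero.
      base : ∀ d i → ¬ (1# ≈ d * A v i)
      base d i e = zero-or-suc v (λ { (inj₁ p) → v≉0 p ; (inj₂ (w , p)) → zero-or-suc d (λ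
        { (inj₁ q) → suc≉0 0# (0-+ 1# ∙ e ∙ *-cong q ≈-refl ∙ 0-* _)
        ; (inj₂ (d' , q)) → suc≉0 (d' * ((i + 1#) * (w + 1#) + 1#) + (i * w + i + w)) (suc-inj
            (solve 3 (λ i w d' → ((d' :* ((i :+ con 1) :* (w :+ con 1) :+ con 1) :+ (i :* w :+ i :+ w)) :+ con 1) :+
              con 1
                := (d' :+ con 1) :* ((i :+ con 1) :* (w :+ con 1) :+ con 1)) ≈-refl i w d'
              ∙ *-cong (≈-sym q) (+-cʳ 1# (*-cong ≈-refl (≈-sym p))) ∙ ≈-sym e ∙ ≈-sym (0-+ 1#))) }) })


  elimF-correct : ∀ {n m} {φ : Fm n (suc m)} (p : Δ₀ φ) (c : Tm n) {ρ τ Y b} →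
                  Codes (eval c ρ) Y b → eval (bnd p) ρ ≤ b → Sat φ ρ (Y ▹ τ) ⟷ Sat (elimF c φ) ρ τ
  -- Terms are monotone, so the bound of the body at an `x` below `t` is at most its value with `t`
  -- put for the bound variable, which is how `bnd` passes a bounded quantifier.
  elimF-under : ∀ {n m} (t : Tm n) {φ : Fm (suc n) (suc m)} (p : Δ₀ φ) (c : Tm n) {ρ τ Y b} →
                Codes (eval c ρ) Y b → eval (substT (single t) (bnd p)) ρ ≤ b →
                ∀ x → x < eval (wkT t) (x ▹ ρ) → Sat φ (x ▹ ρ) (Y ▹ τ) ⟷ Sat (elimF (wkT c) φ) (x ▹ ρ) τ
  elimF-correct d-≐ c h l = ⟷-refl
  elimF-correct d-≺ c h l = ⟷-refl
  elimF-correct (d-∈ {t = t} {zero}) c {ρ} {τ} h l =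
    ⟷-trans (h (eval t ρ) (<-≤-trans x<x+1 l)) (⟷-trans (⟷-sym (Sat-memF (eval c ρ) (eval t ρ) {τ}))
      (⟷-sym (Sat-subst (c ▹ t ▹ ε) memF {ρ} {eval c ρ ▹ eval t ρ ▹ ε} {τ} (λ { zero → ≈-refl ; 1F → ≈-refl }))))
  elimF-correct (d-∈ {X = suc X}) c h l = ⟷-refl
  elimF-correct d-⊥ c h l = ⟷-refl
  elimF-correct (d-⇒ p q) c h l =
    →-⟷ (elimF-correct p c h (≤-trans (≤-+ʳ _ _) l)) (elimF-correct q c h (≤-trans (≤-+ˡ _ _) l))
  elimF-correct (d-∧ p q) c h l =
    ×-⟷ (elimF-correct p c h (≤-trans (≤-+ʳ _ _) l)) (elimF-correct q c h (≤-trans (≤-+ˡ _ _) l))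
  elimF-correct (d-∨ p q) c h l =
    ¬¬⊎-⟷ (elimF-correct p c h (≤-trans (≤-+ʳ _ _) l)) (elimF-correct q c h (≤-trans (≤-+ˡ _ _) l))
  elimF-correct (d-b∀ t p) c h l =
    (λ f x x<t → proj₁ (elimF-under t p c h l x x<t) (f x x<t)) ,
    (λ f x x<t → proj₂ (elimF-under t p c h l x x<t) (f x x<t))
  elimF-correct (d-b∃ t p) c h l =
    ¬¬-map (λ (x , x<t , s) → x , x<t , proj₁ (elimF-under t p c h l x x<t) s) ,
    ¬¬-map (λ (x , x<t , s) → x , x<t , proj₂ (elimF-under t p c h l x x<t) s)
  elimF-under t p c {ρ} h l x x<t = elimF-correct p (wkT c)
    (λ i i<b → ⟷-trans (h i i<b) (CodeMem-cong (≈-sym (eval-wkT c)) ≈-refl , CodeMem-cong (eval-wkT c) ≈-refl))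
    (≤-trans (eval-mono (bnd p) {x ▹ ρ} {eval t ρ ▹ ρ} (λ { zero → <⇒≤ (<-cong ≈-refl (eval-wkT t) x<t) ; (suc i) →
      ≤-refl }))
      (≤-trans (≈⇒≤ (≈-sym (eval-subst (single t) (bnd p) {ρ} {eval t ρ ▹ ρ} (λ { zero → ≈-refl ; (suc i) →
        ≈-refl })))) l))

-- The Σ₂ Skolem hull

-- A Δ₀ form of destructuring: the components of variable `i` enter the context as `v1` and `v0`,
-- and the formula is false if `i` is not a pair. Pairing is injective, so it acts as a local
-- definition.
splitV : ∀ {n m} → Fin n → Fm (suc (suc n)) m → Fm n m
splitV i φ = ∃ₙ (v0 ≺ var (suc i) ⊕ `1 ∧̇ ∃ₙ (v0 ≺ var (suc (suc i)) ⊕ `1 ∧̇ (var (suc (suc i)) ≐ pairT v1 v0 ∧̇ φ)))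

splitV-Δ₀ : ∀ {n m} (i : Fin n) {φ : Fm (suc (suc n)) m} → Δ₀ φ → Δ₀ (splitV i φ)
splitV-Δ₀ i p = d-b∃ (var i ⊕ `1) (d-b∃ (var (suc i) ⊕ `1) (d-∧ d-≐ p))

-- `Δ₀-subst` transports its derivations at bounded quantifiers; the bound has to be read through
-- this transport.
bnd-∀ : ∀ {n m} {t : Tm n} {u} {φ : Fm (suc n) m} (e : wkT t ≡ u) (p : Δ₀ φ) →
        bnd (subst (λ u → Δ₀ (∀ₙ ((var zero ≺ u) ⇒ φ))) e (d-b∀ t p)) ≡ substT (single t) (bnd p)
bnd-∀ refl p = refl

bnd-∃ : ∀ {n m} {t : Tm n} {u} {φ : Fm (suc n) m} (e : wkT t ≡ u) (p : Δ₀ φ) →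
        bnd (subst (λ u → Δ₀ (∃ₙ ((var zero ≺ u) ∧̇ φ))) e (d-b∃ t p)) ≡ substT (single t) (bnd p)
bnd-∃ refl p = refl

module Definable (M : Structure) (rca : Sem.Models M RCA₀) where
  open Coding M rca public

  splitV-intro : ∀ {n m} (i : Fin n) (φ : Fm (suc (suc n)) m) {ρ τ x y} → ρ i ≈ ⟪ x , y ⟫ →
                 Sat (splitV i φ) ρ τ ⟷ Sat φ (y ▹ x ▹ ρ) τ
  splitV-intro i φ {x = x} {y} e =
    (λ h → Sat-stable φ (λ k → h (λ (x' , _ , h) → h (λ (y' , _ , e' , s) →
       let (p , q) = pair-inj (≈-sym e' ∙ e) in k (Sat-congᵥ φ (▹-≈ q (▹-≈ p (λ _ → ≈-refl))) s))))) ,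
    (λ s k → k (x , ≤-trans (≤-pair₁ x y) (≈⇒≤ (≈-sym e)) , λ k → k (y , ≤-trans (≤-pair₂ x y) (≈⇒≤ (≈-sym e)) , e ,
      s)))

  splitV-elim : ∀ {n m} (i : Fin n) (φ : Fm (suc (suc n)) m) {ρ τ} → Sat (splitV i φ) ρ τ →
                ¬ ¬ (Σ Dom λ x → Σ Dom λ y → ρ i ≈ ⟪ x , y ⟫ × Sat φ (y ▹ x ▹ ρ) τ)
  splitV-elim i φ h k = h (λ (x , _ , h) → h (λ (y , _ , e , s) → k (x , y , e , s)))

  bnd-subst : ∀ {n k m} (σ : Fin n → Tm k) {φ : Fm n m} (p : Δ₀ φ) {ρ ρ'} →
              (∀ i → eval (σ i) ρ ≈ ρ' i) → eval (bnd (Δ₀-subst σ p)) ρ ≈ eval (bnd p) ρ'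
  bnd-under : ∀ {n k m} (σ : Fin n → Tm k) (t : Tm n) {φ : Fm (suc n) m} (p : Δ₀ φ) {ρ ρ'} →
              (∀ i → eval (σ i) ρ ≈ ρ' i) →
              eval (substT (single (substT σ t)) (bnd (Δ₀-subst (liftσ σ) p))) ρ ≈ eval (substT (single t) (bnd p)) ρ'
  bnd-subst σ d-≐ h = ≈-refl
  bnd-subst σ d-≺ h = ≈-refl
  bnd-subst σ (d-∈ {t = t}) h = +-cʳ 1# (eval-subst σ t h)
  bnd-subst σ d-⊥ h = ≈-refl
  bnd-subst σ (d-⇒ p q) h = +-cong (bnd-subst σ p h) (bnd-subst σ q h)
  bnd-subst σ (d-∧ p q) h = +-cong (bnd-subst σ p h) (bnd-subst σ q h)
  bnd-subst σ (d-∨ p q) h = +-cong (bnd-subst σ p h) (bnd-subst σ q h)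
  bnd-subst σ (d-b∀ t p) {ρ} h =
    ≡⇒≈ (cong (λ u → eval u ρ) (bnd-∀ (sym (substT-wkT σ t)) (Δ₀-subst (liftσ σ) p))) ∙ bnd-under σ t p h
  bnd-subst σ (d-b∃ t p) {ρ} h =
    ≡⇒≈ (cong (λ u → eval u ρ) (bnd-∃ (sym (substT-wkT σ t)) (Δ₀-subst (liftσ σ) p))) ∙ bnd-under σ t p h
  bnd-under σ t p {ρ} {ρ'} h =
    eval-subst _ (bnd (Δ₀-subst (liftσ σ) p)) {ρ} {eval t ρ' ▹ ρ}
      (λ { zero → eval-subst σ t h ; (suc i) → ≈-refl }) ∙
    bnd-subst (liftσ σ) p {eval t ρ' ▹ ρ} {eval t ρ' ▹ ρ'} (lift-eval σ h) ∙
    ≈-sym (eval-subst (single t) (bnd p) {ρ'} {eval t ρ' ▹ ρ'} (λ { zero → ≈-refl ; (suc i) → ≈-refl }))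

  -- The induction on j proves ∃u ∀y<j ∃w<u ¬φ(w,y) as long as no least y with ∀w φ(w,y) has been met.
  leastΠ₁ : ∀ {n m} {φ : Fm (suc (suc n)) m} → Δ₀ φ → (ρ : Fin n → Dom) (τ : Fin m → Sets) →
            ∀ {y₀} → (∀ w → Sat φ (w ▹ y₀ ▹ ρ) τ) →
            ¬ ¬ (Σ Dom λ y → Σ Dom λ u → (∀ w → Sat φ (w ▹ y ▹ ρ) τ) ×
                 (∀ y' → y' < y → ¬ ¬ (Σ Dom λ w → w < u × ¬ Sat φ (w ▹ y' ▹ ρ) τ)))
  leastΠ₁ {n} {m} {φ} d ρ τ {y₀} h₀ k = go (y₀ + 1#) (λ (u , f) → f y₀ x<x+1 (λ (w , _ , nφ) →
    nφ (proj₂ (iff w u (y₀ + 1#)) (h₀ w))))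
    where
    σ : Fin (suc (suc n)) → Tm (suc (suc (suc (suc n))))
    σ = v0 ▹ v1 ▹ (λ i → var (suc (suc (suc (suc i)))))
    iff : ∀ w {y} u j → Sat (substF σ φ) (w ▹ y ▹ u ▹ j ▹ ρ) τ ⟷ Sat φ (w ▹ y ▹ ρ) τ
    iff w {y} u j = Sat-subst σ φ {w ▹ y ▹ u ▹ j ▹ ρ} {w ▹ y ▹ ρ} (λ { zero → ≈-refl ; 1F → ≈-refl ; (suc (suc i)) →
      ≈-refl })
    ψ : Fm (suc n) m
    ψ = ∃ₙ (∀ₙ (v0 ≺ v2 ⇒ ∃ₙ (v0 ≺ v2 ∧̇ ¬̇ substF σ φ)))
    go : ∀ j → Sat ψ (j ▹ ρ) τ
    go = induction {φ = ψ} (Σ-∃ (Δ₀⇒Σ₁ (d-b∀ v1 (d-b∃ v1 (d-⇒ (Δ₀-subst σ d) d-⊥))))) ρ τ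
      (λ k → k (0# , λ y l → ⊥-elim (≮0 l)))
      (λ j h k' → h (λ (u , f) → k (j , u ,
        (λ w → Sat-stable φ (λ nφ → k' (u + (w + 1#) , λ y l k'' → proj₁ <-suc l (λ
          { (inj₁ l') → f y l' (λ (w' , l'' , nφ') → k'' (w' , <-≤-trans l'' (≤-+ʳ _ _) , λ s →
            nφ' (proj₂ (iff w' u j) (proj₁ (iff w' (u + (w + 1#)) (j + 1#)) s))))
          ; (inj₂ e) → k'' (w , ≤-+ˡ' , λ s → nφ (Sat-congᵥ φ (▹-≈ ≈-refl (▹-≈ e (λ _ → ≈-refl)))
            (proj₁ (iff w (u + (w + 1#)) (j + 1#)) s))) })))) ,
        (λ y' l k'' → f y' l (λ (w , l' , nφ) → k'' (w , l' , λ s → nφ (proj₂ (iff w u j) s)))))))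
      where
      ≤-+ˡ' : ∀ {u w} → w < u + (w + 1#)
      ≤-+ˡ' {u} {w} = <-≤-trans x<x+1 (≤-+ˡ u (w + 1#))

  -- This is BΣ₁, obtained from the least number principle for "y < J implies that no w satisfies
  -- φ". `J` satisfies this vacuously and by hypothesis nothing below does, so the least solution is
  -- at least `J` and the bound that comes with it serves all y below `J`.
  collection : ∀ {n m} {φ : Fm (suc (suc n)) m} → Δ₀ φ → (ρ : Fin n → Dom) (τ : Fin m → Sets) →
               ∀ J → (∀ y → y < J → ¬ ¬ (Σ Dom λ w → Sat φ (w ▹ y ▹ ρ) τ)) →
               ¬ ¬ (Σ Dom λ u → ∀ y → y < J → ¬ ¬ (Σ Dom λ w → w < u × Sat φ (w ▹ y ▹ ρ) τ))
  collection {n} {m} {φ} d ρ τ J h k =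
    leastΠ₁ {φ = v1 ≺ v2 ⇒ ¬̇ substF σ φ} (d-⇒ d-≺ (d-⇒ (Δ₀-subst σ d) d-⊥)) (J ▹ ρ) τ {J}
      (λ w l → ⊥-elim (<-irrefl l))
      (λ (y , u , p , f) → k (u , λ y' l → ¬¬-map
         (λ (w , l' , s) → w , l' , Sat-stable φ (λ nφ → s (λ _ s → nφ (proj₁ (iff w) s))))
         (f y' (<-≤-trans l (≮⇒≥ (λ y<J → h y y<J (λ (w , s) → p w y<J (proj₂ (iff w) s))))))))
    where
    σ : Fin (suc (suc n)) → Tm (suc (suc (suc n)))
    σ = v0 ▹ v1 ▹ (λ i → var (suc (suc (suc i))))
    iff : ∀ w {y} → Sat (substF σ φ) (w ▹ y ▹ J ▹ ρ) τ ⟷ Sat φ (w ▹ y ▹ ρ) τ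
    iff w {y} = Sat-subst σ φ {w ▹ y ▹ J ▹ ρ} {w ▹ y ▹ ρ} (λ { zero → ≈-refl ; 1F → ≈-refl ; (suc (suc i)) → ≈-refl })

module Hull (M : Structure) (rca : Sem.Models M RCA₀)
            (a : Structure.Dom M) (X U : Structure.Sets M) where
  open Definable M rca public

  τ₀ : Fin 2 → Sets
  τ₀ = X ▹ U ▹ ε

  Holds : Fm 3 2 → Dom → Dom → Set
  Holds θ p g = ∀ w → Sat θ (w ▹ p ▹ g ▹ ε) τ₀

  Holds-cong : ∀ θ {p q g} → p ≈ q → Holds θ p g → Holds θ q g
  Holds-cong θ e h w = Sat-congᵥ θ (▹-≈ ≈-refl (▹-≈ e (λ _ → ≈-refl))) (h w)

  Defines : Fm 3 2 → Dom → Set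
  Defines θ p = Holds θ p a × (∀ q → Holds θ q a → q ≈ p)

  -- The component r holds the auxiliary witnesses that make the pair the unique solution of a Π₁ formula.
  K : Dom → Set
  K x = ¬ ¬ (Σ Dom λ r → Σ (Fm 3 2) λ θ → Δ₀ θ × Defines θ ⟪ x , r ⟫)

  K-cong : ∀ {x y} → x ≈ y → K x → K y
  K-cong e = ¬¬-map (λ (r , θ , d , h , u) → r , θ , d , Holds-cong θ (pair-cong e ≈-refl) h ,
                       λ q s → u q s ∙ pair-cong e ≈-refl)

  K-a : K a
  K-a k = k (a , (v1 ≐ pairT v2 v2) , d-≐ , (λ _ → ≈-refl) , λ q h → h 0#)

  -- The solutions `⟪ x , r ⟫` and `⟪ y , s ⟫` are regrouped as `⟪ ⟪ x , y ⟫ , ⟪ r , s ⟫ ⟫`, which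
  -- puts the wanted pair in first position and the auxiliary data in second.
  module PairUp (θ₁ θ₂ : Fm 3 2) where
    σ₁ σ₂ : Fin 3 → Tm 9
    σ₁ = v6 ▹ pairT v3 v1 ▹ v8 ▹ ε
    σ₂ = v6 ▹ pairT v2 v0 ▹ v8 ▹ ε

    body : Fm 9 2
    body = substF σ₁ θ₁ ∧̇ substF σ₂ θ₂

    l₂ : Fm 7 2
    l₂ = splitV 2F body

    l₁ : Fm 5 2
    l₁ = splitV 1F l₂

    θ : Fm 3 2
    θ = splitV 1F l₁

    iff : ∀ w {p P R x y r s} → p ≈ ⟪ P , R ⟫ → P ≈ ⟪ x , y ⟫ → R ≈ ⟪ r , s ⟫ →
          Sat θ (w ▹ p ▹ a ▹ ε) τ₀ ⟷ (Sat θ₁ (w ▹ ⟪ x , r ⟫ ▹ a ▹ ε) τ₀ × Sat θ₂ (w ▹ ⟪ y , s ⟫ ▹ a ▹ ε) τ₀)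
    iff w {p} {P} {R} {x} {y} {r} {s} e₁ e₂ e₃ =
      ⟷-trans (splitV-intro 1F l₁ {w ▹ p ▹ a ▹ ε} e₁)
      (⟷-trans (splitV-intro 1F l₂ {R ▹ P ▹ w ▹ p ▹ a ▹ ε} e₂)
      (⟷-trans (splitV-intro 2F body {y ▹ x ▹ R ▹ P ▹ w ▹ p ▹ a ▹ ε} e₃)
        (×-⟷ (Sat-subst σ₁ θ₁ {s ▹ r ▹ y ▹ x ▹ R ▹ P ▹ w ▹ p ▹ a ▹ ε} {w ▹ ⟪ x , r ⟫ ▹ a ▹ ε}
                (λ { zero → ≈-refl ; 1F → ≈-refl ; 2F → ≈-refl }))
             (Sat-subst σ₂ θ₂ {s ▹ r ▹ y ▹ x ▹ R ▹ P ▹ w ▹ p ▹ a ▹ ε} {w ▹ ⟪ y , s ⟫ ▹ a ▹ ε}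
                (λ { zero → ≈-refl ; 1F → ≈-refl ; 2F → ≈-refl })))))

    defines : ∀ {x y r s} → Defines θ₁ ⟪ x , r ⟫ → Defines θ₂ ⟪ y , s ⟫ → Defines θ ⟪ ⟪ x , y ⟫ , ⟪ r , s ⟫ ⟫
    defines (h₁ , u₁) (h₂ , u₂) =
      (λ w → proj₂ (iff w ≈-refl ≈-refl ≈-refl) (h₁ w , h₂ w)) ,
      λ q h → use ≈-stable (splitV-elim 1F l₁ (h 0#)) (λ (P , R , e₁ , h') →
              use ≈-stable (splitV-elim 1F l₂ h') (λ (x' , y' , e₂ , h') →
              use ≈-stable (splitV-elim 2F body h') (λ (r' , s' , e₃ , _) →
                let (ex , er) = pair-inj (u₁ ⟪ x' , r' ⟫ (λ w → proj₁ (proj₁ (iff w e₁ e₂ e₃) (h w))))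
                    (ey , es) = pair-inj (u₂ ⟪ y' , s' ⟫ (λ w → proj₂ (proj₁ (iff w e₁ e₂ e₃) (h w))))
                in e₁ ∙ pair-cong (e₂ ∙ pair-cong ex ey) (e₃ ∙ pair-cong er es))))

  K-pair : ∀ {x y} → K x → K y → K ⟪ x , y ⟫
  K-pair kx ky k = kx (λ (r , θ₁ , d₁ , h₁) → ky (λ (s , θ₂ , d₂ , h₂) →
    k (⟪ r , s ⟫ , PairUp.θ θ₁ θ₂ ,
       splitV-Δ₀ 1F (splitV-Δ₀ 1F (splitV-Δ₀ 2F (d-∧ (Δ₀-subst _ d₁) (Δ₀-subst _ d₂)))) ,
       PairUp.defines θ₁ θ₂ h₁ h₂)))

  module Extend (θ₁ : Fm 3 2) (φ : Fm 4 2) where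
    σ₁ : Fin 3 → Tm 9
    σ₁ = v6 ▹ v2 ▹ v8 ▹ ε
    σ₂ : Fin 4 → Tm 9
    σ₂ = v6 ▹ v5 ▹ v3 ▹ v1 ▹ ε

    body : Fm 9 2
    body = substF σ₁ θ₁ ∧̇ substF σ₂ φ

    l₂ : Fm 7 2
    l₂ = splitV zero body

    l₁ : Fm 5 2
    l₁ = splitV zero l₂

    θ : Fm 3 2
    θ = splitV 1F l₁

    iff : ∀ w {p q s y u g r} → p ≈ ⟪ y , q ⟫ → q ≈ ⟪ u , s ⟫ → s ≈ ⟪ g , r ⟫ →
          Sat θ (w ▹ p ▹ a ▹ ε) τ₀ ⟷ (Sat θ₁ (w ▹ s ▹ a ▹ ε) τ₀ × Sat φ (w ▹ y ▹ u ▹ g ▹ ε) τ₀)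
    iff w {p} {q} {s} {y} {u} {g} {r} e₁ e₂ e₃ =
      ⟷-trans (splitV-intro 1F l₁ {w ▹ p ▹ a ▹ ε} e₁)
      (⟷-trans (splitV-intro zero l₂ {q ▹ y ▹ w ▹ p ▹ a ▹ ε} e₂)
      (⟷-trans (splitV-intro zero body {s ▹ u ▹ q ▹ y ▹ w ▹ p ▹ a ▹ ε} e₃)
        (×-⟷ (Sat-subst σ₁ θ₁ {r ▹ g ▹ s ▹ u ▹ q ▹ y ▹ w ▹ p ▹ a ▹ ε} {w ▹ s ▹ a ▹ ε}
                (λ { zero → ≈-refl ; 1F → ≈-refl ; 2F → ≈-refl }))
             (Sat-subst σ₂ φ {r ▹ g ▹ s ▹ u ▹ q ▹ y ▹ w ▹ p ▹ a ▹ ε} {w ▹ y ▹ u ▹ g ▹ ε}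
                (λ { zero → ≈-refl ; 1F → ≈-refl ; 2F → ≈-refl ; 3F → ≈-refl })))))

  -- The parameter is absorbed into the auxiliary component: `⟪ y , ⟪ u , ⟪ g , r ⟫ ⟫ ⟫` is a Π₁
  -- singleton over a, where `⟪ g , r ⟫` is the one that puts `g` into the hull.
  K-define : ∀ {g y u} (φ : Fm 4 2) → Δ₀ φ → K g → (∀ w → Sat φ (w ▹ y ▹ u ▹ g ▹ ε) τ₀) →
             (∀ y' u' → (∀ w → Sat φ (w ▹ y' ▹ u' ▹ g ▹ ε) τ₀) → y' ≈ y × u' ≈ u) → K y
  K-define {g} {y} {u} φ d kg hφ uφ k = kg (λ (r , θ₁ , d₁ , h₁ , u₁) → let open Extend θ₁ φ in
    k (⟪ u , ⟪ g , r ⟫ ⟫ , θ ,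
       splitV-Δ₀ 1F (splitV-Δ₀ zero (splitV-Δ₀ zero (d-∧ (Δ₀-subst σ₁ d₁) (Δ₀-subst σ₂ d)))) ,
       (λ w → proj₂ (iff w ≈-refl ≈-refl ≈-refl) (h₁ w , hφ w)) ,
       λ p h → use ≈-stable (splitV-elim 1F l₁ (h 0#)) (λ (y' , q , e₁ , h') →
               use ≈-stable (splitV-elim zero l₂ h') (λ (u' , s , e₂ , h') →
               use ≈-stable (splitV-elim zero body h') (λ (g' , r' , e₃ , _) →
                 let es = u₁ s (λ w → proj₁ (proj₁ (iff w e₁ e₂ e₃) (h w)))
                     (eg , er) = pair-inj (≈-sym e₃ ∙ es)
                     (ey , eu) = uφ y' u' (λ w → Sat-congᵥ φ (▹-≈ ≈-refl (▹-≈ ≈-refl (▹-≈ ≈-refl (▹-≈ eg (λ ())))))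
                                   (proj₂ (proj₁ (iff w e₁ e₂ e₃) (h w))))
                 in e₁ ∙ pair-cong ey (e₂ ∙ pair-cong eu es))))))

  K-fst : ∀ {x y} → K ⟪ x , y ⟫ → K x
  K-fst {x} {y} k = K-define (v3 ≐ pairT v1 v2) d-≐ k (λ _ → ≈-refl) (λ y' u' h → pair-inj (≈-sym (h 0#)))

  private
    module Least (φ : Fm 3 2) (d : Δ₀ φ) where
      -- ψ (u, y, g): every y' < y is refuted by some w < u
      σ : Fin 3 → Tm 5
      σ = v0 ▹ v1 ▹ v4 ▹ ε
      ψ : Fm 3 2
      ψ = ∀ₙ (v0 ≺ v2 ⇒ ∃ₙ (v0 ≺ v2 ∧̇ ¬̇ substF σ φ))
      ψ-Δ₀ : Δ₀ ψ
      ψ-Δ₀ = d-b∀ v1 (d-b∃ v1 (d-⇒ (Δ₀-subst σ d) d-⊥))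
      Sat-ψ : ∀ u y g → Sat ψ (u ▹ y ▹ g ▹ ε) τ₀ ⟷
              (∀ y' → y' < y → ¬ ¬ (Σ Dom λ w → w < u × ¬ Sat φ (w ▹ y' ▹ g ▹ ε) τ₀))
      Sat-ψ u y g = Π-⟷ (λ y' → →-⟷ ⟷-refl (¬¬Σ-⟷ (λ w → ×-⟷ ⟷-refl (→-⟷
        (Sat-subst σ φ {w ▹ y' ▹ u ▹ y ▹ g ▹ ε} {w ▹ y' ▹ g ▹ ε} (λ { zero → ≈-refl ; 1F → ≈-refl ; 2F → ≈-refl }))
          ⟷-refl))))
      -- (w, y, u, g): φ holds at y, and u is the least number refuting all smaller y'
      χ : Fm 4 2
      χ = substF (v0 ▹ v1 ▹ v3 ▹ ε) φ ∧̇ (substF (v2 ▹ v1 ▹ v3 ▹ ε) ψ ∧̇ ∀ₙ (v0 ≺ v3 ⇒ ¬̇ substF (v0 ▹ v2 ▹ v4 ▹ ε)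
        ψ))
      χ-Δ₀ : Δ₀ χ
      χ-Δ₀ = d-∧ (Δ₀-subst _ d) (d-∧ (Δ₀-subst (v2 ▹ v1 ▹ v3 ▹ ε) ψ-Δ₀)
        (d-b∀ v2 (d-⇒ (Δ₀-subst (v0 ▹ v2 ▹ v4 ▹ ε) ψ-Δ₀) d-⊥)))
      Sat-χ : ∀ w y u g → Sat χ (w ▹ y ▹ u ▹ g ▹ ε) τ₀ ⟷
              (Sat φ (w ▹ y ▹ g ▹ ε) τ₀ × Sat ψ (u ▹ y ▹ g ▹ ε) τ₀ × (∀ u' → u' < u → ¬ Sat ψ (u' ▹ y ▹ g ▹ ε) τ₀))
      Sat-χ w y u g = ×-⟷ (Sat-subst _ φ {ρ' = w ▹ y ▹ g ▹ ε} (λ { zero → ≈-refl ; 1F → ≈-refl ; 2F → ≈-refl }))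
        (×-⟷ (Sat-subst (v2 ▹ v1 ▹ v3 ▹ ε) ψ {ρ = w ▹ y ▹ u ▹ g ▹ ε} {ρ' = u ▹ y ▹ g ▹ ε} {τ₀}
          (λ { zero → ≈-refl ; 1F → ≈-refl ; 2F → ≈-refl }))
             (Π-⟷ (λ u' → →-⟷ ⟷-refl (→-⟷ (Sat-subst (v0 ▹ v2 ▹ v4 ▹ ε) ψ {ρ = u' ▹ w ▹ y ▹ u ▹ g ▹ ε} {ρ' =
               u' ▹ y ▹ g ▹ ε} {τ₀} (λ { zero → ≈-refl ; 1F → ≈-refl ; 2F → ≈-refl })) ⟷-refl))))

  -- For the least solution `y`, the statement that all smaller numbers are refuted is only Σ₁ over
  -- collection. Relative to a bound `u` on the refutations it is Δ₀, and with `u` also chosen least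
  -- the pair of `y` and `u` is the only solution of the Π₁ condition given by `χ`.
  skolem₁ : ∀ {g y₀} (φ : Fm 3 2) → Δ₀ φ → K g → Holds φ y₀ g → ¬ ¬ (Σ Dom λ y → K y × Holds φ y g)
  skolem₁ {g} φ d kg h₀ k = leastΠ₁ d (g ▹ ε) τ₀ h₀ (λ (y , u₀ , hy , f) →
    leastΠ₁ {φ = substF (v1 ▹ v2 ▹ v3 ▹ ε) ψ} (Δ₀-subst (v1 ▹ v2 ▹ v3 ▹ ε) ψ-Δ₀) (y ▹ g ▹ ε) τ₀ {u₀}
      (λ w → proj₂ (sub w u₀ y) (proj₂ (Sat-ψ u₀ y g) f)) (λ (u , _ , hu , fu) →
      k (y , K-define {g} {y} {u} χ χ-Δ₀ kg
        (λ w → proj₂ (Sat-χ w y u g) (hy w , proj₁ (sub w u y) (hu w) ,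
           λ u' l s → fu u' l (λ (w , _ , n) → n (proj₂ (sub w u' y) s))))
        (λ y' u' h →
          let hy' = λ w → proj₁ (proj₁ (Sat-χ w y' u' g) (h w))
              (_ , ψ' , min') = proj₁ (Sat-χ 0# y' u' g) (h 0#)
              ey : y' ≈ y
              ey = use ≈-stable (compare y' y) (λ
                { (inj₁ l) → ⊥-elim (f y' l (λ (w , _ , n) → n (hy' w)))
                ; (inj₂ (inj₁ e)) → e
                ; (inj₂ (inj₂ l)) → ⊥-elim (proj₁ (Sat-ψ u' y' g) ψ' y l (λ (w , _ , n) → n (hy w))) })
              tr : ∀ {y y'} v → y ≈ y' → Sat ψ (v ▹ y ▹ g ▹ ε) τ₀ → Sat ψ (v ▹ y' ▹ g ▹ ε) τ₀
              tr {y} {y'} v e = Sat-congᵥ ψ {v ▹ y ▹ g ▹ ε} {v ▹ y' ▹ g ▹ ε} {τ₀} (▹-≈ ≈-refl (▹-≈ e (λ _ → ≈-refl)))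
          in ey , use ≈-stable (compare u' u) (λ
            { (inj₁ l) → ⊥-elim (fu u' l (λ (w , _ , n) → n (proj₂ (sub w u' y) (tr u' ey ψ'))))
            ; (inj₂ (inj₁ e)) → e
            ; (inj₂ (inj₂ l)) → ⊥-elim (min' u l (tr u (≈-sym ey) (proj₁ (sub 0# u y) (hu 0#)))) })) , hy)))
    where
    open Least φ d
    sub : ∀ w u y → Sat (substF (v1 ▹ v2 ▹ v3 ▹ ε) ψ) (w ▹ u ▹ y ▹ g ▹ ε) τ₀ ⟷ Sat ψ (u ▹ y ▹ g ▹ ε) τ₀
    sub w u y = Sat-subst (v1 ▹ v2 ▹ v3 ▹ ε) ψ {w ▹ u ▹ y ▹ g ▹ ε} {u ▹ y ▹ g ▹ ε} {τ₀}
      (λ { zero → ≈-refl ; 1F → ≈-refl ; 2F → ≈-refl })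

-- v1 codes the part below v0 of the set variable j
codesF : ∀ {m} → Fin m → Fm 2 m
codesF j = ∀ₙ (v0 ≺ v1 ⇒ (v0 ∈̇ j ⇔ substF (v2 ▹ v0 ▹ ε) memF))

codesF-Δ₀ : ∀ {m} (j : Fin m) → Δ₀ (codesF j)
codesF-Δ₀ j = d-b∀ v0 (d-∧ (d-⇒ d-∈ mem) (d-⇒ mem d-∈))
  where mem = Δ₀-subst (v2 ▹ v0 ▹ ε) memF-Δ₀

-- The sets of the hull, and elimination of set and number parameters

module Transfer (M : Structure) (rca : Sem.Models M RCA₀)
                (a : Structure.Dom M) (X U : Structure.Sets M) where
  open Hull M rca a X U public

  Sat-codesF : ∀ {m} (j : Fin m) b c τ → Sat (codesF j) (b ▹ c ▹ ε) τ ⟷ Codes c (τ j) b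
  Sat-codesF j b c τ = Π-⟷ (λ i → →-⟷ ⟷-refl (×-⟷ (→-⟷ ⟷-refl (mem i)) (→-⟷ (mem i) ⟷-refl)))
    where
    mem : ∀ i → Sat (substF (v2 ▹ v0 ▹ ε) memF) (i ▹ b ▹ c ▹ ε) τ ⟷ CodeMem c i
    mem i = ⟷-trans (Sat-subst (v2 ▹ v0 ▹ ε) memF {i ▹ b ▹ c ▹ ε} {c ▹ i ▹ ε} {τ} (λ { zero → ≈-refl ; 1F → ≈-refl }))
                    (Sat-memF c i {τ})

  -- Δ₁ definability of Y over 𝒦, in the form: the relation "c codes Y below b" is Σ₁.  In this form a Δ₀ formula
  -- about Y becomes Σ₁ (and Π₁) in X and U without any use of collection.
  InHull : Sets → Set
  InHull Y = ¬ ¬ (Σ Dom λ g → Σ (Fm 3 2) λ χ → K g × Δ₀ χ ×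
    (∀ c b → Codes c Y b ⟷ (¬ ¬ (Σ Dom λ w → Sat χ (w ▹ ⟪ c , b ⟫ ▹ g ▹ ε) τ₀))))

  InHull-τ₀ : ∀ j → InHull (τ₀ j)
  InHull-τ₀ j k = k (a , splitV 1F (substF (v0 ▹ v1 ▹ ε) (codesF j)) , K-a ,
    splitV-Δ₀ 1F (Δ₀-subst (v0 ▹ v1 ▹ ε) (codesF-Δ₀ j)) ,
    λ c b → (λ h k → k (0# , proj₂ (iff c b 0#) h)) ,
            (λ h → proj₁ (Sat-codesF j b c τ₀) (Sat-stable (codesF j) {b ▹ c ▹ ε} {τ₀} (λ k →
              h (λ (w , s) → k (proj₂ (Sat-codesF j b c τ₀) (proj₁ (iff c b w) s)))))))
    where
    iff : ∀ c b w → Sat (splitV 1F (substF (v0 ▹ v1 ▹ ε) (codesF j))) (w ▹ ⟪ c , b ⟫ ▹ a ▹ ε) τ₀ ⟷ Codes c (τ₀ j) b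
    iff c b w = ⟷-trans (splitV-intro 1F (substF (v0 ▹ v1 ▹ ε) (codesF j)) {w ▹ ⟪ c , b ⟫ ▹ a ▹ ε} {τ₀} {c} {b}
      ≈-refl)
      (⟷-trans (Sat-subst (v0 ▹ v1 ▹ ε) (codesF j) {b ▹ c ▹ w ▹ ⟪ c , b ⟫ ▹ a ▹ ε} {b ▹ c ▹ ε} {τ₀}
        (λ { zero → ≈-refl ; 1F → ≈-refl }))
               (Sat-codesF j b c τ₀))

  append : ∀ {m} → (Fin m → Sets) → Fin (m +ℕ 2) → Sets
  append {zero} τ = τ₀
  append {suc m} τ = τ zero ▹ append (λ i → τ (suc i))

  append-↑ˡ : ∀ {m} (τ : Fin m → Sets) i → append τ (i ↑ˡ 2) ≡ τ i
  append-↑ˡ τ zero = refl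
  append-↑ˡ τ (suc i) = append-↑ˡ (λ i → τ (suc i)) i

  append-↑ʳ : ∀ {m} (τ : Fin m → Sets) i → append τ (m ↑ʳ i) ≡ τ₀ i
  append-↑ʳ {zero} τ i = refl
  append-↑ʳ {suc m} τ i = append-↑ʳ (λ i → τ (suc i)) i

  Ex : ∀ {n m} → Fm (suc (suc n)) m → Dom → (Fin n → Dom) → (Fin m → Sets) → Set
  Ex θ q ρ τ = ¬ ¬ (Σ Dom λ w → Sat θ (w ▹ q ▹ ρ) τ)

  module ElimSet {n m : ℕ} {θ : Fm (suc (suc n)) (suc (m +ℕ 2))} (p : Δ₀ θ) (χ : Fm 3 2) where
    -- context of body: w₀ , c , b , w , w' , q , g , ρ
    σ : Fin (suc (suc n)) → Tm (7 +ℕ n)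
    σ = v3 ▹ v5 ▹ (λ i → var (suc (suc (suc (suc (suc (suc (suc i))))))))
    χ' : Fm (7 +ℕ n) (m +ℕ 2)
    χ' = substF (v0 ▹ pairT v1 v2 ▹ v6 ▹ ε) (renS (m ↑ʳ_) χ)
    body : Fm (7 +ℕ n) (m +ℕ 2)
    body = substT σ (bnd p) ≺ v2 ⊕ `1 ∧̇ (χ' ∧̇ elimF v1 (substF σ θ))
    θ' : Fm (suc (suc (suc n))) (m +ℕ 2)
    θ' = ∃ₙ (v0 ≺ v1 ∧̇ ∃ₙ (v0 ≺ v2 ∧̇ ∃ₙ (v0 ≺ v3 ∧̇ ∃ₙ (v0 ≺ v4 ∧̇ body))))
    θ'-Δ₀ : Δ₀ χ → Δ₀ θ'
    θ'-Δ₀ d = d-b∃ v0 (d-b∃ v1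
      (d-b∃ v2 (d-b∃ v3 (d-∧ d-≺ (d-∧ (Δ₀-subst _ (Δ₀-ren _ d)) (elimF-Δ₀ (Δ₀-subst σ p)))))))

    -- A Δ₀ formula consults only a bounded part of the set, so the set may be traded for a code of
    -- that part. Codes always exist, and being one is Σ₁ by membership in the hull.
    correct : ∀ {g} (ρ : Fin n → Dom) (τ : Fin (suc m) → Sets) →
              (∀ c b → Codes c (τ zero) b ⟷ (¬ ¬ (Σ Dom λ w → Sat χ (w ▹ ⟪ c , b ⟫ ▹ g ▹ ε) τ₀))) →
              ∀ q → Ex θ q ρ (append τ) ⟷ Ex θ' q (g ▹ ρ) (append (λ i → τ (suc i)))
    correct {g} ρ τ cd q =
      (λ h k → h (λ (w , s) → let b = eval (bnd p) (w ▹ q ▹ ρ) in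
         code-exists (τ zero) b (λ (c , hc) → proj₁ (cd c b) hc (λ (w₀ , s₀) →
           -- One unbounded witness above all the others, which can then be quantified boundedly.
           let w' = (w + b + c + w₀) + 1# in
           k (w' , λ k → k (w , ≤-trans (≤-+ʳ w b) (≤-trans (≤-+ʳ _ c) (≤-+ʳ _ w₀)) ,
                   λ k → k (b , ≤-trans (≤-+ˡ w b) (≤-trans (≤-+ʳ _ c) (≤-+ʳ _ w₀)) ,
                   λ k → k (c , ≤-trans (≤-+ˡ _ c) (≤-+ʳ _ w₀) ,
                   λ k → k (w₀ , ≤-+ˡ _ w₀ ,
                     ≈⇒≤ (eval-subst σ (bnd p) (σ-eval w₀ c b w w')) ,
                     proj₂ (iffχ w₀ c b w w') s₀ ,
                     proj₁ (iffθ w₀ c b w w' hc ≤-refl) s))))))))) ,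
      (λ h k → h (λ (w' , h) → h (λ (w , _ , h) → h (λ (b , _ , h) → h (λ (c , _ , h) → h (λ (w₀ , _ , l , s₀ , s) →
         k (w , proj₂ (iffθ w₀ c b w w' (proj₂ (cd c b) (λ k → k (w₀ , proj₁ (iffχ w₀ c b w w') s₀)))
                        (≤-trans (≈⇒≤ (≈-sym (eval-subst σ (bnd p) (σ-eval w₀ c b w w')))) l)) s)))))))
      where
      env : Dom → Dom → Dom → Dom → Dom → Fin (7 +ℕ n) → Dom
      env w₀ c b w w' = w₀ ▹ c ▹ b ▹ w ▹ w' ▹ q ▹ g ▹ ρ
      σ-eval : ∀ w₀ c b w w' → ∀ i → eval (σ i) (env w₀ c b w w') ≈ (w ▹ q ▹ ρ) i
      σ-eval w₀ c b w w' zero = ≈-refl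
      σ-eval w₀ c b w w' (suc zero) = ≈-refl
      σ-eval w₀ c b w w' (suc (suc i)) = ≈-refl
      iffχ : ∀ w₀ c b w w' → Sat χ' (env w₀ c b w w') (append (λ i → τ (suc i))) ⟷ Sat χ (w₀ ▹ ⟪ c , b ⟫ ▹ g ▹ ε) τ₀
      iffχ w₀ c b w w' = ⟷-trans
        (Sat-subst _ (renS (m ↑ʳ_) χ) {env w₀ c b w w'} {w₀ ▹ ⟪ c , b ⟫ ▹ g ▹ ε} (λ { zero → ≈-refl ; 1F →
          ≈-refl ; 2F → ≈-refl }))
        (Sat-ren (m ↑ʳ_) χ (append-↑ʳ (λ i → τ (suc i))))
      iffθ : ∀ w₀ c b w w' → Codes c (τ zero) b → eval (bnd p) (w ▹ q ▹ ρ) ≤ b →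
             Sat θ (w ▹ q ▹ ρ) (append τ) ⟷ Sat (elimF v1 (substF σ θ)) (env w₀ c b w w') (append (λ i → τ (suc i)))
      iffθ w₀ c b w w' hc l = ⟷-trans (⟷-sym (Sat-subst σ θ (σ-eval w₀ c b w w')))
        (elimF-correct (Δ₀-subst σ p) v1 {env w₀ c b w w'} hc (≤-trans (≈⇒≤ (bnd-subst σ p (σ-eval w₀ c b w w'))) l))

  elimSets : ∀ m {n} {θ : Fm (suc (suc n)) (m +ℕ 2)} → Δ₀ θ → (ρ : Fin n → Dom) → (∀ i → K (ρ i)) →
             (τ : Fin m → Sets) → (∀ i → InHull (τ i)) →
             ¬ ¬ (Σ ℕ λ n' → Σ (Fin n' → Dom) λ ρ' → (∀ i → K (ρ' i)) × Σ (Fm (suc (suc n')) 2) λ θ' → Δ₀ θ' ×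
                  (∀ q → Ex θ q ρ (append τ) ⟷ Ex θ' q ρ' τ₀))
  elimSets zero {n} {θ} d ρ kρ τ hτ k = k (n , ρ , kρ , θ , d , λ q → ⟷-refl)
  elimSets (suc m) d ρ kρ τ hτ k = hτ zero (λ (g , χ , kg , dχ , cd) →
    elimSets m (ElimSet.θ'-Δ₀ d χ dχ) (g ▹ ρ) (λ { zero → kg ; (suc i) → kρ i }) (λ i → τ (suc i)) (λ i → hτ (suc i))
      (λ (n' , ρ' , kρ' , θ' , d' , f) → k (n' , ρ' , kρ' , θ' , d' , λ q → ⟷-trans (ElimSet.correct d χ ρ τ cd q)
        (f q))))


  elimParams : ∀ n {θ : Fm (suc (suc n)) 2} → Δ₀ θ → (ρ : Fin n → Dom) → (∀ i → K (ρ i)) →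
               ¬ ¬ (Σ Dom λ g → K g × Σ (Fm 3 2) λ θ' → Δ₀ θ' × (∀ q → Ex θ q ρ τ₀ ⟷ Ex θ' q (g ▹ ε) τ₀))
  -- Without parameters, `a` fills the place of the one that is expected.
  elimParams zero {θ} d ρ kρ k = k (a , K-a , substF (v0 ▹ v1 ▹ ε) θ , Δ₀-subst _ d ,
    λ q → ¬¬Σ-⟷ (λ w → ⟷-sym (Sat-subst _ θ {ρ' = w ▹ q ▹ ρ} (λ { zero → ≈-refl ; 1F → ≈-refl }))))
  elimParams (suc zero) {θ} d ρ kρ k = k (ρ zero , kρ zero , θ , d ,
    λ q → ¬¬Σ-⟷ (λ w → Sat-cong θ (▹-≈ ≈-refl (▹-≈ ≈-refl (λ { zero → ≈-refl }))) (λ _ → refl)))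
  elimParams (suc (suc n)) {θ} d ρ kρ k =
    elimParams (suc n) (splitV-Δ₀ 2F (Δ₀-subst σ d)) ρ' (λ { zero → K-pair (kρ zero) (kρ (suc zero)) ; (suc i) →
      kρ (suc (suc i)) })
      (λ (g , kg , θ' , d' , f) → k (g , kg , θ' , d' , λ q → ⟷-trans (¬¬Σ-⟷ (λ w → ⟷-sym (iff w q))) (f q)))
    where
    σ : Fin (suc (suc (suc (suc n)))) → Tm (5 +ℕ n)
    σ = v2 ▹ v3 ▹ v1 ▹ v0 ▹ (λ i → var (suc (suc (suc (suc (suc i))))))
    ρ' : Fin (suc n) → Dom
    ρ' = ⟪ ρ zero , ρ (suc zero) ⟫ ▹ (λ i → ρ (suc (suc i)))
    iff : ∀ w q → Sat (splitV 2F (substF σ θ)) (w ▹ q ▹ ρ') τ₀ ⟷ Sat θ (w ▹ q ▹ ρ) τ₀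
    iff w q = ⟷-trans (splitV-intro 2F (substF σ θ) {w ▹ q ▹ ρ'} ≈-refl)
      (Sat-subst σ θ {ρ' = w ▹ q ▹ ρ} (λ { zero → ≈-refl ; 1F → ≈-refl ; 2F → ≈-refl ; 3F → ≈-refl
         ; (suc (suc (suc (suc i)))) → ≈-refl }))

  translate : ∀ {n m} {θ : Fm (suc (suc n)) m} → Δ₀ θ → (ρ : Fin n → Dom) → (∀ i → K (ρ i)) →
              (τ : Fin m → Sets) → (∀ i → InHull (τ i)) →
              ¬ ¬ (Σ Dom λ g → K g × Σ (Fm 3 2) λ θ' → Δ₀ θ' × (∀ q → Ex θ q ρ τ ⟷ Ex θ' q (g ▹ ε) τ₀))
  translate {m = m} {θ} d ρ kρ τ hτ k =
    elimSets m {θ = renS (_↑ˡ 2) θ} (Δ₀-ren _ d) ρ kρ τ hτ (λ (n' , ρ' , kρ' , θ₁ , d₁ , f₁) →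
    elimParams n' d₁ ρ' kρ' (λ (g , kg , θ₂ , d₂ , f₂) →
    k (g , kg , θ₂ , d₂ , λ q → ⟷-trans (¬¬Σ-⟷ (λ w → ⟷-sym (Sat-ren (_↑ˡ 2) θ (append-↑ˡ τ))))
      (⟷-trans (f₁ q) (f₂ q)))))

  -- `translate` treats Σ₁ formulas and is therefore applied to the negation of the Π₁ condition.
  skolem : ∀ {n m} {θ : Fm (suc (suc n)) m} → Δ₀ θ → (ρ : Fin n → Dom) → (∀ i → K (ρ i)) →
           (τ : Fin m → Sets) → (∀ i → InHull (τ i)) →
           ∀ {y₀} → (∀ w → Sat θ (w ▹ y₀ ▹ ρ) τ) → ¬ ¬ (Σ Dom λ y → K y × ∀ w → Sat θ (w ▹ y ▹ ρ) τ)
  skolem {θ = θ} d ρ kρ τ hτ {y₀} h₀ k = translate (d-⇒ d d-⊥) ρ kρ τ hτ (λ (g , kg , θ' , d' , f) →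
    skolem₁ {g} {y₀} (¬̇ θ') (d-⇒ d' d-⊥) kg (λ w s → proj₂ (f y₀) (λ k → k (w , s)) (λ (w , n) → n (h₀ w)))
      (λ (y , ky , hy) → k (y , ky , λ w → Sat-stable θ (λ n → proj₁ (f y) (λ k → k (w , n)) (λ (w' , s) →
        hy w' s)))))

-- Elementarity

module HullModel (M : Structure) (rca : Sem.Models M RCA₀)
                 (a : Structure.Dom M) (X U : Structure.Sets M) where
  open Transfer M rca a X U public

  -- A Σ₂ normal form up to truth in M. Equivalence is semantic because formulas such as a Σ₁
  -- formula conjoined with a Π₁ formula are Σ₂ only after rewriting.
  record NF {n m} (φ : Fm n m) : Set where
    field
      matrix : Fm (suc (suc n)) m
      isΔ₀ : Δ₀ matrix
      correct : ∀ ρ τ → Sat φ ρ τ ⟷ (¬ ¬ (Σ Dom λ v → ∀ w → Sat matrix (w ▹ v ▹ ρ) τ))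
  open NF

  private
    σ∃ : ∀ {n} → Fin (suc (suc (suc n))) → Tm (suc (suc (suc (suc n))))
    σ∃ = v2 ▹ v0 ▹ v1 ▹ (λ i → var (suc (suc (suc (suc i)))))

    split∃ : ∀ {n m} {φ : Fm (suc n) m} (N : NF φ) {p y v} w (ρ : Fin n → Dom) τ → p ≈ ⟪ y , v ⟫ →
             Sat (splitV 1F (substF σ∃ (matrix N))) (w ▹ p ▹ ρ) τ ⟷ Sat (matrix N) (w ▹ v ▹ y ▹ ρ) τ
    split∃ N {p} {y} {v} w ρ τ e = ⟷-trans (splitV-intro 1F (substF σ∃ (matrix N)) {w ▹ p ▹ ρ} e)
      (Sat-subst σ∃ (matrix N) {ρ' = w ▹ v ▹ y ▹ ρ} (λ { zero → ≈-refl ; 1F → ≈-refl ; 2F →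
        ≈-refl ; (suc (suc (suc i))) → ≈-refl }))

    unsplit∃ : ∀ {n m} {φ : Fm (suc n) m} (N : NF φ) {p} (ρ : Fin n → Dom) τ →
               (∀ w → Sat (splitV 1F (substF σ∃ (matrix N))) (w ▹ p ▹ ρ) τ) →
               ¬ ¬ (Σ Dom λ y → Σ Dom λ v → p ≈ ⟪ y , v ⟫ × Sat φ (y ▹ ρ) τ)
    unsplit∃ N ρ τ h k = splitV-elim 1F (substF σ∃ (matrix N)) (h 0#) (λ (y , v , e , _) →
      k (y , v , e , proj₂ (correct N (y ▹ ρ) τ) (λ k → k (v , λ w → proj₁ (split∃ N w ρ τ e) (h w)))))

  NF-∃ : ∀ {n m} {φ : Fm (suc n) m} → NF φ → NF (∃ₙ φ)
  NF-∃ {n} {m} {φ} N = record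
    { matrix = splitV 1F (substF σ∃ (matrix N))
    ; isΔ₀ = splitV-Δ₀ 1F (Δ₀-subst σ∃ (isΔ₀ N))
    ; correct = λ ρ τ →
        (λ h k → h (λ (y , s) → proj₁ (correct N (y ▹ ρ) τ) s (λ (v , f) → k (⟪ y , v ⟫ , λ w →
          proj₂ (split∃ N w ρ τ ≈-refl) (f w))))) ,
        (λ h k → h (λ (p , f) → unsplit∃ N ρ τ f (λ (y , v , e , s) → k (y , s)))) }

  -- The Skolem witness is found for `y` paired with its inner existential witness, because only
  -- then is the condition Π₁; projection stays in the hull.
  skolemNF : ∀ {n m} {φ : Fm (suc n) m} → NF φ → (ρ : Fin n → Dom) → (∀ i → K (ρ i)) →
             (τ : Fin m → Sets) → (∀ i → InHull (τ i)) →
             Sat (∃ₙ φ) ρ τ → ¬ ¬ (Σ Dom λ y → K y × Sat φ (y ▹ ρ) τ)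
  skolemNF N ρ kρ τ hτ s k = proj₁ (correct (NF-∃ N) ρ τ) s (λ (p , f) →
    skolem (isΔ₀ (NF-∃ N)) ρ kρ τ hτ f (λ (p' , kp' , f') → unsplit∃ N ρ τ f' (λ (y , v , e , s') →
      k (y , K-fst (K-cong e kp') , s'))))

  -- A block of like quantifiers contracts to one that bounds all the others, so no tuple has to be
  -- decoded.
  nfΠ₁ : ∀ {n m} {φ : Fm n m} → Π⁰ 1 φ → Σ (Fm (suc n) m) λ θ → Δ₀ θ × (∀ ρ τ → Sat φ ρ τ ⟷ (∀ w → Sat θ (w ▹ ρ) τ))
  nfΠ₁ {φ = φ} (Π-Σ (Σ-Δ₀ d)) = wkN φ , Δ₀-subst _ d ,
    λ ρ τ → (λ s w → proj₂ (Sat-wkN φ) s) , (λ f → proj₁ (Sat-wkN φ) (f 0#))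
  nfΠ₁ {n} {m} (Π-∀ {φ = φ} p) with nfΠ₁ p
  ... | θ , d , c = ∀ₙ (v0 ≺ v1 ⇒ ∀ₙ (v0 ≺ v2 ⇒ substF σ θ)) , d-b∀ v0 (d-b∀ v1 (Δ₀-subst σ d)) ,
    λ ρ τ → (λ s w z _ w' _ → proj₂ (iff w w' z ρ τ) (proj₁ (c (z ▹ ρ) τ) (s z) w')) ,
            (λ f z → proj₂ (c (z ▹ ρ) τ) (λ w' → proj₁ (iff _ w' z ρ τ) (f ((z + w') + 1#) z (≤-+ʳ z w') w'
              (≤-+ˡ z w'))))
    where
    σ : Fin (suc (suc n)) → Tm (suc (suc (suc n)))
    σ = v0 ▹ v1 ▹ (λ i → var (suc (suc (suc i))))
    iff : ∀ w w' z ρ τ → Sat (substF σ θ) (w' ▹ z ▹ w ▹ ρ) τ ⟷ Sat θ (w' ▹ z ▹ ρ) τ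
    iff w w' z ρ τ = Sat-subst σ θ {ρ' = w' ▹ z ▹ ρ} (λ { zero → ≈-refl ; 1F → ≈-refl ; (suc (suc i)) → ≈-refl })

  nfΣ₁ : ∀ {n m} {φ : Fm n m} → Σ⁰ 1 φ → Σ (Fm (suc n) m) λ θ → Δ₀ θ × (∀ ρ τ → Sat φ ρ τ ⟷
    (¬ ¬ (Σ Dom λ w → Sat θ (w ▹ ρ) τ)))
  nfΣ₁ {φ = φ} (Σ-Π (Π-Δ₀ d)) = wkN φ , Δ₀-subst _ d ,
    λ ρ τ → (λ s k → k (0# , proj₂ (Sat-wkN φ) s)) , (λ h → Sat-stable φ (¬¬-map (λ (w , s) → proj₁ (Sat-wkN φ) s) h))
  nfΣ₁ {n} {m} (Σ-∃ {φ = φ} p) with nfΣ₁ p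
  ... | θ , d , c = ∃ₙ (v0 ≺ v1 ∧̇ ∃ₙ (v0 ≺ v2 ∧̇ substF σ θ)) , d-b∃ v0 (d-b∃ v1 (Δ₀-subst σ d)) ,
    λ ρ τ → (λ h k → h (λ (z , s) → proj₁ (c (z ▹ ρ) τ) s (λ (w' , s') →
               k ((z + w') + 1# , λ k → k (z , ≤-+ʳ z w' , λ k → k (w' , ≤-+ˡ z w' , proj₂ (iff _ w' z ρ τ) s')))))) ,
            (λ h k → h (λ (w , h) → h (λ (z , _ , h) → k (z , proj₂ (c (z ▹ ρ) τ) (¬¬-map (λ (w' , _ , s) → w' ,
              proj₁ (iff w w' z ρ τ) s) h)))))
    where
    σ : Fin (suc (suc n)) → Tm (suc (suc (suc n)))
    σ = v0 ▹ v1 ▹ (λ i → var (suc (suc (suc i))))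
    iff : ∀ w w' z ρ τ → Sat (substF σ θ) (w' ▹ z ▹ w ▹ ρ) τ ⟷ Sat θ (w' ▹ z ▹ ρ) τ
    iff w w' z ρ τ = Sat-subst σ θ {ρ' = w' ▹ z ▹ ρ} (λ { zero → ≈-refl ; 1F → ≈-refl ; (suc (suc i)) → ≈-refl })

  private
    dropV : ∀ {n} → Fin (suc n) → Tm (suc (suc n))
    dropV = v0 ▹ (λ i → var (suc (suc i)))

    Sat-dropV : ∀ {n m} (θ : Fm (suc n) m) w v ρ τ → Sat (substF dropV θ) (w ▹ v ▹ ρ) τ ⟷ Sat θ (w ▹ ρ) τ
    Sat-dropV θ w v ρ τ = Sat-subst dropV θ {ρ' = w ▹ ρ} (λ { zero → ≈-refl ; (suc i) → ≈-refl })

  NF-Σ₁ : ∀ {n m} {φ : Fm n m} → Σ⁰ 1 φ → NF φ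
  NF-Σ₁ p with nfΣ₁ p
  ... | θ , d , c = record
    { matrix = wkN θ ; isΔ₀ = Δ₀-subst _ d
    ; correct = λ ρ τ → ⟷-trans (c ρ τ) (¬¬Σ-⟷ (λ v → (λ s w → proj₂ (Sat-wkN θ) s) ,
      (λ f → proj₁ (Sat-wkN θ) (f 0#)))) }

  NF-¬Π₁ : ∀ {n m} {φ : Fm n m} → Π⁰ 1 φ → NF (¬̇ φ)
  NF-¬Π₁ p with nfΠ₁ p
  ... | θ , d , c = record
    { matrix = ¬̇ wkN θ ; isΔ₀ = d-⇒ (Δ₀-subst _ d) d-⊥
    ; correct = λ ρ τ →
       (λ n k → n (proj₂ (c ρ τ) (λ v → Sat-stable θ (λ nθ → k (v , λ w s → nθ (proj₁ (Sat-wkN θ) s)))))) ,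
       (λ h s → h (λ (v , f) → f 0# (proj₂ (Sat-wkN θ) (proj₁ (c ρ τ) s v)))) }

  NF-Σ₂ : ∀ {n m} {φ : Fm n m} → Σ⁰ 2 φ → NF φ
  NF-Σ₂ (Σ-Π p) with nfΠ₁ p
  ... | θ , d , c = record
    { matrix = substF dropV θ ; isΔ₀ = Δ₀-subst _ d
    ; correct = λ ρ τ → ⟷-trans (c ρ τ)
       ((λ f k → k (0# , λ w → proj₂ (Sat-dropV θ w 0# ρ τ) (f w))) ,
        (λ h w → Sat-stable θ (¬¬-map (λ (v , f) → proj₁ (Sat-dropV θ w v ρ τ) (f w)) h))) }
  NF-Σ₂ (Σ-∃ p) = NF-∃ (NF-Σ₂ p)

  NF-Δ₀ : ∀ {n m} {φ : Fm n m} → Δ₀ φ → NF φ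
  NF-Δ₀ d = NF-Σ₁ (Δ₀⇒Σ₁ d)

  K-eval : ∀ {n} (t : Tm n) (ρ : Fin n → Dom) → (∀ i → K (ρ i)) → K (eval t ρ)
  K-eval t ρ kρ k = skolemNF {m = 0} {φ = v0 ≐ wkT t} (NF-Δ₀ d-≐) ρ kρ ε (λ ())
    (λ k → k (eval t ρ , ≈-sym (eval-wkT t))) (λ (y , ky , e) → K-cong (e ∙ eval-wkT t) ky k)

  𝒦 : Structure
  𝒦 = record
    { Dom = Σ Dom K ; Sets = Σ Sets InHull
    ; 0# = 0# , K-eval `0 ε (λ ())
    ; 1# = 1# , K-eval `1 ε (λ ())
    ; _+_ = λ (x , kx) (y , ky) → x + y , K-eval (v0 ⊕ v1) (x ▹ y ▹ ε) (λ { zero → kx ; 1F → ky })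
    ; _*_ = λ (x , kx) (y , ky) → x * y , K-eval (v0 ⊗ v1) (x ▹ y ▹ ε) (λ { zero → kx ; 1F → ky })
    ; _≈_ = λ x y → proj₁ x ≈ proj₁ y
    ; _<_ = λ x y → proj₁ x < proj₁ y
    ; _∈_ = λ x Y → proj₁ x ∈ proj₁ Y
    ; set₀ = X , InHull-τ₀ zero
    ; ≈-refl = ≈-refl ; ≈-sym = ≈-sym ; ≈-trans = ≈-trans
    ; +-cong = +-cong ; *-cong = *-cong ; <-cong = <-cong ; ∈-cong = ∈-cong
    ; ≈-stable = ≈-stable ; <-stable = <-stable ; ∈-stable = ∈-stable }

  module 𝒮 = Sem 𝒦

  DomK SetsK : Set
  DomK = Σ Dom K
  SetsK = Σ Sets InHull

  eval-𝒦 : ∀ {n} (t : Tm n) {ρ : Fin n → DomK} {ρ'} → (∀ i → proj₁ (ρ i) ≈ ρ' i) → proj₁ (𝒮.eval t ρ) ≈ eval t ρ'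
  eval-𝒦 (var i) h = h i
  eval-𝒦 `0 h = ≈-refl
  eval-𝒦 `1 h = ≈-refl
  eval-𝒦 (s ⊕ t) h = +-cong (eval-𝒦 s h) (eval-𝒦 t h)
  eval-𝒦 (s ⊗ t) h = *-cong (eval-𝒦 s h) (eval-𝒦 t h)

  -- The environments for 𝒦 and for M are carried side by side, since projecting an extended
  -- environment agrees only pointwise with extending the projected one.
  record Env (n m : ℕ) : Set where
    field
      ρ : Fin n → DomK
      τ : Fin m → SetsK
      ρM : Fin n → Dom
      τM : Fin m → Sets
      ρ≈ : ∀ i → proj₁ (ρ i) ≈ ρM i
      τ≡ : ∀ i → proj₁ (τ i) ≡ τM i
  open Env

  env : ∀ {n m} → (Fin n → DomK) → (Fin m → SetsK) → Env n m
  env r t = record { ρ = r ; τ = t ; ρM = λ i → proj₁ (r i) ; τM = λ i → proj₁ (t i) ; ρ≈ = λ _ → ≈-refl ; τ≡ = λ _ →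
    refl }

  infixr 5 _▸_
  _▸_ : ∀ {n m} → DomK → Env n m → Env (suc n) m
  x ▸ e = record { ρ = x ▹ ρ e ; τ = τ e ; ρM = proj₁ x ▹ ρM e ; τM = τM e
                 ; ρ≈ = λ { zero → ≈-refl ; (suc i) → ρ≈ e i } ; τ≡ = τ≡ e }

  K-env : ∀ {n m} (e : Env n m) i → K (ρM e i)
  K-env e i = K-cong (ρ≈ e i) (proj₂ (ρ e i))

  H-env : ∀ {n m} (e : Env n m) i → InHull (τM e i)
  H-env e i = subst InHull (τ≡ e i) (proj₂ (τ e i))

  SatK SatM : ∀ {n m} → Fm n m → Env n m → Set
  SatK φ e = 𝒮.Sat φ (ρ e) (τ e)
  SatM φ e = Sat φ (ρM e) (τM e)

  witness : ∀ {n m} {φ : Fm (suc n) m} → NF φ → (e : Env n m) → SatM (∃ₙ φ) e → ¬ ¬ (Σ DomK λ y → SatM φ (y ▸ e))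
  witness N e s = ¬¬-map (λ (y , ky , p) → (y , ky) , p) (skolemNF N (ρM e) (K-env e) (τM e) (H-env e) s)

  -- Nothing makes the hull an initial segment of M, so bounded quantifiers, too, need Skolem
  -- witnesses.
  elΔ₀ : ∀ {n m} {φ : Fm n m} → Δ₀ φ → (e : Env n m) → SatK φ e ⟷ SatM φ e
  elΔ₀ (d-≐ {s = s} {t}) e =
    (λ p → ≈-sym (eval-𝒦 s (ρ≈ e)) ∙ p ∙ eval-𝒦 t (ρ≈ e)) , (λ p → eval-𝒦 s (ρ≈ e) ∙ p ∙ ≈-sym (eval-𝒦 t (ρ≈ e)))
  elΔ₀ (d-≺ {s = s} {t}) e =
    <-cong (eval-𝒦 s (ρ≈ e)) (eval-𝒦 t (ρ≈ e)) , <-cong (≈-sym (eval-𝒦 s (ρ≈ e))) (≈-sym (eval-𝒦 t (ρ≈ e)))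
  elΔ₀ (d-∈ {t = t} {Y}) e =
    (λ p → subst (eval t (ρM e) ∈_) (τ≡ e Y) (∈-cong (eval-𝒦 t (ρ≈ e)) p)) ,
    (λ p → ∈-cong (≈-sym (eval-𝒦 t (ρ≈ e))) (subst (eval t (ρM e) ∈_) (sym (τ≡ e Y)) p))
  elΔ₀ d-⊥ e = ⟷-refl
  elΔ₀ (d-⇒ p q) e = →-⟷ (elΔ₀ p e) (elΔ₀ q e)
  elΔ₀ (d-∧ p q) e = ×-⟷ (elΔ₀ p e) (elΔ₀ q e)
  elΔ₀ (d-∨ p q) e = ¬¬⊎-⟷ (elΔ₀ p e) (elΔ₀ q e)
  elΔ₀ (d-b∀ t {φ} p) e =
    (λ f y l → Sat-stable φ (λ n → witness {φ = v0 ≺ wkT t ∧̇ ¬̇ φ} (NF-Δ₀ (d-∧ d-≺ (d-⇒ p d-⊥))) e (λ k →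
      k (y , l , n))
      (λ (y' , l' , n') → n' (proj₁ (elΔ₀ p (y' ▸ e)) (f y' (proj₂ (elΔ₀ {φ = v0 ≺ wkT t} d-≺ (y' ▸ e)) l')))))) ,
    (λ f y l → proj₂ (elΔ₀ p (y ▸ e)) (f (proj₁ y) (proj₁ (elΔ₀ {φ = v0 ≺ wkT t} d-≺ (y ▸ e)) l)))
  elΔ₀ (d-b∃ t {φ} p) e =
    ¬¬-map (λ (y , l , s) → proj₁ y , proj₁ (elΔ₀ {φ = v0 ≺ wkT t} d-≺ (y ▸ e)) l , proj₁ (elΔ₀ p (y ▸ e)) s) ,
    (λ h → ¬¬-map (λ (y , l , s) → y , proj₂ (elΔ₀ {φ = v0 ≺ wkT t} d-≺ (y ▸ e)) l , proj₂ (elΔ₀ p (y ▸ e)) s)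
      (witness {φ = v0 ≺ wkT t ∧̇ φ} (NF-Δ₀ (d-∧ d-≺ p)) e h))

  upΣ₁ : ∀ {n m} {φ : Fm n m} → Σ⁰ 1 φ → (e : Env n m) → SatK φ e → SatM φ e
  upΣ₁ (Σ-Π (Π-Δ₀ d)) e = proj₁ (elΔ₀ d e)
  upΣ₁ (Σ-∃ p) e = ¬¬-map (λ (y , s) → proj₁ y , upΣ₁ p (y ▸ e) s)

  downΣ₁ : ∀ {n m} {φ : Fm n m} → Σ⁰ 1 φ → (e : Env n m) → SatM φ e → SatK φ e
  downΣ₁ (Σ-Π (Π-Δ₀ d)) e = proj₂ (elΔ₀ d e)
  downΣ₁ (Σ-∃ p) e s = ¬¬-map (λ (y , s') → y , downΣ₁ p (y ▸ e) s') (witness (NF-Σ₁ p) e s)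

  downΠ₁ : ∀ {n m} {φ : Fm n m} → Π⁰ 1 φ → (e : Env n m) → SatM φ e → SatK φ e
  downΠ₁ (Π-Σ (Σ-Δ₀ d)) e = proj₂ (elΔ₀ d e)
  downΠ₁ (Π-∀ p) e s y = downΠ₁ p (y ▸ e) (s (proj₁ y))

  upΠ₁ : ∀ {n m} {φ : Fm n m} → Π⁰ 1 φ → (e : Env n m) → SatK φ e → SatM φ e
  upΠ₁ (Π-Σ (Σ-Δ₀ d)) e = proj₁ (elΔ₀ d e)
  upΠ₁ (Π-∀ {φ = φ} p) e s y = Sat-stable φ (λ n → witness (NF-¬Π₁ p) e (λ k → k (y , n))
    (λ (y' , n') → n' (upΠ₁ p (y' ▸ e) (s y'))))

  downΣ₂ : ∀ {n m} {φ : Fm n m} → Σ⁰ 2 φ → (e : Env n m) → SatM φ e → SatK φ e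
  downΣ₂ (Σ-Π p) e = downΠ₁ p e
  downΣ₂ (Σ-∃ p) e s = ¬¬-map (λ (y , s') → y , downΣ₂ p (y ▸ e) s') (witness (NF-Σ₂ p) e s)

  -- The outer universal quantifiers range over fewer elements in 𝒦, so Σ₂ elementarity gains one
  -- universal block in this direction.
  downΠ₃ : ∀ {n m} {φ : Fm n m} → Π⁰ 3 φ → (e : Env n m) → SatM φ e → SatK φ e
  downΠ₃ (Π-Σ p) e = downΣ₂ p e
  downΠ₃ (Π-∀ p) e s y = downΠ₃ p (y ▸ e) (s (proj₁ y))

-- The hull satisfies RCA₀

module HullRCA (M : Structure) (rca : Sem.Models M RCA₀)
               (a : Structure.Dom M) (X U : Structure.Sets M) where
  open HullModel M rca a X U public
  open Env

  Sat-suc : ∀ {n m} (φ : Fm (suc n) m) {x ρ τ} → Sat (substF (λ i → sucσ i) φ) (x ▹ ρ) τ ⟷ Sat φ ((x + 1#) ▹ ρ) τ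
  Sat-suc φ = Sat-subst _ φ (λ { zero → ≈-refl ; (suc i) → ≈-refl })

  -- A failure of the induction step in M is a Σ₁ condition conjoined with a Π₁ condition, hence Σ₂;
  -- it would already occur at an element of 𝒦. Thus induction in M applies and is restricted to 𝒦
  -- afterwards.
  𝒦-step : ∀ {n m} {φ : Fm (suc n) m} → Σ⁰ 1 φ → (e : Env n m) →
           (∀ x → SatK φ (x ▸ e) → SatK (substF (λ i → sucσ i) φ) (x ▸ e)) →
           ∀ x → Sat φ (x ▹ ρM e) (τM e) → Sat φ ((x + 1#) ▹ ρM e) (τM e)
  𝒦-step {n} {m} {φ} p e step x s with nfΣ₁ p
  ... | θ , d , c = Sat-stable φ (λ ns → witness N e (λ k → k (x , s , λ s' → ns (proj₁ (Sat-suc φ) s')))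
      (λ (y , s₁ , s₂) → s₂ (proj₂ (Sat-suc φ) (proj₁ (shift y) (step y (downΣ₁ p (y ▸ e) s₁))))))
    where
    shift : ∀ y → SatK (substF (λ i → sucσ i) φ) (y ▸ e) ⟷ Sat φ ((proj₁ y + 1#) ▹ ρM e) (τM e)
    shift y = ⟷-trans (𝒮.Sat-subst _ φ {ρ' = y+1 ▹ ρ e} (λ { zero → ≈-refl ; (suc i) → ≈-refl })) (upΣ₁ p (y+1 ▸ e) ,
      downΣ₁ p (y+1 ▸ e))
      where y+1 = 𝒮.eval (v0 ⊕ `1) (y ▹ ρ e)
    τ₁ : Fin (suc (suc n)) → Tm (suc (suc (suc n)))
    τ₁ = v0 ▹ (v2 ⊕ `1) ▹ (λ i → var (suc (suc (suc i))))
    N : NF (φ ∧̇ ¬̇ substF (λ i → sucσ i) φ)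
    N = record
      { matrix = wkN θ ∧̇ ¬̇ substF τ₁ θ
      ; isΔ₀ = d-∧ (Δ₀-subst _ d) (d-⇒ (Δ₀-subst τ₁ d) d-⊥)
      ; correct = λ r t →
         (λ (s , ns) k → proj₁ (c r t) s (λ (v , sv) → k (v , λ w → proj₂ (Sat-wkN θ) sv , λ sw →
            ns (proj₂ (Sat-subst _ φ (λ _ → ≈-refl)) (proj₂ (c _ t) (λ k → k (w , proj₁ (iff w v r t) sw))))))) ,
         (λ h → proj₂ (c r t) (¬¬-map (λ (v , f) → v , proj₁ (Sat-wkN θ) (proj₁ (f 0#))) h) ,
                (λ s → h (λ (v , f) → proj₁ (c _ t) (proj₁ (Sat-subst _ φ (λ _ → ≈-refl)) s) (λ (w , sw) →
                    proj₂ (f w) (proj₂ (iff w v r t) sw))))) }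
      where
      iff : ∀ w v r t → Sat (substF τ₁ θ) (w ▹ v ▹ r) t ⟷ Sat θ (w ▹ (λ i → eval (sucσ i) r)) t
      iff w v r t = Sat-subst τ₁ θ (λ { zero → ≈-refl ; 1F → ≈-refl ; (suc (suc i)) → ≈-refl })

  𝒦-ind : ∀ {n m} {φ : Fm (suc n) m} → Σ⁰ 1 φ → (e : Env n m) → SatK (φ [ `0 ]ₙ) e →
          (∀ x → SatK φ (x ▸ e) → SatK (substF (λ i → sucσ i) φ) (x ▸ e)) → ∀ x → SatK φ (x ▸ e)
  𝒦-ind {φ = φ} p e base step x = downΣ₁ p (x ▸ e)
    (induction p (ρM e) (τM e) (upΣ₁ p (𝒮.eval `0 (ρ e) ▸ e) (proj₁ (𝒮.Sat-[] φ `0) base)) (𝒦-step p e step)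
      (proj₁ x))

  module Comprehension {n m : ℕ} {φ ψ : Fm (suc n) m} (p : Σ⁰ 1 φ) (q : Π⁰ 1 ψ) (e : Env n m)
                       (φ⇔ψ : ∀ x → SatK (φ ⇔ ψ) (x ▸ e)) where
    θφ θψ : Fm (suc (suc n)) m
    θφ = proj₁ (nfΣ₁ p)
    θψ = proj₁ (nfΠ₁ q)
    dφ : Δ₀ θφ
    dφ = proj₁ (proj₂ (nfΣ₁ p))
    dψ : Δ₀ θψ
    dψ = proj₁ (proj₂ (nfΠ₁ q))
    cφ : ∀ r t → Sat φ r t ⟷ (¬ ¬ (Σ Dom λ w → Sat θφ (w ▹ r) t))
    cφ = proj₂ (proj₂ (nfΣ₁ p))
    cψ : ∀ r t → Sat ψ r t ⟷ (∀ w → Sat θψ (w ▹ r) t)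
    cψ = proj₂ (proj₂ (nfΠ₁ q))

    N₁ : NF (φ ∧̇ ¬̇ ψ)
    N₁ = record
      { matrix = splitV 1F body
      ; isΔ₀ = splitV-Δ₀ 1F (d-∧ (Δ₀-subst _ dφ) (d-⇒ (Δ₀-subst _ dψ) d-⊥))
      ; correct = λ r t →
          (λ (s , ns) k → proj₁ (cφ r t) s (λ (v , sv) → ns (proj₂ (cψ r t) (λ v' → Sat-stable θψ (λ nv' →
             k (⟪ v , v' ⟫ , λ w → proj₂ (iff r t ≈-refl) (sv , nv'))))))) ,
          (λ h → Sat-stable (φ ∧̇ ¬̇ ψ) (λ k → h (λ (pq , f) → splitV-elim 1F body (f 0#) (λ (v , v' , e , _) →
             let (s , ns) = proj₁ (iff r t e) (f 0#) in k (proj₂ (cφ r t) (λ k → k (v , s)) , λ sψ → ns (proj₁ (cψ r t) sψ v')))))) }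
      where
      σφ σψ : Fin (suc (suc n)) → Tm (suc (suc (suc (suc (suc n)))))
      σφ = v1 ▹ (λ i → var (suc (suc (suc (suc i)))))
      σψ = v0 ▹ (λ i → var (suc (suc (suc (suc i)))))
      body : Fm (suc (suc (suc (suc (suc n))))) m
      body = substF σφ θφ ∧̇ ¬̇ substF σψ θψ
      iff : ∀ r t {w p v v'} → p ≈ ⟪ v , v' ⟫ → Sat (splitV 1F body) (w ▹ p ▹ r) t ⟷
        (Sat θφ (v ▹ r) t × ¬ Sat θψ (v' ▹ r) t)
      iff r t {w} {p} {v} {v'} e = ⟷-trans (splitV-intro 1F body {w ▹ p ▹ r} e)
        (×-⟷ (Sat-subst σφ θφ {v' ▹ v ▹ w ▹ p ▹ r} {v ▹ r} (λ { zero → ≈-refl ; (suc i) → ≈-refl }))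
             (→-⟷ (Sat-subst σψ θψ {v' ▹ v ▹ w ▹ p ▹ r} {v' ▹ r} (λ { zero → ≈-refl ; (suc i) → ≈-refl })) ⟷-refl))

    N₂ : NF (ψ ∧̇ ¬̇ φ)
    N₂ = record
      { matrix = substF σ (θψ ∧̇ ¬̇ θφ)
      ; isΔ₀ = Δ₀-subst σ (d-∧ dψ (d-⇒ dφ d-⊥))
      ; correct = λ r t →
          (λ (s , ns) k → k (0# , λ w → proj₂ (iff r t w 0#) (proj₁ (cψ r t) s w , λ sw →
            ns (proj₂ (cφ r t) (λ k → k (w , sw)))))) ,
          (λ h → Sat-stable (ψ ∧̇ ¬̇ φ) (λ k → h (λ (v , f) → k
             (proj₂ (cψ r t) (λ w → proj₁ (proj₁ (iff r t w v) (f w))) ,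
              λ s → proj₁ (cφ r t) s (λ (w , sw) → proj₂ (proj₁ (iff r t w v) (f w)) sw))))) }
      where
      σ : Fin (suc (suc n)) → Tm (suc (suc (suc n)))
      σ = v0 ▹ (λ i → var (suc (suc i)))
      iff : ∀ r t w v → Sat (substF σ (θψ ∧̇ ¬̇ θφ)) (w ▹ v ▹ r) t ⟷ Sat (θψ ∧̇ ¬̇ θφ) (w ▹ r) t
      iff r t w v = Sat-subst σ (θψ ∧̇ ¬̇ θφ) {ρ' = w ▹ r} (λ { zero → ≈-refl ; (suc i) → ≈-refl })

    -- A number in M where the two formulas disagree would satisfy a Σ₂ formula, so there would be
    -- one in 𝒦.
    φ⇔ψM : ∀ x → Sat φ (x ▹ ρM e) (τM e) ⟷ Sat ψ (x ▹ ρM e) (τM e)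
    φ⇔ψM x =
      (λ s → Sat-stable ψ (λ ns → witness N₁ e (λ k → k (x , s , ns))
        (λ (y , s , ns) → ns (upΠ₁ q (y ▸ e) (proj₁ (φ⇔ψ y) (downΣ₁ p (y ▸ e) s)))))) ,
      (λ s → Sat-stable φ (λ ns → witness N₂ e (λ k → k (x , s , ns))
        (λ (y , s , ns) → ns (upΣ₁ p (y ▸ e) (proj₂ (φ⇔ψ y) (downΠ₁ q (y ▸ e) s))))))

    -- kern (v, i, c): v witnesses that c decides correctly whether i satisfies φ
    kern : Fm (suc (suc (suc n))) m
    kern = (substF (v2 ▹ v1 ▹ ε) memF ∧̇ substF σ θφ) ∨̇ (¬̇ substF (v2 ▹ v1 ▹ ε) memF ∧̇ ¬̇ substF σ θψ)
      where
      σ : Fin (suc (suc n)) → Tm (suc (suc (suc n)))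
      σ = v0 ▹ v1 ▹ (λ i → var (suc (suc (suc i))))
    kern-Δ₀ : Δ₀ kern
    kern-Δ₀ = d-∨ (d-∧ (Δ₀-subst (v2 ▹ v1 ▹ ε) memF-Δ₀) (Δ₀-subst _ dφ))
                  (d-∧ (d-⇒ (Δ₀-subst (v2 ▹ v1 ▹ ε) memF-Δ₀) d-⊥) (d-⇒ (Δ₀-subst _ dψ) d-⊥))
    Sat-kern : ∀ v i c → Sat kern (v ▹ i ▹ c ▹ ρM e) (τM e) ⟷
               (¬ ¬ ((CodeMem c i × Sat θφ (v ▹ i ▹ ρM e) (τM e)) ⊎ (¬ CodeMem c i × ¬ Sat θψ (v ▹ i ▹ ρM e) (τM e))))
    Sat-kern v i c = ¬¬⊎-⟷ (×-⟷ mem (Sat-subst _ θφ {ρ' = v ▹ i ▹ ρM e} (λ { zero → ≈-refl ; 1F →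
      ≈-refl ; (suc (suc i)) → ≈-refl })))
      (×-⟷ (→-⟷ mem ⟷-refl) (→-⟷ (Sat-subst _ θψ {ρ' = v ▹ i ▹ ρM e} (λ { zero → ≈-refl ; 1F →
        ≈-refl ; (suc (suc i)) → ≈-refl })) ⟷-refl))
      where
      mem : Sat (substF (v2 ▹ v1 ▹ ε) memF) (v ▹ i ▹ c ▹ ρM e) (τM e) ⟷ CodeMem c i
      mem = ⟷-trans (Sat-subst (v2 ▹ v1 ▹ ε) memF {v ▹ i ▹ c ▹ ρM e} {c ▹ i ▹ ε} {τM e} (λ { zero → ≈-refl ; 1F →
        ≈-refl }))
                    (Sat-memF c i {τM e})

    σk : Fin (suc (suc (suc n))) → Tm (6 +ℕ n)
    σk = v0 ▹ v1 ▹ v3 ▹ (λ i → var (suc (suc (suc (suc (suc (suc i)))))))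
    body : Fm (4 +ℕ n) m
    body = ∀ₙ (v0 ≺ v1 ⇒ ∃ₙ (v0 ≺ v4 ∧̇ substF σk kern))
    θ : Fm (suc (suc n)) m
    θ = splitV 1F body
    θ-Δ₀ : Δ₀ θ
    θ-Δ₀ = splitV-Δ₀ 1F (d-b∀ v0 (d-b∃ v3 (Δ₀-subst σk kern-Δ₀)))
    Sat-θ : ∀ w c b → Sat θ (w ▹ ⟪ c , b ⟫ ▹ ρM e) (τM e) ⟷
            (∀ i → i < b → ¬ ¬ (Σ Dom λ v → v < w × Sat kern (v ▹ i ▹ c ▹ ρM e) (τM e)))
    Sat-θ w c b = ⟷-trans (splitV-intro 1F body {w ▹ ⟪ c , b ⟫ ▹ ρM e} ≈-refl)
      (Π-⟷ (λ i → →-⟷ ⟷-refl (¬¬Σ-⟷ (λ v → ×-⟷ ⟷-refl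
        (Sat-subst σk kern {v ▹ i ▹ b ▹ c ▹ w ▹ ⟪ c , b ⟫ ▹ ρM e} {v ▹ i ▹ c ▹ ρM e}
           (λ { zero → ≈-refl ; 1F → ≈-refl ; 2F → ≈-refl ; (suc (suc (suc i))) → ≈-refl }))))))

    -- Both answers to a membership question have Σ₁ certificates, one from `φ` and one from the
    -- negation of `ψ`. Collection in M bounds the certificates for all numbers below `b` at once,
    -- which makes being a code Σ₁.
    codes-θ : ∀ {Y} → (∀ i → i ∈ Y ⟷ Sat φ (i ▹ ρM e) (τM e)) → ∀ c b → Codes c Y b ⟷ Ex θ ⟪ c , b ⟫ (ρM e) (τM e)
    codes-θ {Y} hY c b =
      (λ h k → collection kern-Δ₀ (c ▹ ρM e) (τM e) b
        (λ i l k → em (i ∈ Y) (λ k → k (λ x → x))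
          (λ iY → proj₁ (cφ _ _) (proj₁ (hY i) iY) (λ (v , s) → k (v , proj₂ (Sat-kern v i c) (λ k →
            k (inj₁ (proj₁ (h i l) iY , s))))))
          (λ niY → niY (proj₂ (hY i) (proj₂ (φ⇔ψM i) (proj₂ (cψ _ _) (λ v → Sat-stable θψ (λ ns →
                 k (v , proj₂ (Sat-kern v i c) (λ k → k (inj₂ ((λ m → niY (proj₂ (h i l) m)) , ns)))))))))))
        (λ (u , f) → k (u , proj₂ (Sat-θ u c b) f))) ,
      (λ h i l →
        (λ iY k → h (λ (w , s) → proj₁ (Sat-θ w c b) s i l (λ (v , _ , s') → proj₁ (Sat-kern v i c) s' (λ
           { (inj₁ (m , _)) → m k
           ; (inj₂ (_ , ns)) → ns (proj₁ (cψ _ _) (proj₁ (φ⇔ψM i) (proj₁ (hY i) iY)) v) })))) ,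
        (λ m → ∈-stable (λ k → h (λ (w , s) → proj₁ (Sat-θ w c b) s i l (λ (v , _ , s') → proj₁ (Sat-kern v i c) s' (λ
           { (inj₁ (_ , s'')) → k (proj₂ (hY i) (proj₂ (cφ _ _) (λ k → k (v , s''))))
           ; (inj₂ (nm , _)) → nm m }))))))

    comprehend : SatK (∃ₛ (∀ₙ ((var zero ∈̇ zero) ⇔ wkS φ))) e
    comprehend k =
      proj₁ (Sat-close (∀ₙ (φ ⇔ ψ) ⇒ ∃ₛ (∀ₙ ((var zero ∈̇ zero) ⇔ wkS φ)))) (rca _ (comp φ ψ p q)) (ρM e) (τM e) φ⇔ψM
        (λ (Y , hY) → let hY' = λ i → ⟷-trans (hY i) (Sat-wkS φ) in
          k ((Y , λ k → translate θ-Δ₀ (ρM e) (K-env e) (τM e) (H-env e) (λ (g , kg , χ , dχ , f) →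
                 k (g , χ , kg , dχ , λ c b → ⟷-trans (codes-θ hY' c b) (f ⟪ c , b ⟫)))) ,
             λ x → ⟷-trans (hY' (proj₁ x)) (⟷-trans (downΣ₁ p (x ▸ e) , upΣ₁ p (x ▸ e)) (⟷-sym (𝒮.Sat-wkS φ)))))

  𝒦-RCA₀ : 𝒮.Models RCA₀
  𝒦-RCA₀ _ b1 x = rca _ b1 (proj₁ x)
  𝒦-RCA₀ _ b2 x y = rca _ b2 (proj₁ x) (proj₁ y)
  𝒦-RCA₀ _ b3 x = rca _ b3 (proj₁ x)
  𝒦-RCA₀ _ b4 x y = rca _ b4 (proj₁ x) (proj₁ y)
  𝒦-RCA₀ _ b5 x = rca _ b5 (proj₁ x)
  𝒦-RCA₀ _ b6 x y = rca _ b6 (proj₁ x) (proj₁ y)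
  𝒦-RCA₀ _ b7 x = rca _ b7 (proj₁ x)
  𝒦-RCA₀ _ b8 x y = rca _ b8 (proj₁ x) (proj₁ y)
  𝒦-RCA₀ _ (ind φ p) = proj₂ (𝒮.Sat-close ((φ [ `0 ]ₙ ∧̇ ∀ₙ (φ ⇒ substF (λ i → sucσ i) φ)) ⇒ ∀ₙ φ))
    (λ ρ τ (base , step) → 𝒦-ind p (env ρ τ) base step)
  𝒦-RCA₀ _ (comp φ ψ p q) = proj₂ (𝒮.Sat-close (∀ₙ (φ ⇔ ψ) ⇒ ∃ₛ (∀ₙ ((var zero ∈̇ zero) ⇔ wkS φ))))
    (λ ρ τ h → Comprehension.comprehend p q (env ρ τ) h)

-- Failure of bounding

¬¬-choice : ∀ {n} {P : Fin n → Set} → (∀ i → ¬ ¬ P i) → ¬ ¬ (∀ i → P i)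
¬¬-choice {zero} h k = k (λ ())
¬¬-choice {suc n} h k = h zero (λ p → ¬¬-choice (λ i → h (suc i)) (λ f → k (λ { zero → p ; (suc i) → f i })))

module Pigeon (N : Structure) (rca : Sem.Models N RCA₀) (zF : Fm 3 2) (zF-Δ₀ : Δ₀ zF)
              (τ : Fin 2 → Structure.Sets N) where
  open Arith N rca

  Z : Dom → Dom → Dom → Set
  Z e p w = Sat zF (w ▹ p ▹ e ▹ ε) τ

  -- The graph sending an index to its least solution, with all unbounded quantifiers cut off at
  -- `n`. It may be wrong as an approximation, but for fixed `n` it is a partial function, and that
  -- suffices for counting.
  G : Dom → Dom → Dom → Set
  G n e p = (∀ w → w < n → Z e p w) × (∀ q → q < p → ¬ ¬ (Σ Dom λ w → w < n × ¬ Z e q w))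

  Covered : Dom → Dom → Set
  Covered k n = ∀ x → x < k + 1# → ¬ ¬ (Σ Dom λ e → e < k × ¬ ¬ (Σ Dom λ r → r < n × G n e ⟪ x , r ⟫))

  Covered-cong : ∀ {k k' n} → k ≈ k' → Covered k n → Covered k' n
  Covered-cong e h x l = ¬¬-map (λ (d , l' , f) → d , <-cong ≈-refl e l' , f)
    (h x (<-cong ≈-refl (+-cʳ 1# (≈-sym e)) l))

  G-cong : ∀ {n e e' p} → e ≈ e' → G n e p → G n e' p
  G-cong {n} {e} {e'} ee (h , u) =
    (λ w l → zc ee (h w l)) , (λ q l → ¬¬-map (λ (w , l' , n) → w , l' , λ z → n (zc (≈-sym ee) z)) (u q l))
    where
    zc : ∀ {e e' p w} → e ≈ e' → Z e p w → Z e' p w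
    zc ee = Sat-congᵥ zF (▹-≈ ≈-refl (▹-≈ ≈-refl (▹-≈ ee (λ _ → ≈-refl))))

  G-functional : ∀ {n e p p'} → G n e p → G n e p' → p ≈ p'
  G-functional {p = p} {p'} (h , u) (h' , u') = use ≈-stable (compare p p') (λ
    { (inj₁ l) → ⊥-elim (u' p l (λ (w , lw , n) → n (h w lw)))
    ; (inj₂ (inj₁ e)) → e
    ; (inj₂ (inj₂ l)) → ⊥-elim (u p' l (λ (w , lw , n) → n (h' w lw))) })

  -- For standard `k` the pigeonhole principle is that of the metatheory: the `k + 1` standard
  -- numbers up to `k` would get distinct indices below `k`. Choosing the indices is a finite choice
  -- under double negation.
  ¬Covered-num : ∀ k n → ¬ Covered (num k) n
  ¬Covered-num k n h = ¬¬-choice {suc k} {λ i → Σ (Fin k) λ j → Σ Dom λ r → G n (num (toℕ j)) ⟪ num (toℕ i) , r ⟫}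
    (λ i c → h (num (toℕ i)) (num-< i) (λ (e , l , f) → f (λ (r , _ , g) → <num k l (λ (j , ej) →
      c (j , r , G-cong ej g)))))
    (λ f → let (i , i' , i<i' , eq) = pigeonhole (ℕₚ.n<1+n k) (λ i → proj₁ (f i))
               (ri , gi) = proj₂ (f i)
               (ri' , gi') = proj₂ (f i')
           in ℕₚ.<-irrefl (num-inj _ _ (proj₁ (pair-inj (G-functional gi
                (subst (λ j → G n (num (toℕ j)) ⟪ num (toℕ i') , ri' ⟫) (sym eq) gi'))))) i<i')

  Nonstandard : Dom → Set
  Nonstandard k = ∀ m → num m < k

  zσ : Fin 3 → Tm 8
  zσ = v0 ▹ pairT v3 v1 ▹ v2 ▹ ε
  zσ' : Fin 3 → Tm 9
  zσ' = v0 ▹ v1 ▹ v3 ▹ ε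
  gF : Fm 7 2
  gF = ∀ₙ (v0 ≺ v4 ⇒ substF zσ zF) ∧̇ ∀ₙ (v0 ≺ pairT v3 v1 ⇒ ∃ₙ (v0 ≺ v5 ∧̇ ¬̇ substF zσ' zF))
  coveredF : Fm 4 2
  coveredF = ∀ₙ (v0 ≺ v2 ⊕ `1 ⇒ ∃ₙ (v0 ≺ v3 ∧̇ ∃ₙ (v0 ≺ v3 ∧̇ gF)))
  coveredF-Δ₀ : Δ₀ coveredF
  coveredF-Δ₀ = d-b∀ (v1 ⊕ `1) (d-b∃ v2 (d-b∃ v2 (d-∧ (d-b∀ v3 (Δ₀-subst zσ zF-Δ₀))
    (d-b∀ (pairT v2 v0) (d-b∃ v4 (d-⇒ (Δ₀-subst zσ' zF-Δ₀) d-⊥))))))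
  Sat-coveredF : ∀ n k j k₀ → Sat coveredF (n ▹ k ▹ j ▹ k₀ ▹ ε) τ ⟷ Covered k n
  Sat-coveredF n k j k₀ = Π-⟷ (λ x → →-⟷ ⟷-refl (¬¬Σ-⟷ (λ e → ×-⟷ ⟷-refl (¬¬Σ-⟷ (λ r → ×-⟷ ⟷-refl (×-⟷
    (Π-⟷ (λ w → →-⟷ ⟷-refl (Sat-subst zσ zF {w ▹ r ▹ e ▹ x ▹ n ▹ k ▹ j ▹ k₀ ▹ ε} {w ▹ ⟪ x , r ⟫ ▹ e ▹ ε}
       (λ { zero → ≈-refl ; 1F → ≈-refl ; 2F → ≈-refl }))))
    (Π-⟷ (λ q → →-⟷ ⟷-refl (¬¬Σ-⟷ (λ w → ×-⟷ ⟷-refl (→-⟷ (Sat-subst zσ' zF {w ▹ q ▹ r ▹ e ▹ x ▹ n ▹ k ▹ j ▹ k₀ ▹ ε}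
      {w ▹ q ▹ e ▹ ε}
       (λ { zero → ≈-refl ; 1F → ≈-refl ; 2F → ≈-refl })) ⟷-refl)))))))))))

  -- Σ₁ induction downwards from k₀: the set of k with ∃n Covered k n would have no least element.
  descent : (∀ k → Nonstandard k → ¬ ¬ (Σ Dom λ n → Covered k n)) → ∀ k₀ → ¬ Nonstandard k₀
  descent h k₀ ns = go (k₀ + 1#) (λ (k , f) → f (λ (n , e , _) →
      <-irrefl (+⇒< k (solve 2 (λ k k₀ → k₀ :+ (k :+ con 1) := k :+ (k₀ :+ con 1)) ≈-refl k k₀ ∙ e))))
    where
    -- A covered number is not standard, so neither is its predecessor.
    pred-ns : ∀ {k k' n} → k ≈ k' + 1# → Covered k n → Nonstandard k'
    pred-ns {k} {k'} {n} e c m = use <-stable (compare (num m) k') (λ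
      { (inj₁ l) → l
      ; (inj₂ (inj₁ l)) → ⊥-elim (¬Covered-num (suc m) n (Covered-cong (e ∙ +-cʳ 1# (≈-sym l)) c))
      ; (inj₂ (inj₂ l)) → ⊥-elim (<num m l (λ (j , ej) → ¬Covered-num (suc (toℕ j)) n (Covered-cong (e ∙ +-cʳ 1# ej)
        c))) })
    -- `j` counts the steps taken down from `k₀`. Nonstandardness is not expressible in the model,
    -- and being covered, a Σ₁ property, stands in for it. After `k₀ + 1#` steps the equation is
    -- absurd.
    go : ∀ j → Sat (∃ₙ (∃ₙ (v1 ⊕ v2 ≐ v3 ∧̇ coveredF))) (j ▹ k₀ ▹ ε) τ
    go = induction {φ = ∃ₙ (∃ₙ (v1 ⊕ v2 ≐ v3 ∧̇ coveredF))} (Σ-∃ (Σ-∃ (Δ₀⇒Σ₁ (d-∧ d-≐ coveredF-Δ₀)))) (k₀ ▹ ε) τ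
      (λ c → h k₀ ns (λ (n , f) → c (k₀ , λ c → c (n , +-0 k₀ , proj₂ (Sat-coveredF n k₀ 0# k₀) f))))
      (λ j s c → s (λ (k , s) → s (λ (n , e , f) →
        let f' = proj₁ (Sat-coveredF n k j k₀) f in
        zero-or-suc k (λ
          { (inj₁ k≈0) → ¬Covered-num 0 n (Covered-cong k≈0 f')
          ; (inj₂ (k' , k≈)) → h k' (pred-ns k≈ f') (λ (n' , g) → c (k' , λ c → c (n' ,
              (solve 2 (λ k j → k :+ (j :+ con 1) := (k :+ con 1) :+ j) ≈-refl k' j ∙ +-cʳ j (≈-sym k≈) ∙ e) ,
              proj₂ (Sat-coveredF n' k' (j + 1#) k₀) g))) }))))

-- A Π₁ formula that is universal at standard indices

module Index (M : Structure) (rca : Sem.Models M RCA₀) (a : Structure.Dom M) (X U : Structure.Sets M) where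
  open HullRCA M rca a X U public

  -- The formula that replaces a membership atom mentions no set and has bound zero, so removing one
  -- set leaves the bound for the other intact.
  bnd-elimF : ∀ {n m} {c : Tm n} {φ : Fm n (suc m)} (p : Δ₀ φ) ρ → eval (bnd (elimF-Δ₀ {c = c} p)) ρ ≤ eval (bnd p) ρ
  bnd-elimF-under : ∀ {n m} {c : Tm n} (t : Tm n) {φ : Fm (suc n) (suc m)} (p : Δ₀ φ) ρ →
                    eval (substT (single t) (bnd (elimF-Δ₀ {c = wkT c} p))) ρ ≤ eval (substT (single t) (bnd p)) ρ
  bnd-elimF d-≐ ρ = ≤-refl
  bnd-elimF d-≺ ρ = ≤-refl
  bnd-elimF {m = m} {c} (d-∈ {t = t} {zero}) ρ =
    ≤-trans (≈⇒≤ (bnd-subst (c ▹ t ▹ ε) (memF-Δ₀ {m}) {ρ} {eval c ρ ▹ eval t ρ ▹ ε} (λ { zero → ≈-refl ; 1F →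
      ≈-refl }) ∙ +-0 0#)) 0≤
  bnd-elimF (d-∈ {X = suc X}) ρ = ≤-refl
  bnd-elimF d-⊥ ρ = ≤-refl
  bnd-elimF (d-⇒ p q) ρ = +-mono-≤ (bnd-elimF p ρ) (bnd-elimF q ρ)
  bnd-elimF (d-∧ p q) ρ = +-mono-≤ (bnd-elimF p ρ) (bnd-elimF q ρ)
  bnd-elimF (d-∨ p q) ρ = +-mono-≤ (bnd-elimF p ρ) (bnd-elimF q ρ)
  bnd-elimF (d-b∀ t p) ρ = bnd-elimF-under t p ρ
  bnd-elimF (d-b∃ t p) ρ = bnd-elimF-under t p ρ
  bnd-elimF-under t p ρ =
    ≤-trans (≈⇒≤ (eval-subst (single t) (bnd (elimF-Δ₀ p)) {ρ} {eval t ρ ▹ ρ} (λ { zero → ≈-refl ; (suc i) →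
      ≈-refl })))
      (≤-trans (bnd-elimF p (eval t ρ ▹ ρ))
        (≈⇒≤ (≈-sym (eval-subst (single t) (bnd p) {ρ} {eval t ρ ▹ ρ} (λ { zero → ≈-refl ; (suc i) → ≈-refl })))))

  quad : Dom → Dom → Dom → Dom → Dom
  quad p b s t = ⟪ p , ⟪ b , ⟪ s , t ⟫ ⟫ ⟫

  -- The pure formula (a, quad p b s t) that evaluates θ at p below b, reading X and U off the codes s and t.
  module Pure (θ : Fm 3 2) (d : Δ₀ θ) where
    σ : Fin 3 → Tm 9
    σ = v0 ▹ v6 ▹ v7 ▹ ε
    θ° : Fm 9 0
    θ° = elimF v1 (elimF v2 (substF σ θ))
    body : Fm 8 0
    -- Instances that might ask about numbers beyond the coded segments pass vacuously; a larger `b`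
    -- tests them.
    body = ∀ₙ (v0 ≺ v4 ⇒ substT σ (bnd d) ≺ v4 ⊕ `1 ⇒ θ°)
    l₂ : Fm 6 0
    l₂ = splitV zero body
    l₁ : Fm 4 0
    l₁ = splitV zero l₂
    pureF : Fm 2 0
    pureF = splitV 1F l₁
    pureF-Δ₀ : Δ₀ pureF
    pureF-Δ₀ = splitV-Δ₀ 1F (splitV-Δ₀ zero (splitV-Δ₀ zero
      (d-b∀ v3 (d-⇒ d-≺ (elimF-Δ₀ (elimF-Δ₀ (Δ₀-subst σ d)))))))

    Sat-pureF : ∀ p b s t → Codes s X b → Codes t U b →
      Sat pureF (a ▹ (quad p b s t) ▹ ε) ε ⟷
      (∀ z → z < b → eval (bnd d) (z ▹ p ▹ a ▹ ε) ≤ b → Sat θ (z ▹ p ▹ a ▹ ε) τ₀)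
    Sat-pureF p b s t hs ht =
      ⟷-trans (splitV-intro 1F l₁ {a ▹ (quad p b s t) ▹ ε} ≈-refl)
      (⟷-trans (splitV-intro zero l₂ {⟪ b , ⟪ s , t ⟫ ⟫ ▹ p ▹ a ▹ (quad p b s t) ▹ ε} ≈-refl)
      (⟷-trans (splitV-intro zero body {⟪ s , t ⟫ ▹ b ▹ ⟪ b , ⟪ s , t ⟫ ⟫ ▹ p ▹ a ▹ (quad p b s t) ▹ ε} ≈-refl)
      (Π-⟷ (λ z → →-⟷ ⟷-refl (let h = eval-subst σ (bnd d) {ev z} {z ▹ p ▹ a ▹ ε} (σ-eval z) in
        (λ f l → proj₁ (iff z l) (f (≤-trans (≈⇒≤ h) l))) ,
        (λ f l → let l' = ≤-trans (≈⇒≤ (≈-sym h)) l in proj₂ (iff z l') (f l')))))))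
      where
      ev : Dom → Fin 9 → Dom
      ev z = z ▹ t ▹ s ▹ ⟪ s , t ⟫ ▹ b ▹ ⟪ b , ⟪ s , t ⟫ ⟫ ▹ p ▹ a ▹ (quad p b s t) ▹ ε
      σ-eval : ∀ z i → eval (σ i) (ev z) ≈ (z ▹ p ▹ a ▹ ε) i
      σ-eval z zero = ≈-refl
      σ-eval z (suc zero) = ≈-refl
      σ-eval z (suc (suc zero)) = ≈-refl
      iff : ∀ z → eval (bnd d) (z ▹ p ▹ a ▹ ε) ≤ b → Sat θ° (ev z) ε ⟷ Sat θ (z ▹ p ▹ a ▹ ε) τ₀
      iff z l = ⟷-trans
        (⟷-sym (elimF-correct (elimF-Δ₀ {c = v2} (Δ₀-subst σ d)) v1 {ev z} {ε} ht
          (≤-trans (bnd-elimF {c = v2} (Δ₀-subst σ d) (ev z)) l')))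
        (⟷-trans (⟷-sym (elimF-correct (Δ₀-subst σ d) v2 {ev z} {U ▹ ε} hs l'))
          (⟷-trans (Sat-cong (substF σ θ) (λ _ → ≈-refl) (λ { zero → refl ; 1F → refl })) (Sat-subst σ θ {τ = τ₀}
            (σ-eval z))))
        where
        l' : eval (bnd (Δ₀-subst σ d)) (ev z) ≤ b
        l' = ≤-trans (≈⇒≤ (bnd-subst σ d (σ-eval z))) l

-- (w, p, e).  U enumerates set-free formulas only, since by diagonalization no set can enumerate the formulas about
-- itself; formulas about X and U are reached by passing codes s, t of their initial segments as arguments.
zF : Fm 3 2
zF = ∀ₙ (v0 ≺ v1 ⇒ ∀ₙ (v0 ≺ v2 ⇒ ∀ₙ (v0 ≺ v3 ⇒
       substF (v2 ▹ v1 ▹ ε) (codesF zero) ⇒ substF (v2 ▹ v0 ▹ ε) (codesF 1F) ⇒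
       pairT v5 (pairT v4 (pairT v2 (pairT v1 v0))) ∈̇ suc zero)))

zF-Δ₀ : Δ₀ zF
zF-Δ₀ = d-b∀ v0 (d-b∀ v1 (d-b∀ v2 (d-⇒ (Δ₀-subst (v2 ▹ v1 ▹ ε) (codesF-Δ₀ zero))
          (d-⇒ (Δ₀-subst (v2 ▹ v0 ▹ ε) (codesF-Δ₀ 1F)) d-∈))))

module Universal (M : Structure) (rca : Sem.Models M RCA₀) (a : Structure.Dom M) (X U : Structure.Sets M)
                 (universal : ∀ e q → Structure._∈_ M (Arith.⟪_,_⟫ M rca (Arith.num M rca e) q) U ⟷
                                      Sem.Sat M (proj₁ (enumΔ e)) (a ▹ q ▹ ε) ε) where
  open Index M rca a X U

  Sat-zF : ∀ w p e → Sat zF (w ▹ p ▹ e ▹ ε) τ₀ ⟷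
           (∀ b → b < w → ∀ s → s < w → ∀ t → t < w → Codes s X b → Codes t U b → ⟪ e , (quad p b s t) ⟫ ∈ U)
  Sat-zF w p e = Π-⟷ (λ b → →-⟷ ⟷-refl (Π-⟷ (λ s → →-⟷ ⟷-refl (Π-⟷ (λ t → →-⟷ ⟷-refl (→-⟷
      (⟷-trans (Sat-subst (v2 ▹ v1 ▹ ε) (codesF zero) {t ▹ s ▹ b ▹ w ▹ p ▹ e ▹ ε} {b ▹ s ▹ ε} {τ₀}
        (λ { zero → ≈-refl ; 1F → ≈-refl }))
               (Sat-codesF zero b s τ₀))
      (→-⟷ (⟷-trans (Sat-subst (v2 ▹ v0 ▹ ε) (codesF 1F) {t ▹ s ▹ b ▹ w ▹ p ▹ e ▹ ε} {b ▹ t ▹ ε} {τ₀}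
        (λ { zero → ≈-refl ; 1F → ≈-refl }))
                    (Sat-codesF 1F b t τ₀))
           ⟷-refl)))))))

  index-at : ∀ {θ : Fm 3 2} (d : Δ₀ θ) (e : ℕ) → enumΔ e ≡ (Pure.pureF θ d , Pure.pureF-Δ₀ θ d) →
             ∀ p → (∀ w → Sat zF (w ▹ p ▹ num e ▹ ε) τ₀) ⟷ Holds θ p a
  index-at {θ} d e eq p =
    -- `b` is chosen above `z` and above every membership question that `θ` asks at `z`, so that the
    -- instance at `z` is really tested.
    (λ h z → Sat-stable θ (λ k → let b = (z + eval (bnd d) (z ▹ p ▹ a ▹ ε)) + 1# in
      code-exists X b (λ (s , hs) → code-exists U b (λ (t , ht) →
        k (proj₁ (Sat-pureF p b s t hs ht)
             (proj₁ (univ (quad p b s t)) (proj₁ (Sat-zF ((b + s + t) + 1#) p (num e)) (h _)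
                b (≤-trans (≤-+ʳ b s) (≤-+ʳ _ t)) s (≤-trans (≤-+ˡ b s) (≤-+ʳ _ t)) t (≤-+ˡ _ t) hs ht))
             z (≤-+ʳ z _) (≤-trans (≤-+ˡ z _) (<⇒≤ x<x+1))))))) ,
    (λ h w → proj₂ (Sat-zF w p (num e)) (λ b _ s _ t _ hs ht →
       proj₂ (univ (quad p b s t)) (proj₂ (Sat-pureF p b s t hs ht) (λ z _ _ → h z))))
    where
    open Pure θ d
    univ : ∀ q → ⟪ num e , q ⟫ ∈ U ⟷ Sat pureF (a ▹ q ▹ ε) ε
    univ q = subst (λ x → ⟪ num e , q ⟫ ∈ U ⟷ Sat (proj₁ x) (a ▹ q ▹ ε) ε) eq (universal e q)


  index : ∀ {θ : Fm 3 2} → Δ₀ θ → Σ ℕ λ e → ∀ p → (∀ w → Sat zF (w ▹ p ▹ num e ▹ ε) τ₀) ⟷ Holds θ p a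
  index {θ} d = proj₁ code , index-at d (proj₁ code) (proj₂ code)
    where code = enumΔ-onto (Pure.pureF-Δ₀ θ d)

-- The bounding instance that fails in the hull

module Phi (zF : Fm 3 2) (zF-Δ₀ : Δ₀ zF) where

  -- Φ (v, x; k): for some e < k, some ⟪ x , r ⟫ < v is the least p with ∀w zF (w, p, e), and v bounds the
  -- refutations of all smaller p.
  Φ-matrix : Fm 6 2
  Φ-matrix = pairT v4 v2 ≺ v3 ∧̇ (v1 ≺ v5 ∧̇ (substF (v0 ▹ pairT v4 v2 ▹ v1 ▹ ε) zF ∧̇
               ∀ₙ (v0 ≺ pairT v5 v3 ⇒ ∃ₙ (v0 ≺ v5 ∧̇ ¬̇ substF (v0 ▹ v1 ▹ v3 ▹ ε) zF))))

  Φ : Fm 3 2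
  Φ = ∃ₙ (∃ₙ (∀ₙ Φ-matrix))

  Φ-Σ₂ : Σ⁰ 2 Φ
  Φ-Σ₂ = Σ-∃ (Σ-∃ (Σ-Π (Π-∀ (Π-Σ (Σ-Δ₀ (d-∧ d-≺ (d-∧ d-≺ (d-∧ (Δ₀-subst (v0 ▹ pairT v4 v2 ▹ v1 ▹ ε) zF-Δ₀)
           (d-b∀ (pairT v4 v2) (d-b∃ v4 (d-⇒ (Δ₀-subst (v0 ▹ v1 ▹ v3 ▹ ε) zF-Δ₀) d-⊥)))))))))))

  Sat-Φ-matrix : (N : Structure) (let open Structure N) (let open Sem N) → ∀ z e r v x k τ →
    Sat Φ-matrix (z ▹ e ▹ r ▹ v ▹ x ▹ k ▹ ε) τ ⟷
    (eval (pairT v0 v1) (x ▹ r ▹ ε) < v × e < k × Sat zF (z ▹ eval (pairT v0 v1) (x ▹ r ▹ ε) ▹ e ▹ ε) τ ×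
     (∀ q → q < eval (pairT v0 v1) (x ▹ r ▹ ε) → ¬ ¬ (Σ Dom λ w → w < v × ¬ Sat zF (w ▹ q ▹ e ▹ ε) τ)))
  Sat-Φ-matrix N z e r v x k τ = ×-⟷ ⟷-refl (×-⟷ ⟷-refl (×-⟷
      (Sat-subst (v0 ▹ pairT v4 v2 ▹ v1 ▹ ε) zF {z ▹ e ▹ r ▹ v ▹ x ▹ k ▹ ε} {z ▹ eval (pairT v0 v1) (x ▹ r ▹ ε) ▹ e ▹
        ε} {τ} (λ { zero → ≈-refl ; 1F → ≈-refl ; 2F → ≈-refl }))
      (Π-⟷ (λ q → →-⟷ ⟷-refl (¬¬Σ-⟷ (λ w → ×-⟷ ⟷-refl (→-⟷
        (Sat-subst (v0 ▹ v1 ▹ v3 ▹ ε) zF {w ▹ q ▹ z ▹ e ▹ r ▹ v ▹ x ▹ k ▹ ε} {w ▹ q ▹ e ▹ ε} {τ}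
          (λ { zero → ≈-refl ; 1F → ≈-refl ; 2F → ≈-refl })) ⟷-refl)))))))
    where open Structure N; open Sem N


module Failure (M : Structure) (rca : Sem.Models M RCA₀) (a : Structure.Dom M) (X U : Structure.Sets M)
               (a-large : ∀ k → Structure._<_ M (Arith.num M rca k) a) (zF : Fm 3 2) (zF-Δ₀ : Δ₀ zF)
               (index : ∀ {θ : Fm 3 2} → Δ₀ θ → Σ ℕ λ e → ∀ p →
                        (∀ w → Sem.Sat M zF (w ▹ p ▹ Arith.num M rca e ▹ ε) (X ▹ U ▹ ε)) ⟷ Hull.Holds M rca a X U θ p a) where
  open HullRCA M rca a X U public
  open Phi zF zF-Δ₀ public

  τK : Fin 2 → SetsK
  τK = (X , InHull-τ₀ zero) ▹ (U , InHull-τ₀ (suc zero)) ▹ ε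

  module A = Arith 𝒦 𝒦-RCA₀
  module P = Pigeon 𝒦 𝒦-RCA₀ zF zF-Δ₀ τK

  num-𝒦 : ∀ k → proj₁ (A.num k) ≈ num k
  num-𝒦 zero = ≈-refl
  num-𝒦 (suc k) = +-cʳ 1# (num-𝒦 k)

  -- An element of the hull has a standard index, which lies below the nonstandard `k`. Its defining
  -- pair is the only solution, so every smaller number is refuted, and collection in M bounds the
  -- refutations. The Σ₂ statement thus true in M passes down to 𝒦.
  Φ-total : ∀ k → P.Nonstandard k → ∀ x → ¬ ¬ (Σ DomK λ v → 𝒮.Sat Φ (v ▹ x ▹ k ▹ ε) τK)
  Φ-total k ns x = downΣ₂ (Σ-∃ Φ-Σ₂) e sat
    where
    e : Env 2 2
    e = record { ρ = x ▹ k ▹ ε ; τ = τK ; ρM = proj₁ x ▹ proj₁ k ▹ ε ; τM = τ₀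
               ; ρ≈ = λ { zero → ≈-refl ; 1F → ≈-refl } ; τ≡ = λ { zero → refl ; 1F → refl } }
    sat : SatM (∃ₙ Φ) e
    sat c = proj₂ x (λ (r , θ , d , hθ , uθ) →
      let (i , f) = index d
          p = ⟪ proj₁ x , r ⟫
      in collection {φ = ¬̇ zF} (d-⇒ zF-Δ₀ d-⊥) (num i ▹ ε) τ₀ p
          (λ q l c → <-irrefl (<-cong (uθ q (proj₁ (f q) (λ w → Sat-stable zF {w ▹ q ▹ num i ▹ ε} {τ₀} (λ n →
            c (w , n))))) ≈-refl l))
          -- The witness for v has to exceed the pair `p` as well as the bound `u` on the
          -- refutations.
          (λ (u , g) → c ((p + u) + 1# , λ c → c (r , λ c → c (num i , λ z →
             proj₂ (Sat-Φ-matrix M z (num i) r ((p + u) + 1#) (proj₁ x) (proj₁ k) τ₀)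
               (≤-+ʳ p u , <-cong (num-𝒦 i) ≈-refl (ns i) , proj₂ (f p) hθ z ,
                λ q l → ¬¬-map (λ (w , l' , n) → w , <-trans l' (≤-+ˡ p u) , n) (g q l)))))))

  -- A bound on v bounds the auxiliary component and all refutations along with it, so the Σ₂
  -- statement collapses to the Δ₀ statement `P.Covered`.
  ¬bounding : ¬ 𝒮.Sat (BoundingInstance Φ) ε ε
  ¬bounding B = P.descent covered (a , K-a) (λ m → <-cong (≈-sym (num-𝒦 m)) ≈-refl (a-large m))
    where
    covered : ∀ k → P.Nonstandard k → ¬ ¬ (Σ DomK λ n → P.Covered k n)
    -- Bounding is used at `k + 1`: the elements are the numbers up to `k` and the indices only
    -- those below `k`, one fewer.
    covered k ns c = proj₁ (𝒮.Sat-close χ) B (k ▹ ε) τK (Φ-total k ns) (k A.+ A.1#) (λ (n , h) →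
      c (n , λ x l c' → h x l (λ (v , v<n , s) →
        proj₁ (𝒮.Sat-subst shift₂ Φ {v ▹ x ▹ n ▹ (k A.+ A.1#) ▹ k ▹ ε} {v ▹ x ▹ k ▹ ε} {τK}
                 (λ { zero → ≈-refl ; 1F → ≈-refl ; 2F → ≈-refl })) s (λ (r , s) → s (λ (e , f) →
        let m = λ z → proj₁ (Sat-Φ-matrix 𝒦 z e r v x k τK) (f z)
            (p<v , e<k , _ , least) = m A.0#
        in c' (e , e<k , λ c → c (r , A.≤-<-trans {r} {A.⟪ x , r ⟫} {n} (A.≤-pair₂ x r) (A.<-trans {A.⟪ x , r ⟫} {v} {n} p<v v<n) ,
             (λ w _ → proj₁ (proj₂ (proj₂ (m w)))) ,
             (λ q l → ¬¬-map (λ (w , l' , nz) → w , A.<-trans {w} {v} {n} l' v<n , nz) (least q l)))))))))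
      where
      χ : Fm 1 2
      χ = ∀ₙ (∃ₙ Φ) ⇒ ∀ₙ (∃ₙ (∀ₙ ((var zero ≺ var (suc (suc zero))) ⇒
            ∃ₙ ((var zero ≺ var (suc (suc zero))) ∧̇ substF shift₂ Φ))))

-- Compactness

module Axioms (Ψ : Fm 0 2) where

  θ : ℕ → Fm 2 0
  θ k = proj₁ (enumΔ k)

  κ : Fin 2 → Fin 3
  κ = zero ▹ suc zero ▹ ε

  atΨ : Fm 1 2
  atΨ = ∀ₛ (renS κ (substF (λ ()) Ψ))

  atU : ℕ → Fm 1 2
  atU k = ∀ₙ (pairT (numT k) v0 ∈̇ suc zero ⇔ substF (v1 ▹ v0 ▹ ε) (renS (λ ()) (θ k)))

  b : ℕ → Fm 1 2
  b k = atΨ ∧̇ (numT k ≺ v0 ∧̇ atU k)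

  -- (x, a): x is ⟪ k , q ⟫ with θ k true of a and q, for some k < N
  disjunct : ℕ → Fm 4 0
  disjunct k = v1 ≐ numT k ∧̇ substF (v3 ▹ v0 ▹ ε) (θ k)

  disj : ℕ → Fm 2 0
  disj zero = ⊥̇
  disj (suc k) = disj k ∨̇ splitV zero (disjunct k)

  disj-Δ₀ : ∀ N → Δ₀ (disj N)
  disj-Δ₀ zero = d-⊥
  disj-Δ₀ (suc k) = d-∨ (disj-Δ₀ k) (splitV-Δ₀ zero (d-∧ d-≐ (Δ₀-subst (v3 ▹ v0 ▹ ε) (proj₂ (enumΔ k)))))

  module Facts (M : Structure) (rca : Sem.Models M RCA₀) where
    open Definable M rca public

    eval-numT : ∀ {n} k (ρ : Fin n → Dom) → eval (numT k) ρ ≈ num k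
    eval-numT zero ρ = ≈-refl
    eval-numT (suc k) ρ = +-cʳ 1# (eval-numT k ρ)

    Sat-atΨ : ∀ ρ τ → Sat atΨ ρ τ ⟷ (∀ Y → Sat Ψ ε (Y ▹ τ zero ▹ ε))
    Sat-atΨ ρ τ = Π-⟷ (λ Y → ⟷-trans (Sat-ren κ (substF (λ ()) Ψ) {τ' = Y ▹ τ zero ▹ ε} (λ { zero → refl ; 1F →
      refl })) (Sat-subst _ Ψ (λ ())))

    Sat-atU : ∀ k ρ τ → Sat (atU k) ρ τ ⟷ (∀ q → ⟪ num k , q ⟫ ∈ τ (suc zero) ⟷ Sat (θ k) (ρ zero ▹ q ▹ ε) ε)
    Sat-atU k ρ τ = Π-⟷ (λ q → ×-⟷ (→-⟷ (mem q) (val q)) (→-⟷ (val q) (mem q)))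
      where
      e : ∀ q → ⟪ eval (numT k) (q ▹ ρ) , q ⟫ ≈ ⟪ num k , q ⟫
      e q = pair-cong (eval-numT k (q ▹ ρ)) ≈-refl
      mem : ∀ q → Sat (pairT (numT k) v0 ∈̇ suc zero) (q ▹ ρ) τ ⟷ ⟪ num k , q ⟫ ∈ τ (suc zero)
      mem q = ∈-cong (e q) , ∈-cong (≈-sym (e q))
      val : ∀ q → Sat (substF (v1 ▹ v0 ▹ ε) (renS (λ ()) (θ k))) (q ▹ ρ) τ ⟷ Sat (θ k) (ρ zero ▹ q ▹ ε) ε
      val q = ⟷-trans (Sat-subst (v1 ▹ v0 ▹ ε) (renS (λ ()) (θ k)) {ρ' = ρ zero ▹ q ▹ ε} (λ { zero → ≈-refl ; 1F →
        ≈-refl }))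
                      (Sat-ren (λ ()) (θ k) (λ ()))

    Sat-disjunct : ∀ n k q a → Sat (splitV zero (disjunct n)) (⟪ num k , q ⟫ ▹ a ▹ ε) ε ⟷
      (num k ≈ num n × Sat (θ n) (a ▹ q ▹ ε) ε)
    Sat-disjunct n k q a = ⟷-trans (splitV-intro zero (disjunct n) {⟪ num k , q ⟫ ▹ a ▹ ε} {ε} {num k} {q} ≈-refl)
      (×-⟷ ((λ p → p ∙ eval-numT n _) , (λ p → p ∙ ≈-sym (eval-numT n _)))
           (Sat-subst (v3 ▹ v0 ▹ ε) (θ n) {ρ' = a ▹ q ▹ ε} (λ { zero → ≈-refl ; 1F → ≈-refl })))

    Sat-disj : ∀ N k q a → k <ℕ N → Sat (disj N) (⟪ num k , q ⟫ ▹ a ▹ ε) ε ⟷ Sat (θ k) (a ▹ q ▹ ε) ε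
    Sat-disj N k q a k<N = to N , from (ℕₚ.≤⇒≤′ k<N)
      where
      to : ∀ N → Sat (disj N) (⟪ num k , q ⟫ ▹ a ▹ ε) ε → Sat (θ k) (a ▹ q ▹ ε) ε
      to zero ()
      to (suc n) h = Sat-stable (θ k) (λ c → h (λ
        { (inj₁ s) → c (to n s)
        ; (inj₂ s) → let (e , s') = proj₁ (Sat-disjunct n k q a) s in
            c (subst (λ j → Sat (θ j) (a ▹ q ▹ ε) ε) (sym (num-inj k n e)) s') }))
      from : ∀ {N} → suc k ≤′ N → Sat (θ k) (a ▹ q ▹ ε) ε → Sat (disj N) (⟪ num k , q ⟫ ▹ a ▹ ε) ε
      from (≤′-reflexive refl) s c = c (inj₂ (proj₂ (Sat-disjunct k k q a) (≈-refl , s)))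
      from (≤′-step l) s c = c (inj₁ (from l s))

    -- The first `N` axioms ask only that a exceed the numerals below `N`, so the numeral `N` itself
    -- may serve as a. The required sections are united in one set by the Δ₀ formula `disj N`.
    finite : (X : Sets) → (∀ Y → Sat Ψ ε (Y ▹ X ▹ ε)) → ∀ N → ¬ ¬ (Σ Sets λ U → Sat (conj b N) (num N ▹ ε)
      (X ▹ U ▹ ε))
    finite X hX N c = proj₁ (Sat-close (∀ₙ (disj N ⇔ disj N) ⇒ ∃ₛ (∀ₙ ((var zero ∈̇ zero) ⇔ wkS (disj N)))))
        (rca _ (comp (disj N) (disj N) (Δ₀⇒Σ₁ (disj-Δ₀ N)) (Δ₀⇒Π₁ (disj-Δ₀ N)))) (num N ▹ ε) ε (λ _ → ⟷-refl)
        (λ (U , hU) → c (U , go U (λ x → ⟷-trans (hU x) (Sat-wkS (disj N))) N (λ k l → l)))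
      where
      go : ∀ U → (∀ x → x ∈ U ⟷ Sat (disj N) (x ▹ num N ▹ ε) ε) → ∀ L → (∀ k → k <ℕ L → k <ℕ N) → Sat (conj b L)
        (num N ▹ ε) (X ▹ U ▹ ε)
      go U hU zero l = λ x → x
      go U hU (suc L) l = go U hU L (λ k k<L → l k (ℕₚ.m<n⇒m<1+n k<L)) ,
        proj₂ (Sat-atΨ (num N ▹ ε) (X ▹ U ▹ ε)) hX ,
        <-cong (≡⇒≈ (cong num (toℕ-fromℕ< L<N)) ∙ ≈-sym (eval-numT L _)) ≈-refl (num-< (fromℕ< L<N)) ,
        proj₂ (Sat-atU L (num N ▹ ε) (X ▹ U ▹ ε)) (λ q → ⟷-trans (hU ⟪ num L , q ⟫) (Sat-disj N L q (num N) L<N))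
        where
        L<N : L <ℕ N
        L<N = l L (ℕₚ.n<1+n L)

strengthen : ∀ {T} → Pf T {1} {2} ⊥̇ → T ⊢ ⊥̇
strengthen p = mp (q∀V ⊥̇) (genN (mp (s∀V ⊥̇) (genS (mp (s∀V ⊥̇) (genS p)))))

theorem3p4 : (Ψ : Fm 0 2) → Π⁰ 3 Ψ →
    Consistent (RCA₀ +ₜ ∃ₛ (∀ₛ Ψ)) →
    ¬ ProvesBΣ 2 (RCA₀ +ₜ ∃ₛ (∀ₛ Ψ))
theorem3p4 Ψ Ψ-Π₃ con proves = ¬bounding (𝒮.soundness 𝒦-T (proves Φ Φ-Σ₂) ε ε)
  where
  T = RCA₀ +ₜ ∃ₛ (∀ₛ Ψ)
  open Axioms Ψ

  -- Completeness is used twice. Here, with trivial axioms in place of `b`, it gives some model of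
  -- `T`; finite parts of `b` hold in it for suitable values, so by soundness they are not
  -- refutable.
  consistent : ∀ N → ¬ Pf T (conj b N ⇒ ⊥̇)
  consistent N p = T-holds₀ _ (inj₂ refl) (λ (X , hX) → finite X hX N (λ (U , s) →
      soundness T-holds₀ p (num N ▹ ε) (X ▹ U ▹ ε) s))
    where
    trivial : ∀ N → Pf T {1} {2} (conj (λ _ → ⊤̇) N)
    trivial zero = Hilbert.idᵖ T
    trivial (suc N) = mp (mp (p∧I _ _) (trivial N)) (Hilbert.idᵖ T)
    open ModelOf (completeness T (λ _ → ⊤̇) (λ N p → con (strengthen (mp p (trivial N))))) renaming
      (M to M₀; T-holds to T-holds₀)
    open Facts M₀ (λ σ h → T-holds₀ σ (inj₁ h))

  open ModelOf (completeness T b consistent)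
  rca : Sem.Models M RCA₀
  rca σ h = T-holds σ (inj₁ h)
  module F = Facts M rca

  a = nums zero
  X = sets zero
  U = sets (suc zero)

  open Failure M rca a X U
    (λ k → F.<-cong {Sem.eval M (numT k) nums} {F.num k} {a} {a} (F.eval-numT k nums) (F.≈-refl {a})
      (proj₁ (proj₂ (b-holds k)))) zF zF-Δ₀
    (Universal.index M rca a X U (λ e → proj₁ (F.Sat-atU e nums sets) (proj₂ (proj₂ (b-holds e)))))

  𝒦-T : 𝒮.Models T
  𝒦-T σ (inj₁ h) = 𝒦-RCA₀ σ h
  -- The same `X` is the witness in 𝒦: a set `Y` of 𝒦 is one of M, where Ψ holds, and the Π₃ formula
  -- passes down.
  𝒦-T σ (inj₂ refl) c = c ((X , InHull-τ₀ zero) , λ Y → downΠ₃ Ψ-Π₃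
    (record { ρ = ε ; τ = Y ▹ (X , InHull-τ₀ zero) ▹ ε ; ρM = ε ; τM = proj₁ Y ▹ X ▹ ε
            ; ρ≈ = λ () ; τ≡ = λ { zero → refl ; 1F → refl } })
    (proj₁ (F.Sat-atΨ nums sets) (proj₁ (b-holds 0)) (proj₁ Y)))
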